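{- Let $G$ be a $d$-dimensional simplicial complex with Laplacian matrix $L_G=\partial_d^{G}\cdot(\partial_d^{G})^T$. Then, $x$ being an indeterminate, $$\sum_{(F,R)} |H_{d-1}(F,R)|^2\, x^{|R|}= \det(L_G+x\cdot \mathrm{Id}),$$ where the sum is over all rooted forests $(F,R)$ of $G$ and $\mathrm{Id}$ is the identity matrix of dimension $|G_{d-1}|$. More generally, let $\{x_r\}_{r\in G_{d-1}}$ and $\{y_f\}_{f\in G_{d}}$ be indeterminates indexed by the $(d-1)$-faces and the $d$-faces of $G$ respectively. Let $X$ (resp. $Y$) be the diagonal matrix with rows and columns indexed by $G_{d-1}$ (resp. $G_d$) whose diagonal entry in the row indexed by $r$ is $x_r$ (resp. in the row indexed by $f$ is $y_f$), and let $L_G^y=\partial_d^{G}\cdot Y\cdot (\partial_d^{G})^T$. Then $$\sum_{(F,R)} |H_{d-1}(F,R)|^2 \prod_{r\in R}x_r\prod_{f\in F}y_f= \det(L_G^y+X),$$ where the sum is over all rooted forests $(F,R)$ of $G$.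
   Context: A simplicial complex on $n$ vertices is a nonempty collection $G$ of subsets of $[n]=\{1,\dots,n\}$ closed under taking subsets; its elements are called faces. A $k$-face is a face of cardinality $k+1$ (so $\emptyset$ is the $(-1)$-face), $G_k$ is the set of $k$-faces, and the dimension $d\ge 0$ of $G$ is the maximal dimension of its faces. Incidence matrix: for $k\ge 0$, $\partial_k^{G}$ is the matrix with rows indexed by $G_{k-1}$ and columns indexed by $G_k$ whose entry $\partial_k^{G}[r,f]$ is $(-1)^j$ if $f=\{v_0,\dots,v_k\}$ with $v_0<\cdots<v_k$ and $r=f\setminus\{v_j\}$, and $0$ if $r\not\subset f$. It is also viewed as the boundary map sending combinations of $k$-faces to combinations of $(k-1)$-faces. A subset $F\subseteq G_d$ is a forest of $G$ if the columns of $\partial_d^{G}$ indexed by $F$ are linearly independent (over $\mathbb{R}$). For $R\subseteq G_{d-1}$ write $\overline{R}=G_{d-1}\setminus R$. For a forest $F$, let $\partial_d^{F}$ be the submatrix of $\partial_d^{G}$ with columns indexed by $F$ and all rows indexed by $G_{d-1}$; $R$ is a root of $F$ if the rows of $\partial_d^{F}$ indexed by $\overline{R}$ form a basis of the row space of $\partial_d^{F}$. A rooted forest of $G$ is a pair $(F,R)$ where $F\subseteq G_d$ is a forest of $G$ (possibly empty) and $R\subseteq G_{d-1}$ is a root of $F$. Relative homology: for $F\subseteq G_d$ and $R\subseteq G_{d-1}$, let $\Psi_{F,R}:\mathbb{Z}F\to \mathbb{Z}G_{d-1}/\mathbb{Z}R$ be the group homomorphism $x\mapsto \partial_d^{G}(x)+\mathbb{Z}R$,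 where $\mathbb{Z}S$ denotes the free abelian group on a set $S$. Then $H_{d-1}(F,R)=\operatorname{coker}\Psi_{F,R}=(\mathbb{Z}G_{d-1}/\mathbb{Z}R)/\operatorname{Im}(\Psi_{F,R})$, and $|H_{d-1}(F,R)|$ is its cardinality. -}

module Defs where

open import Algebra.Bundles.Raw using (RawRing)
import Algebra.Definitions.RawSemiring as RawSemiringOps
import Algebra.Properties.Semiring.Sum as SemiringSum
open import Data.Bool.Base using (if_then_else_)
import Data.Bool.Properties as Bool
open import Data.Fin.Base using (Fin; zero; suc; toℕ; punchIn)
import Data.Fin.Properties as Fin
open import Data.Fin.Subset using (Subset; inside; outside; _∈_; _∉_; _⊆_; _-_; ∁; ⊤; ∣_∣)
open import Data.Fin.Subset.Properties using (_∈?_)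
open import Data.Integer.Base as ℤ using (ℤ; 0ℤ; 1ℤ; -1ℤ)
import Data.Integer.Properties as ℤ
import Data.Integer.Solver as ℤ
open import Data.List.Base
  using (List; []; _∷_; [_]; _++_; map; filter; length; lookup; foldr; allFin;
         cartesianProduct; cartesianProductWith)
open import Data.Nat.Base as ℕ using (ℕ; zero; suc)
import Data.Nat.Properties as ℕ
open import Data.Product.Base using (∃; _×_; _,_)
open import Data.Rational.Base as ℚ using (ℚ; 0ℚ; 1ℚ; ½)
import Data.Rational.Properties as ℚ
import Data.Rational.Solver as ℚ
open import Data.Vec.Base as Vec using ([]; _∷_)
import Data.Vec.Properties as Vec
open import Data.Vec.Functional using (Vector)
open import Function.Bundles using (Inverse; _⇔_)
open import Level using (Level; 0ℓ; _⊔_)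
open import Relation.Binary.Bundles using (Setoid)
open import Relation.Binary.Definitions using (DecidableEquality)
open import Relation.Binary.PropositionalEquality as ≡
  using (_≡_; refl; sym; trans; cong; cong₂)
open import Relation.Nullary.Decidable using (yes; no; does; _×-dec_)
open import Relation.Unary using (Pred; Decidable; Satisfiable)

private variable
  n p q : ℕ
  a ℓ : Level

-- ℝ is the Cauchy completion of ℚ; _≃_ is its equality.
IsCauchy : (ℕ → ℚ) → Set
IsCauchy s = ∀ ε → 0ℚ ℚ.< ε →
  ∃ λ N → ∀ i j → N ℕ.≤ i → N ℕ.≤ j → ℚ.∣ s i ℚ.- s j ∣ ℚ.≤ ε

record ℝ : Set where
  constructor mkℝ
  field
    seq    : ℕ → ℚ
    cauchy : IsCauchy seq

open ℝ

infix 4 _≃_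
_≃_ : ℝ → ℝ → Set
x ≃ y = ∀ ε → 0ℚ ℚ.< ε →
  ∃ λ N → ∀ i → N ℕ.≤ i → ℚ.∣ seq x i ℚ.- seq y i ∣ ℚ.≤ ε

fromℚ : ℚ → ℝ
fromℚ c = mkℝ (λ _ → c) λ ε 0<ε → 0 , λ _ _ _ _ →
  ℚ.≤-trans (ℚ.≤-reflexive (cong ℚ.∣_∣ (ℚ.+-inverseʳ c))) (ℚ.<⇒≤ 0<ε)

fromℤ : ℤ → ℝ
fromℤ z = fromℚ (z ℚ./ 1)

private
  ½*-pos : ∀ {ε} → 0ℚ ℚ.< ε → 0ℚ ℚ.< ½ ℚ.* ε
  ½*-pos {ε} 0<ε = ℚ.positive⁻¹ (½ ℚ.* ε) {{ℚ.pos*pos⇒pos ½ ε {{ℚ.positive 0<ε}}}}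

  ½+½ : ∀ ε → ½ ℚ.* ε ℚ.+ ½ ℚ.* ε ≡ ε
  ½+½ ε = trans (sym (ℚ.*-distribʳ-+ ε ½ ½)) (ℚ.*-identityˡ ε)

  bounded : ∀ x → ∃ λ B → 0ℚ ℚ.< B ×
            ∃ λ N → ∀ i → N ℕ.≤ i → ℚ.∣ seq x i ∣ ℚ.≤ B
  bounded (mkℝ s s-cauchy) with s-cauchy 1ℚ (ℚ.positive⁻¹ 1ℚ)
  ... | N , close = 1ℚ ℚ.+ ℚ.∣ s N ∣
      , ℚ.+-mono-<-≤ (ℚ.positive⁻¹ 1ℚ) (ℚ.0≤∣p∣ (s N))
      , N , λ i N≤i → begin
        ℚ.∣ s i ∣                          ≡⟨ cong ℚ.∣_∣ (split (s i) (s N)) ⟩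
        ℚ.∣ (s i ℚ.- s N) ℚ.+ s N ∣        ≤⟨ ℚ.∣p+q∣≤∣p∣+∣q∣ (s i ℚ.- s N) (s N) ⟩
        ℚ.∣ s i ℚ.- s N ∣ ℚ.+ ℚ.∣ s N ∣    ≤⟨ ℚ.+-monoˡ-≤ ℚ.∣ s N ∣ (close i N N≤i ℕ.≤-refl) ⟩
        1ℚ ℚ.+ ℚ.∣ s N ∣                   ∎
    where
    open ℚ.≤-Reasoning
    open ℚ.+-*-Solver
    split : ∀ x y → x ≡ (x ℚ.- y) ℚ.+ y
    split = solve 2 (λ x y → x := (x :- y) :+ y) refl

infixl 6 _+ℝ_
_+ℝ_ : ℝ → ℝ → ℝ
x +ℝ y = mkℝ (λ i → seq x i ℚ.+ seq y i) λ ε 0<ε →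
  let M , closeˣ = cauchy x (½ ℚ.* ε) (½*-pos 0<ε)
      N , closeʸ = cauchy y (½ ℚ.* ε) (½*-pos 0<ε)
  in M ℕ.⊔ N , λ i j ≤i ≤j → begin
    ℚ.∣ (seq x i ℚ.+ seq y i) ℚ.- (seq x j ℚ.+ seq y j) ∣
      ≡⟨ cong ℚ.∣_∣ (swap (seq x i) (seq y i) (seq x j) (seq y j)) ⟩
    ℚ.∣ (seq x i ℚ.- seq x j) ℚ.+ (seq y i ℚ.- seq y j) ∣
      ≤⟨ ℚ.∣p+q∣≤∣p∣+∣q∣ (seq x i ℚ.- seq x j) (seq y i ℚ.- seq y j) ⟩
    ℚ.∣ seq x i ℚ.- seq x j ∣ ℚ.+ ℚ.∣ seq y i ℚ.- seq y j ∣
      ≤⟨ ℚ.+-mono-≤ (closeˣ i j (ℕ.m⊔n≤o⇒m≤o M N ≤i) (ℕ.m⊔n≤o⇒m≤o M N ≤j))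
                    (closeʸ i j (ℕ.m⊔n≤o⇒n≤o M N ≤i) (ℕ.m⊔n≤o⇒n≤o M N ≤j)) ⟩
    ½ ℚ.* ε ℚ.+ ½ ℚ.* ε
      ≡⟨ ½+½ ε ⟩
    ε ∎
  where
  open ℚ.≤-Reasoning
  open ℚ.+-*-Solver
  swap : ∀ u v w z → (u ℚ.+ v) ℚ.- (w ℚ.+ z) ≡ (u ℚ.- w) ℚ.+ (v ℚ.- z)
  swap = solve 4 (λ u v w z → (u :+ v) :- (w :+ z) := (u :- w) :+ (v :- z)) refl

infixl 7 _*ℝ_
_*ℝ_ : ℝ → ℝ → ℝ
x *ℝ y = mkℝ (λ i → seq x i ℚ.* seq y i) λ ε 0<ε →
  let B , 0<B , M₁ , boundˣ = bounded x
      C , 0<C , N₁ , boundʸ = bounded y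
      0<B+C   = ℚ.+-mono-< 0<B 0<C
      instance
        B≥0   = ℚ.nonNegative (ℚ.<⇒≤ 0<B)
        C≥0   = ℚ.nonNegative (ℚ.<⇒≤ 0<C)
        B+C>0 = ℚ.positive 0<B+C
        ε>0   = ℚ.positive 0<ε
        B+C≢0 = ℚ.pos⇒nonZero (B ℚ.+ C)
        1/>0  = ℚ.1/pos⇒pos (B ℚ.+ C)
      δ       = ε ℚ.* ℚ.1/ (B ℚ.+ C)
      0<δ     = ℚ.positive⁻¹ δ {{ℚ.pos*pos⇒pos ε (ℚ.1/ (B ℚ.+ C))}}
      M₂ , closeˣ = cauchy x δ 0<δ
      N₂ , closeʸ = cauchy y δ 0<δ
      instance
        δ≥0   = ℚ.nonNegative (ℚ.<⇒≤ 0<δ)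
      M = M₁ ℕ.⊔ M₂
      N = N₁ ℕ.⊔ N₂
  in M ℕ.⊔ N , λ i j ≤i ≤j →
  let M≤i = ℕ.m⊔n≤o⇒m≤o M N ≤i
      N≤i = ℕ.m⊔n≤o⇒n≤o M N ≤i
      M≤j = ℕ.m⊔n≤o⇒m≤o M N ≤j
      N≤j = ℕ.m⊔n≤o⇒n≤o M N ≤j
      Δx = seq x i ℚ.- seq x j
      Δy = seq y i ℚ.- seq y j
  in begin
    ℚ.∣ seq x i ℚ.* seq y i ℚ.- seq x j ℚ.* seq y j ∣
      ≡⟨ cong ℚ.∣_∣ (split (seq x i) (seq y i) (seq x j) (seq y j)) ⟩
    ℚ.∣ seq x i ℚ.* Δy ℚ.+ Δx ℚ.* seq y j ∣
      ≤⟨ ℚ.∣p+q∣≤∣p∣+∣q∣ (seq x i ℚ.* Δy) (Δx ℚ.* seq y j) ⟩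
    ℚ.∣ seq x i ℚ.* Δy ∣ ℚ.+ ℚ.∣ Δx ℚ.* seq y j ∣
      ≡⟨ cong₂ ℚ._+_ (ℚ.∣p*q∣≡∣p∣*∣q∣ (seq x i) Δy) (ℚ.∣p*q∣≡∣p∣*∣q∣ Δx (seq y j)) ⟩
    ℚ.∣ seq x i ∣ ℚ.* ℚ.∣ Δy ∣ ℚ.+ ℚ.∣ Δx ∣ ℚ.* ℚ.∣ seq y j ∣
      ≤⟨ ℚ.+-mono-≤
           (*-mono-≤ {{ℚ.∣-∣-nonNeg Δy}} {{B≥0}}
             (boundˣ i (ℕ.m⊔n≤o⇒m≤o M₁ M₂ M≤i))
             (closeʸ i j (ℕ.m⊔n≤o⇒n≤o N₁ N₂ N≤i) (ℕ.m⊔n≤o⇒n≤o N₁ N₂ N≤j)))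
           (*-mono-≤ {{ℚ.∣-∣-nonNeg (seq y j)}} {{δ≥0}}
             (closeˣ i j (ℕ.m⊔n≤o⇒n≤o M₁ M₂ M≤i) (ℕ.m⊔n≤o⇒n≤o M₁ M₂ M≤j))
             (boundʸ j (ℕ.m⊔n≤o⇒m≤o N₁ N₂ N≤j))) ⟩
    B ℚ.* δ ℚ.+ δ ℚ.* C
      ≡⟨ regroup B C ε (ℚ.1/ (B ℚ.+ C)) ⟩
    ε ℚ.* ((B ℚ.+ C) ℚ.* ℚ.1/ (B ℚ.+ C))
      ≡⟨ cong (ε ℚ.*_) (ℚ.*-inverseʳ (B ℚ.+ C)) ⟩
    ε ℚ.* 1ℚ
      ≡⟨ ℚ.*-identityʳ ε ⟩
    ε ∎
  where
  open ℚ.≤-Reasoning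
  open ℚ.+-*-Solver
  split : ∀ u v w z → u ℚ.* v ℚ.- w ℚ.* z ≡ u ℚ.* (v ℚ.- z) ℚ.+ (u ℚ.- w) ℚ.* z
  split = solve 4 (λ u v w z → u :* v :- w :* z := u :* (v :- z) :+ (u :- w) :* z) refl
  regroup : ∀ b c e k → b ℚ.* (e ℚ.* k) ℚ.+ (e ℚ.* k) ℚ.* c ≡ e ℚ.* ((b ℚ.+ c) ℚ.* k)
  regroup = solve 4 (λ b c e k → b :* (e :* k) :+ (e :* k) :* c := e :* ((b :+ c) :* k)) refl
  *-mono-≤ : ∀ {u v w z} → .{{ℚ.NonNegative w}} → .{{ℚ.NonNegative v}} →
             u ℚ.≤ v → w ℚ.≤ z → u ℚ.* w ℚ.≤ v ℚ.* z
  *-mono-≤ {u} {v} {w} {z} u≤v w≤z =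
    ℚ.≤-trans (ℚ.*-monoʳ-≤-nonNeg w u≤v) (ℚ.*-monoˡ-≤-nonNeg v w≤z)

-ℝ_ : ℝ → ℝ
-ℝ x = fromℚ (ℚ.- 1ℚ) *ℝ x

ℝ-rawRing : RawRing 0ℓ 0ℓ
ℝ-rawRing = record
  { Carrier = ℝ
  ; _≈_     = _≃_
  ; _+_     = _+ℝ_
  ; _*_     = _*ℝ_
  ; -_      = -ℝ_
  ; 0#      = fromℚ 0ℚ
  ; 1#      = fromℚ 1ℚ
  }

-- The i-th entry is the exponent of the i-th indeterminate.
Monomial : ℕ → Set
Monomial N = Vec.Vec ℕ N

-- A formal sum of terms; the same monomial may occur several times, so
-- equality compares the total coefficient of every monomial.
Poly : ℕ → Set
Poly N = List (ℤ × Monomial N)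

coeff : ∀ {N} → Poly N → Monomial N → ℤ
coeff []             m = 0ℤ
coeff ((c , u) ∷ f) m = (if does (Vec.≡-dec ℕ._≟_ u m) then c else 0ℤ) ℤ.+ coeff f m

const : ∀ {N} → ℤ → Poly N
const c = [ c , Vec.replicate _ 0 ]

var : ∀ {N} → Fin N → Poly N
var i = [ 1ℤ , Vec.replicate _ 0 Vec.[ i ]≔ 1 ]

ℤ[_] : ℕ → RawRing 0ℓ 0ℓ
ℤ[ N ] = record
  { Carrier = Poly N
  ; _≈_     = λ f g → ∀ m → coeff f m ≡ coeff g m
  ; _+_     = _++_
  ; _*_     = cartesianProductWith λ (c , u) (c′ , u′) → c ℤ.* c′ , Vec.zipWith ℕ._+_ u u′
  ; -_      = map λ (c , u) → ℤ.- c , u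
  ; 0#      = []
  ; 1#      = const 1ℤ
  }

Matrix : Set a → ℕ → ℕ → Set a
Matrix A p q = Fin p → Fin q → A

infixl 10 _ᵀ
_ᵀ : ∀ {A I J : Set a} → (I → J → A) → (J → I → A)
(M ᵀ) j i = M i j

mapMatrix : ∀ {A B : Set} → (A → B) → Matrix A p q → Matrix B p q
mapMatrix f M i j = f (M i j)

module LinearAlgebra (A : RawRing a ℓ) where
  open RawRing A
  open RawSemiringOps rawSemiring using (sum; product; _^_) public

  infixl 6 _⊕_
  _⊕_ : Matrix Carrier p q → Matrix Carrier p q → Matrix Carrier p q
  (M ⊕ N) i j = M i j + N i j

  infixl 7 _⊗_
  _⊗_ : ∀ {r} → Matrix Carrier p q → Matrix Carrier q r → Matrix Carrier p r
  (M ⊗ N) i k = sum λ j → M i j * N j k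

  diagonal : Vector Carrier p → Matrix Carrier p p
  diagonal v i j = if does (i Fin.≟ j) then v i else 0#

  Id : Matrix Carrier p p
  Id = diagonal λ _ → 1#

  infixr 8 _·_
  _·_ : Carrier → Matrix Carrier p q → Matrix Carrier p q
  (c · M) i j = c * M i j

  det : ∀ {p} → Matrix Carrier p p → Carrier
  det {zero}  M = 1#
  det {suc p} M = sum λ j →
    (- 1#) ^ toℕ j * M zero j * det (λ i k → M (suc i) (punchIn j k))

  ∑-list : {B : Set} → List B → (B → Carrier) → Carrier
  ∑-list xs f = foldr (λ x s → f x + s) 0# xs

  ∏[∈_]_ : Subset p → Vector Carrier p → Carrier
  ∏[∈ S ] v = product λ i → if does (i ∈? S) then v i else 1#

  SupportedOn : Subset p → Pred (Vector Carrier p) ℓ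
  SupportedOn S c = ∀ i → i ∉ S → c i ≈ 0#

  -- Families v : Fin p → J → Carrier of vectors with coordinates in an
  -- arbitrary type J.
  module _ {J : Set} where

    combination : Vector Carrier p → (Fin p → J → Carrier) → J → Carrier
    combination c v j = sum λ i → c i * v i j

    LinearlyIndependent : (Fin p → J → Carrier) → Subset p → Set (a ⊔ ℓ)
    LinearlyIndependent v S = ∀ c → SupportedOn S c →
      (∀ j → combination c v j ≈ 0#) → ∀ i → c i ≈ 0#

    Span : (Fin p → J → Carrier) → Subset p → Pred (J → Carrier) (a ⊔ ℓ)
    Span v S w = ∃ λ c → SupportedOn S c × ∀ j → combination c v j ≈ w j

    RowSpace : (Fin p → J → Carrier) → Pred (J → Carrier) (a ⊔ ℓ)
    RowSpace v = Span v ⊤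

    IsBasis : (Fin p → J → Carrier) → Subset p → Pred (J → Carrier) (a ⊔ ℓ) → Set (a ⊔ ℓ)
    IsBasis v S W = LinearlyIndependent v S × ∀ w → Span v S w ⇔ W w

_≟ˢ_ : DecidableEquality (Subset n)
_≟ˢ_ = Vec.≡-dec Bool._≟_

subsets : ∀ n → List (Subset n)
subsets zero    = [ [] ]
subsets (suc n) = map (outside ∷_) (subsets n) ++ map (inside ∷_) (subsets n)

record SimplicialComplex (n : ℕ) : Set₁ where
  field
    Face     : Pred (Subset n) 0ℓ
    face?    : Decidable Face
    nonempty : Satisfiable Face
    closed   : ∀ {s t} → s ⊆ t → Face t → Face s

open SimplicialComplex

HasDimension : SimplicialComplex n → ℕ → Set
HasDimension G d = (∃ λ s → Face G s × ∣ s ∣ ≡ suc d) × (∀ s → Face G s → ∣ s ∣ ℕ.≤ suc d)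

-- Faces are graded by cardinality: faces G k lists the (k-1)-faces, so
-- that the (-1)-face needs no special treatment.
faces : SimplicialComplex n → ℕ → List (Subset n)
faces {n} G k = filter (λ s → face? G s ×-dec (∣ s ∣ ℕ.≟ k)) (subsets n)

#faces : SimplicialComplex n → ℕ → ℕ
#faces G k = length (faces G k)

face : (G : SimplicialComplex n) (k : ℕ) → Fin (#faces G k) → Subset n
face G k = lookup (faces G k)

-- Sorted increasingly, so the position in the list is the j of v_j.
vertices : Subset n → List (Fin n)
vertices {n} s = filter (_∈? s) (allFin n)

incidence : Subset n → Subset n → ℤ
incidence r f with Fin.any? (λ j → r ≟ˢ (f - lookup (vertices f) j))
... | yes (j , _) = -1ℤ ℤ.^ toℕ j
... | no  _       = 0ℤ

-- ∂ G k is the incidence matrix ∂ₖ: rows are the (k-1)-faces and columns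
-- the k-faces.
∂ : (G : SimplicialComplex n) (k : ℕ) → Matrix ℤ (#faces G k) (#faces G (suc k))
∂ G k r f = incidence (face G k r) (face G (suc k) f)

laplacian : (G : SimplicialComplex n) (d : ℕ) → Matrix ℤ (#faces G d) (#faces G d)
laplacian G d = ∂ G d ⊗ ∂ G d ᵀ
  where open LinearAlgebra ℤ.+-*-rawRing

module _ (G : SimplicialComplex n) (d : ℕ) where

  private
    module ℝ-Lin = LinearAlgebra ℝ-rawRing

  ∂ℝ : Matrix ℝ (#faces G d) (#faces G (suc d))
  ∂ℝ = mapMatrix fromℤ (∂ G d)

  FaceSets : Set
  FaceSets = Subset (#faces G (suc d)) × Subset (#faces G d)

  faceSets : List FaceSets
  faceSets = cartesianProduct (subsets _) (subsets _)

  Forest : Pred (Subset (#faces G (suc d))) 0ℓ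
  Forest F = ℝ-Lin.LinearlyIndependent (∂ℝ ᵀ) F

  -- The submatrix with columns indexed by F, as a family of rows.
  columns : (F : Subset (#faces G (suc d))) →
            Fin (#faces G d) → (∃ λ f → f ∈ F) → ℝ
  columns F r (f , _) = ∂ℝ r f

  Root : Subset (#faces G (suc d)) → Subset (#faces G d) → Set
  Root F R = ℝ-Lin.IsBasis (columns F) (∁ R) (ℝ-Lin.RowSpace (columns F))

  RootedForest : Pred FaceSets 0ℓ
  RootedForest (F , R) = Forest F × Root F R

infixl 6 _-ᶜ_
_-ᶜ_ : Vector ℤ p → Vector ℤ p → Vector ℤ p
(u -ᶜ v) i = u i ℤ.- v i

-- The subgroup ℤ S of ℤ^p, for S a subset of the coordinates.
ℤ⟨_⟩ : Subset p → Pred (Vector ℤ p) 0ℓ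
ℤ⟨_⟩ = LinearAlgebra.SupportedOn ℤ.+-*-rawRing

-- Equality in the quotient of ℤ^p by ℤ R.
infix 4 _≈_mod_
_≈_mod_ : Vector ℤ p → Vector ℤ p → Subset p → Set
u ≈ v mod R = ℤ⟨ R ⟩ (u -ᶜ v)

module _ (G : SimplicialComplex n) (d : ℕ) where

  Chain : ℕ → Set
  Chain k = Vector ℤ (#faces G k)

  boundary : Chain (suc d) → Chain d
  boundary x r = LinearAlgebra.sum ℤ.+-*-rawRing λ f → ∂ G d r f ℤ.* x f

  private
    combine : ∀ {F R} (s t : ℤ) (x y : Chain (suc d)) (u v : Chain d) →
      ℤ⟨ F ⟩ x → ℤ⟨ F ⟩ y → u ≈ boundary x mod R → v ≈ boundary y mod R →
      let xy = λ f → s ℤ.* x f ℤ.+ t ℤ.* y f in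
      ℤ⟨ F ⟩ xy × ((λ r → s ℤ.* u r ℤ.+ t ℤ.* v r) ≈ boundary xy mod R)
    combine s t x y u v x∈F y∈F u≈x v≈y =
        (λ f f∉F → vanish (x∈F f f∉F) (y∈F f f∉F))
      , λ r r∉R → begin
          s ℤ.* u r ℤ.+ t ℤ.* v r ℤ.- boundary (λ f → s ℤ.* x f ℤ.+ t ℤ.* y f) r
            ≡⟨ cong (λ z → s ℤ.* u r ℤ.+ t ℤ.* v r ℤ.- z) (linear r) ⟩
          s ℤ.* u r ℤ.+ t ℤ.* v r ℤ.- (s ℤ.* boundary x r ℤ.+ t ℤ.* boundary y r)
            ≡⟨ regroup s t (u r) (v r) (boundary x r) (boundary y r) ⟩
          s ℤ.* (u r ℤ.- boundary x r) ℤ.+ t ℤ.* (v r ℤ.- boundary y r)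
            ≡⟨ vanish (u≈x r r∉R) (v≈y r r∉R) ⟩
          0ℤ ∎
      where
      open ≡.≡-Reasoning
      open ℤ.+-*-Solver
      open SemiringSum ℤ.+-*-semiring
      vanish : ∀ {b c} → b ≡ 0ℤ → c ≡ 0ℤ → s ℤ.* b ℤ.+ t ℤ.* c ≡ 0ℤ
      vanish refl refl = cong₂ ℤ._+_ (ℤ.*-zeroʳ s) (ℤ.*-zeroʳ t)
      regroup : ∀ s t u v b c →
        s ℤ.* u ℤ.+ t ℤ.* v ℤ.- (s ℤ.* b ℤ.+ t ℤ.* c) ≡ s ℤ.* (u ℤ.- b) ℤ.+ t ℤ.* (v ℤ.- c)
      regroup = solve 6 (λ s t u v b c →
        s :* u :+ t :* v :- (s :* b :+ t :* c) := s :* (u :- b) :+ t :* (v :- c)) refl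
      expand : ∀ s t m b c → m ℤ.* (s ℤ.* b ℤ.+ t ℤ.* c) ≡ s ℤ.* (m ℤ.* b) ℤ.+ t ℤ.* (m ℤ.* c)
      expand = solve 5 (λ s t m b c → m :* (s :* b :+ t :* c) := s :* (m :* b) :+ t :* (m :* c)) refl
      linear : ∀ r → boundary (λ f → s ℤ.* x f ℤ.+ t ℤ.* y f) r
                   ≡ s ℤ.* boundary x r ℤ.+ t ℤ.* boundary y r
      linear r = begin
        sum (λ f → ∂ G d r f ℤ.* (s ℤ.* x f ℤ.+ t ℤ.* y f))
          ≡⟨ sum-cong-≗ (λ f → expand s t (∂ G d r f) (x f) (y f)) ⟩
        sum (λ f → s ℤ.* (∂ G d r f ℤ.* x f) ℤ.+ t ℤ.* (∂ G d r f ℤ.* y f))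
          ≡⟨ ∑-distrib-+ (λ f → s ℤ.* (∂ G d r f ℤ.* x f)) (λ f → t ℤ.* (∂ G d r f ℤ.* y f)) ⟩
        sum (λ f → s ℤ.* (∂ G d r f ℤ.* x f)) ℤ.+ sum (λ f → t ℤ.* (∂ G d r f ℤ.* y f))
          ≡⟨ cong₂ ℤ._+_ (*-distribˡ-sum s (λ f → ∂ G d r f ℤ.* x f))
                         (*-distribˡ-sum t (λ f → ∂ G d r f ℤ.* y f)) ⟨
        s ℤ.* boundary x r ℤ.+ t ℤ.* boundary y r ∎

  -- H_{d-1}(F,R): u and v are identified when the class of u - v modulo ℤ R
  -- is the class of the boundary of some x ∈ ℤ F.
  RelativeHomology : FaceSets G d → Setoid 0ℓ 0ℓ
  RelativeHomology (F , R) = record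
    { Carrier       = Chain d
    ; _≈_           = _∼_
    ; isEquivalence = record
      { refl  = λ {u} → ∼-refl u
      ; sym   = λ {u} {v} → ∼-sym u v
      ; trans = λ {u} {v} {w} → ∼-trans u v w
      }
    }
    where
    infix 4 _∼_
    _∼_ : Chain d → Chain d → Set
    u ∼ v = ∃ λ x → ℤ⟨ F ⟩ x × (u -ᶜ v ≈ boundary x mod R)

    open ℤ.+-*-Solver

    ≗-resp : ∀ (u v w : Chain d) → (∀ r → u r ≡ v r) → u ≈ w mod R → v ≈ w mod R
    ≗-resp u v w u≗v u≈w r r∉R = trans (cong (ℤ._- _) (sym (u≗v r))) (u≈w r r∉R)

    ∼-sym : ∀ u v → u ∼ v → v ∼ u
    ∼-sym u v (x , x∈F , eq) =
      let xx∈F , eq′ = combine -1ℤ 0ℤ x x (u -ᶜ v) (u -ᶜ v) x∈F x∈F eq eq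
      in _ , xx∈F , ≗-resp _ (v -ᶜ u) _ (λ r → flip (u r) (v r)) eq′
      where
      flip : ∀ a b → -1ℤ ℤ.* (a ℤ.- b) ℤ.+ 0ℤ ℤ.* (a ℤ.- b) ≡ b ℤ.- a
      flip = solve 2 (λ a b → con -1ℤ :* (a :- b) :+ con 0ℤ :* (a :- b) := b :- a) refl

    ∼-trans : ∀ u v w → u ∼ v → v ∼ w → u ∼ w
    ∼-trans u v w (x , x∈F , eq) (y , y∈F , eq′) =
      let xy∈F , eq″ = combine 1ℤ 1ℤ x y (u -ᶜ v) (v -ᶜ w) x∈F y∈F eq eq′
      in _ , xy∈F , ≗-resp _ (u -ᶜ w) _ (λ r → telescope (u r) (v r) (w r)) eq″
      where
      telescope : ∀ a b c → 1ℤ ℤ.* (a ℤ.- b) ℤ.+ 1ℤ ℤ.* (b ℤ.- c) ≡ a ℤ.- c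
      telescope = solve 3 (λ a b c → con 1ℤ :* (a :- b) :+ con 1ℤ :* (b :- c) := a :- c) refl

    ∼-refl : ∀ u → u ∼ u
    ∼-refl u = (λ _ → 0ℤ) , (λ _ _ → refl) , λ r _ →
      cong₂ ℤ._-_ (ℤ.+-inverseʳ (u r)) (vanish r)
      where
      open SemiringSum ℤ.+-*-semiring
      vanish : ∀ r → boundary (λ _ → 0ℤ) r ≡ 0ℤ
      vanish r = trans (sum-cong-≗ (λ f → ℤ.*-zeroʳ (∂ G d r f)))
                       (sum-replicate-zero (#faces G (suc d)))

_HasCardinality_ : Setoid a ℓ → ℕ → Set (a ⊔ ℓ)
S HasCardinality m = Inverse S (≡.setoid (Fin m))

{-# OPTIONS --safe #-}

-- Write M = ∂ G d, let p and q be its numbers of rows and columns, and let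
-- W = [Id∣M], so that L + X = W diag(x,y) Wᵀ.  By Cauchy–Binet the determinant
-- is the sum of x^R y^F c(S)² over the sets S = R ∪ F of columns of W, where c(S) is
-- the maximal minor of W at S (zero unless S has p elements), and c(R ∪ F) is up
-- to sign the minor of M with rows ∁ R and columns F.  Euclid's algorithm on
-- columns makes a square integer matrix lower triangular; this shows that a
-- nonzero c(R ∪ F) has as absolute value the order of coker Ψ = ℤᵖ/(ℤR + M ℤF),
-- and that c(R ∪ F) ≠ 0 precisely when (F , R) is a rooted forest: a nonzero
-- minor yields a rational inverse, a zero minor an integer relation between
-- rows or columns, and both survive the passage to the reals.
--
-- Cauchy–Binet itself is proved in the exterior algebra: the wedge product with
-- a vector is adjoint to the contraction with it, and contracting w₁ ∧ ⋯ ∧ wₖ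
-- is the expansion of a determinant along its first row.

module Submission where

open import Defs
open import Algebra.Bundles using (CommutativeRing)
open import Algebra.Bundles.Raw using (RawRing)
open import Algebra.Morphism.Structures using (IsRingHomomorphism)
import Algebra.Properties.Semiring.Sum as SemiringSum
open import Data.Bool.Base using (true; false; if_then_else_)
open import Data.Fin.Base
  using (Fin; zero; suc; toℕ; fromℕ<; punchIn; splitAt; combine; remQuot; _↑ˡ_; _↑ʳ_)
import Data.Fin.Properties as Fin
open import Data.Fin.Subset using (Subset; inside; outside; _∈_; _∉_; ∁; ⊤)
import Data.Fin.Subset as Subset
open import Data.Fin.Subset.Properties
  using (_∈?_; ∣p∣≤n; drop-there; ∈⊤; x∈p⇒x∉∁p; x∉∁p⇒x∈p)
open import Data.Integer.Base as ℤ using (ℤ; +_; -[1+_]; 0ℤ; 1ℤ; -1ℤ)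
import Data.Integer.DivMod as ℤ
import Data.Integer.Properties as ℤ
import Data.Integer.Solver as ℤ
open import Data.List.Base as List using (List; []; _∷_; filter; cartesianProduct)
open import Data.Nat.Base as ℕ using (ℕ; zero; suc) renaming (_+_ to _+ℕ_)
import Data.Nat.Divisibility as ℕ
import Data.Nat.Properties as ℕ
open import Data.Product.Base using (Σ-syntax; ∃; _×_; _,_; proj₁; proj₂)
open import Data.Rational.Base as ℚ using (ℚ; 0ℚ; 1ℚ; ½; fromℚᵘ)
import Data.Rational.Properties as ℚ
import Data.Rational.Solver as ℚ
open import Data.Rational.Unnormalised.Base as ℚᵘ using (mkℚᵘ)
import Data.Rational.Unnormalised.Properties as ℚᵘ
open import Data.Sum.Base using (_⊎_; inj₁; inj₂)
open import Data.Vec.Base as Vec using ([]; _∷_; here; there)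
import Data.Vec.Properties as Vec
open import Data.Vec.Functional using (Vector; head; tail) renaming (_∷_ to _∷ᶠ_; _++_ to _++ᶠ_)
open import Data.Vec.Functional.Properties using (lookup-++ˡ; lookup-++ʳ)
open import Function.Base using (_∘_; _$_; case_of_)
open import Function.Bundles using (mk⇔; Equivalence)
open import Level using (0ℓ)
open import Relation.Binary.Definitions using (tri<; tri≈; tri>)
open import Relation.Binary.PropositionalEquality as ≡
  using (_≡_; _≢_; cong; cong₂; subst; subst₂; module ≡-Reasoning)
open import Relation.Nullary using (Dec; ¬_; contradiction)
open import Relation.Nullary.Decidable using (yes; no; does; decidable-stable)
open import Relation.Unary using (Pred; Decidable)

-- A root selects rows and a forest selects columns. Adjoining Id turns both selections into one set
-- of columns of W: the unit column at r ∈ R removes row r from the minor, and the condition |R| +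
-- |F| = p and all signs are absorbed into one coordinate of a wedge product.
--
-- Equality with zero cannot be tested for Cauchy sequences, so rank arguments and the extraction of
-- bases are not at hand over ℝ. Every case distinction is therefore made on the integer c(S), and
-- each outcome is turned into a finite integer certificate. Real coefficients enter only
-- afterwards, when a certificate with rational entries is applied termwise to their sequences.
--
-- Column operations are the ones used because they preserve the subgroup spanned by the columns:
-- the cokernel stays literally the same, and its order appears as a product of diagonal entries.
-- Determinants are compared up to sign only, which is enough since the theorem squares them.

enum : ∀ {n} (S : Subset n) → Fin Subset.∣ S ∣ → Fin n
enum (outside ∷ S) i       = suc (enum S i)
enum (inside  ∷ S) zero    = zero
enum (inside  ∷ S) (suc i) = suc (enum S i)

-- Exterior algebra and the Cauchy-Binet formula.

module Exterior {c ℓ} (A : CommutativeRing c ℓ) where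
  open import Data.Vec.Base using (_++_)
  open import Data.Fin.Subset using (∣_∣)
  open CommutativeRing A hiding (zero)
  open LinearAlgebra rawRing using (sum; det; _^_; _⊗_; Id; diagonal; ∏[∈_]_)
  open import Algebra.Properties.Ring ring using (-‿distribˡ-*; -‿involutive)
  open import Algebra.Properties.Semiring.Sum semiring
    using (sum-cong-≋; *-distribˡ-sum; *-distribʳ-sum; ∑-comm)
  open import Relation.Binary.Reasoning.Setoid setoid
  open import Algebra.Solver.Ring.NaturalCoefficients.Default commutativeSemiring
    using (solve; _:=_; _:+_; _:*_)

  -- Signs are factors ε instead of negations, which turns the identities below
  -- into identities of commutative semirings.
  ε : Carrier
  ε = - 1#

  -- An element of the exterior algebra of Aⁿ, by its coordinates in the basis
  -- e_S = e_{s₁} ∧ ⋯ ∧ e_{sₖ} with s₁ < ⋯ < sₖ.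
  Λ : ℕ → Set c
  Λ n = Subset n → Carrier

  infix 9 _•_
  _•_ : ∀ {n} → Vector Carrier n → Vector Carrier n → Carrier
  v • w = sum λ i → v i * w i

  infixr 6 _∧_
  -- With v = v₀ e₀ + v′ and ω = α + e₀ ∧ β, the product is v′ ∧ α + e₀ ∧ (v₀ α - v′ ∧ β); the sign
  -- comes from moving v′ past e₀.
  _∧_ : ∀ {n} → Vector Carrier n → Λ n → Λ n
  (v ∧ ω) []            = 0#
  (v ∧ ω) (outside ∷ S) = (tail v ∧ (ω ∘ (outside ∷_))) S
  (v ∧ ω) (inside  ∷ S) = head v * ω (outside ∷ S) + ε * (tail v ∧ (ω ∘ (inside ∷_))) S

  -- Contraction with v, the adjoint of v ∧_.
  ι : ∀ {n} → Vector Carrier n → Λ n → Λ n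
  ι v ω []            = 0#
  ι v ω (outside ∷ S) = head v * ω (inside ∷ S) + ι (tail v) (ω ∘ (outside ∷_)) S
  ι v ω (inside  ∷ S) = ε * ι (tail v) (ω ∘ (inside ∷_)) S

  one : ∀ {n} → Λ n
  one []            = 1#
  one (outside ∷ S) = one S
  one (inside  ∷ S) = 0#

  ⋀ : ∀ {k n} → (Fin k → Vector Carrier n) → Λ n
  ⋀ {zero}  v = one
  ⋀ {suc k} v = v zero ∧ ⋀ (v ∘ suc)

  ∑ₛ : ∀ {n} → Λ n → Carrier
  ∑ₛ {zero}  ω = ω []
  ∑ₛ {suc n} ω = ∑ₛ (ω ∘ (outside ∷_)) + ∑ₛ (ω ∘ (inside ∷_))

  ⟨_,_⟩ : ∀ {n} → Λ n → Λ n → Carrier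
  ⟨ ω , η ⟩ = ∑ₛ λ S → ω S * η S

  ∑ₛ-cong : ∀ {n} {ω η : Λ n} → (∀ S → ω S ≈ η S) → ∑ₛ ω ≈ ∑ₛ η
  ∑ₛ-cong {zero}  eq = eq []
  ∑ₛ-cong {suc n} eq = +-cong (∑ₛ-cong (eq ∘ (outside ∷_))) (∑ₛ-cong (eq ∘ (inside ∷_)))

  ∑ₛ-linear : ∀ {n} a b (ω η : Λ n) →
              ∑ₛ (λ S → a * ω S + b * η S) ≈ a * ∑ₛ ω + b * ∑ₛ η
  ∑ₛ-linear {zero}  a b ω η = refl
  ∑ₛ-linear {suc n} a b ω η = trans
    (+-cong (∑ₛ-linear a b (ω ∘ (outside ∷_)) (η ∘ (outside ∷_)))
            (∑ₛ-linear a b (ω ∘ (inside ∷_)) (η ∘ (inside ∷_))))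
    (solve 6 (λ a b u v w z →
        ((a :* u :+ b :* v) :+ (a :* w :+ b :* z)) := (a :* (u :+ w) :+ b :* (v :+ z)))
      refl a b _ _ _ _)

  ∑ₛ-zero : ∀ {n} {ω : Λ n} → (∀ S → ω S ≈ 0#) → ∑ₛ ω ≈ 0#
  ∑ₛ-zero {zero}  eq = eq []
  ∑ₛ-zero {suc n} eq =
    trans (+-cong (∑ₛ-zero (eq ∘ (outside ∷_))) (∑ₛ-zero (eq ∘ (inside ∷_)))) (+-identityˡ 0#)

  sum-zero : ∀ {n} {v : Vector Carrier n} → (∀ i → v i ≈ 0#) → sum v ≈ 0#
  sum-zero {zero}  eq = refl
  sum-zero {suc n} eq = trans (+-cong (eq zero) (sum-zero (eq ∘ suc))) (+-identityˡ 0#)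

  ∧-cong : ∀ {n} {v w : Vector Carrier n} {ω η : Λ n} →
           (∀ i → v i ≈ w i) → (∀ S → ω S ≈ η S) → ∀ S → (v ∧ ω) S ≈ (w ∧ η) S
  ∧-cong v≈w ω≈η []            = refl
  ∧-cong v≈w ω≈η (outside ∷ S) = ∧-cong (v≈w ∘ suc) (ω≈η ∘ (outside ∷_)) S
  ∧-cong v≈w ω≈η (inside  ∷ S) = +-cong (*-cong (v≈w zero) (ω≈η (outside ∷ S)))
    (*-congˡ (∧-cong (v≈w ∘ suc) (ω≈η ∘ (inside ∷_)) S))

  ι-cong : ∀ {n} {v : Vector Carrier n} {ω η : Λ n} →
           (∀ S → ω S ≈ η S) → ∀ S → ι v ω S ≈ ι v η S
  ι-cong ω≈η []            = refl
  ι-cong ω≈η (outside ∷ S) = +-cong (*-congˡ (ω≈η (inside ∷ S))) (ι-cong (ω≈η ∘ (outside ∷_)) S)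
  ι-cong ω≈η (inside  ∷ S) = *-congˡ (ι-cong (ω≈η ∘ (inside ∷_)) S)

  ⋀-cong : ∀ {k n} {v w : Fin k → Vector Carrier n} →
           (∀ i j → v i j ≈ w i j) → ∀ S → ⋀ v S ≈ ⋀ w S
  ⋀-cong {zero}  v≈w S = refl
  ⋀-cong {suc k} v≈w S = ∧-cong (v≈w zero) (⋀-cong (v≈w ∘ suc)) S

  0≈a*0+b*0 : ∀ a b → 0# ≈ a * 0# + b * 0#
  0≈a*0+b*0 a b = sym (trans (+-cong (zeroʳ a) (zeroʳ b)) (+-identityˡ 0#))

  ∧-linear : ∀ {n} (v : Vector Carrier n) a b (ω η : Λ n) → ∀ S →
             (v ∧ (λ S → a * ω S + b * η S)) S ≈ a * (v ∧ ω) S + b * (v ∧ η) S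
  ∧-linear v a b ω η []            = 0≈a*0+b*0 a b
  ∧-linear v a b ω η (outside ∷ S) = ∧-linear (tail v) a b (ω ∘ (outside ∷_)) (η ∘ (outside ∷_)) S
  ∧-linear v a b ω η (inside  ∷ S) = trans
    (+-congˡ (*-congˡ (∧-linear (tail v) a b (ω ∘ (inside ∷_)) (η ∘ (inside ∷_)) S)))
    (solve 8 (λ e a b h u v w z →
        (h :* (a :* u :+ b :* v) :+ e :* (a :* w :+ b :* z)) :=
        (a :* (h :* u :+ e :* w) :+ b :* (h :* v :+ e :* z)))
      refl ε a b _ _ _ _ _)

  ι-linear : ∀ {n} (v : Vector Carrier n) a b (ω η : Λ n) → ∀ S →
             ι v (λ S → a * ω S + b * η S) S ≈ a * ι v ω S + b * ι v η S
  ι-linear v a b ω η []            = 0≈a*0+b*0 a b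
  ι-linear v a b ω η (outside ∷ S) = trans
    (+-congˡ (ι-linear (tail v) a b (ω ∘ (outside ∷_)) (η ∘ (outside ∷_)) S))
    (solve 7 (λ a b h u v w z →
        (h :* (a :* u :+ b :* v) :+ (a :* w :+ b :* z)) :=
        (a :* (h :* u :+ w) :+ b :* (h :* v :+ z)))
      refl a b _ _ _ _ _)
  ι-linear v a b ω η (inside  ∷ S) = trans
    (*-congˡ (ι-linear (tail v) a b (ω ∘ (inside ∷_)) (η ∘ (inside ∷_)) S))
    (solve 5 (λ e a b w z → (e :* (a :* w :+ b :* z)) := (a :* (e :* w) :+ b :* (e :* z)))
        refl ε a b _ _)

  module _ {n} (D : Λ n → Λ n)
           (D-cong   : ∀ {ω η} → (∀ S → ω S ≈ η S) → ∀ S → D ω S ≈ D η S)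
           (D-linear : ∀ a b ω η S → D (λ S → a * ω S + b * η S) S ≈ a * D ω S + b * D η S)
           where

    -- Zero is written as 0 ω + 0 ω, so that the single law for a ω + b η covers sums, multiples and
    -- zero alike.
    linear-zero : ∀ {ω} → (∀ S → ω S ≈ 0#) → ∀ S → D ω S ≈ 0#
    linear-zero {ω} ω≈0 S = begin
      D ω S
          ≈⟨ D-cong (λ S → trans (ω≈0 S) (sym (zero-comb (ω S) (ω S)))) S ⟩
      D (λ S → 0# * ω S + 0# * ω S) S     ≈⟨ D-linear 0# 0# ω ω S ⟩
      0# * D ω S + 0# * D ω S             ≈⟨ zero-comb _ _ ⟩
      0#                                  ∎
      where
      zero-comb : ∀ x y → 0# * x + 0# * y ≈ 0#
      zero-comb x y = trans (+-cong (zeroˡ x) (zeroˡ y)) (+-identityˡ 0#)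

    linear-sum : ∀ {k} (a : Vector Carrier k) (ω : Fin k → Λ n) S →
                 D (λ S → sum λ j → a j * ω j S) S ≈ sum λ j → a j * D (ω j) S
    linear-sum {zero}  a ω S = linear-zero (λ _ → refl) S
    linear-sum {suc k} a ω S = begin
      D (λ S → a zero * ω zero S + rest S) S
        ≈⟨ D-cong (λ S → +-congˡ (sym (*-identityˡ (rest S)))) S ⟩
      D (λ S → a zero * ω zero S + 1# * rest S) S
        ≈⟨ D-linear (a zero) 1# (ω zero) rest S ⟩
      a zero * D (ω zero) S + 1# * D rest S
        ≈⟨ +-congˡ (trans (*-identityˡ _) (linear-sum (a ∘ suc) (ω ∘ suc) S)) ⟩
      a zero * D (ω zero) S + sum (λ j → a (suc j) * D (ω (suc j)) S) ∎
      where rest = λ S → sum λ j → a (suc j) * ω (suc j) S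

  ∧-zero : ∀ {n} (v : Vector Carrier n) {ω : Λ n} → (∀ S → ω S ≈ 0#) → ∀ S → (v ∧ ω) S ≈ 0#
  ∧-zero v = linear-zero (v ∧_) (∧-cong (λ _ → refl)) (∧-linear v)

  ι-one : ∀ {n} (v : Vector Carrier n) S → ι v one S ≈ 0#
  ι-one v []            = refl
  ι-one v (outside ∷ S) = trans (+-cong (zeroʳ (head v)) (ι-one (tail v) S)) (+-identityˡ 0#)
  ι-one v (inside  ∷ S) = trans
    (*-congˡ (linear-zero (ι (tail v)) ι-cong (ι-linear (tail v)) (λ _ → refl) S)) (zeroʳ ε)

  ε-inverse : ∀ x → x + ε * x ≈ 0#
  ε-inverse x = begin
    x + ε * x          ≈⟨ +-congʳ (*-identityˡ x) ⟨
    1# * x + ε * x     ≈⟨ distribʳ x 1# ε ⟨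
    (1# - 1#) * x      ≈⟨ *-congʳ (-‿inverseʳ 1#) ⟩
    0# * x             ≈⟨ zeroˡ x ⟩
    0#                 ∎

  -- Contraction is an antiderivation. At coordinates without e₀ this is induction and linearity; at
  -- coordinates with e₀ the two contributions of v₀ s₀ on the right cancel.
  ι-∧ : ∀ {n} (v s : Vector Carrier n) (η : Λ n) → ∀ S →
        ι v (s ∧ η) S ≈ v • s * η S + ε * (s ∧ ι v η) S
  ι-∧ v s η []            = sym (trans (+-cong (zeroˡ _) (zeroʳ ε)) (+-identityˡ 0#))
  ι-∧ v s η (outside ∷ S) = begin
    head v * (head s * ηₒ S + ε * (tail s ∧ ηᵢ) S) + ι (tail v) (tail s ∧ ηₒ) S
      ≈⟨ +-congˡ (ι-∧ (tail v) (tail s) ηₒ S) ⟩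
    head v * (head s * ηₒ S + ε * (tail s ∧ ηᵢ) S) +
        (tail v • tail s * ηₒ S + ε * (tail s ∧ ι (tail v) ηₒ) S)
      ≈⟨ solve 7 (λ e a b c d g f → (a :* (b :* c :+ e :* d) :+ (g :* c :+ e :* f)) :=
           ((a :* b :+ g) :* c :+ e :* (a :* d :+ f))) refl ε _ _ _ _ _ _ ⟩
    v • s * ηₒ S + ε * (head v * (tail s ∧ ηᵢ) S + (tail s ∧ ι (tail v) ηₒ) S)
      ≈⟨ +-congˡ (*-congˡ (begin
           head v * (tail s ∧ ηᵢ) S + (tail s ∧ ι (tail v) ηₒ) S
             ≈⟨ +-congˡ (*-identityˡ _) ⟨
           head v * (tail s ∧ ηᵢ) S + 1# * (tail s ∧ ι (tail v) ηₒ) S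
             ≈⟨ ∧-linear (tail s) (head v) 1# ηᵢ (ι (tail v) ηₒ) S ⟨
           (tail s ∧ (λ S → head v * ηᵢ S + 1# * ι (tail v) ηₒ S)) S
             ≈⟨ ∧-cong (λ _ → refl) (λ S → +-congˡ (*-identityˡ _)) S ⟩
           (tail s ∧ (λ S → head v * ηᵢ S + ι (tail v) ηₒ S)) S ∎)) ⟩
    v • s * ηₒ S + ε * (s ∧ ι v η) (outside ∷ S) ∎
    where
    ηₒ = η ∘ (outside ∷_)
    ηᵢ = η ∘ (inside ∷_)
  ι-∧ v s η (inside ∷ S) = begin
    ε * ι (tail v) (λ S → head s * ηₒ S + ε * (tail s ∧ ηᵢ) S) S
      ≈⟨ *-congˡ (ι-linear (tail v) (head s) ε ηₒ (tail s ∧ ηᵢ) S) ⟩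
    ε * (head s * ι (tail v) ηₒ S + ε * ι (tail v) (tail s ∧ ηᵢ) S)
      -- The vanishing term v₀ s₀ ηᵢ - v₀ s₀ ηᵢ is inserted: its halves are the summands of the
      -- right-hand side without counterpart on the left.
      ≈⟨ trans (+-cong (*-congʳ (ε-inverse _))
           (*-congˡ (+-congˡ (*-congˡ (sym (ι-∧ (tail v) (tail s) ηᵢ S))))))
           (trans (+-congʳ (zeroˡ _)) (+-identityˡ _)) ⟨
    (head v * head s + ε * (head v * head s)) * ηᵢ S
      + ε * (head s * ι (tail v) ηₒ S + ε * (tail v • tail s * ηᵢ S + ε * (tail s ∧ ι (tail v) ηᵢ) S))
      ≈⟨ +-congˡ (solve 5 (λ e a b c d → (e :* (a :+ e :* (b :* c :+ e :* d))) :=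
           (e :* a :+ (e :* e) :* (b :* c) :+ e :* (e :* (e :* d)))) refl ε _ _ _ _) ⟩
    (head v * head s + ε * (head v * head s)) * ηᵢ S
      + (ε * (head s * ι (tail v) ηₒ S) + (ε * ε) * (tail v • tail s * ηᵢ S) + ε *
          (ε * (ε * (tail s ∧ ι (tail v) ηᵢ) S)))
      -- The square of `ε` becomes 1 only in front of the scalar product; the other powers of `ε`
      -- agree on both sides as they stand.
      ≈⟨ +-congˡ (+-congʳ (+-congˡ (trans (*-congʳ ε*ε≈1) (*-identityˡ _)))) ⟩
    (head v * head s + ε * (head v * head s)) * ηᵢ S
      + (ε * (head s * ι (tail v) ηₒ S) + tail v • tail s * ηᵢ S + ε *
          (ε * (ε * (tail s ∧ ι (tail v) ηᵢ) S)))
      ≈⟨ solve 7 (λ e a b c g f h →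
           ((a :* b :+ e :* (a :* b)) :* c :+ (e :* (b :* g) :+ f :* c :+ e :* (e :* (e :* h)))) :=
           ((a :* b :+ f) :* c :+ e :* (b :* (a :* c :+ g) :+ e :* (e :* h)))) refl ε _ _ _ _ _ _ ⟩
    v • s * ηᵢ S + ε * (head s * (head v * ηᵢ S + ι (tail v) ηₒ S) + ε *
        (ε * (tail s ∧ ι (tail v) ηᵢ) S))
      ≈⟨ +-congˡ (*-congˡ (+-congˡ (*-congˡ (begin
           ε * X S                                ≈⟨ trans (+-congˡ (zeroˡ _)) (+-identityʳ _) ⟨
           ε * X S + 0# * X S
               ≈⟨ ∧-linear (tail s) ε 0# (ι (tail v) ηᵢ) (ι (tail v) ηᵢ) S ⟨
           (tail s ∧ (λ S → ε * ι (tail v) ηᵢ S + 0# * ι (tail v) ηᵢ S)) S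
             ≈⟨ ∧-cong (λ _ → refl) (λ S → trans (+-congˡ (zeroˡ _)) (+-identityʳ _)) S ⟩
           (tail s ∧ (λ S → ε * ι (tail v) ηᵢ S)) S ∎)))) ⟩
    v • s * ηᵢ S + ε * (s ∧ ι v η) (inside ∷ S) ∎
    where
    ηₒ = η ∘ (outside ∷_)
    ηᵢ = η ∘ (inside ∷_)
    X = tail s ∧ ι (tail v) ηᵢ
    ε*ε≈1 : ε * ε ≈ 1#
    ε*ε≈1 = trans (sym (-‿distribˡ-* 1# ε)) (trans (-‿cong (*-identityˡ ε)) (-‿involutive 1#))

  -- On both sides v₀ couples the coordinates of ω without e₀ to those of η with e₀; the tail of v
  -- is handled by induction in each half.
  adjoint : ∀ {n} (v : Vector Carrier n) (ω η : Λ n) → ⟨ v ∧ ω , η ⟩ ≈ ⟨ ω , ι v η ⟩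
  adjoint {zero}  v ω η = trans (zeroˡ _) (sym (zeroʳ _))
  adjoint {suc n} v ω η = begin
    ⟨ tail v ∧ ωₒ , ηₒ ⟩ + ∑ₛ (λ S → (head v * ωₒ S + ε * (tail v ∧ ωᵢ) S) * ηᵢ S)
      ≈⟨ +-cong (adjoint (tail v) ωₒ ηₒ) (trans
           (∑ₛ-cong {n} λ S → solve 5 (λ e a b c d →
              ((a :* b :+ e :* c) :* d) := (a :* (b :* d) :+ e :* (c :* d))) refl ε _ _ _ _)
           (∑ₛ-linear {n} (head v) ε _ _)) ⟩
    ⟨ ωₒ , ι (tail v) ηₒ ⟩ + (head v * ⟨ ωₒ , ηᵢ ⟩ + ε * ⟨ tail v ∧ ωᵢ , ηᵢ ⟩)
      ≈⟨ +-congˡ (+-congˡ (*-congˡ (adjoint (tail v) ωᵢ ηᵢ))) ⟩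
    ⟨ ωₒ , ι (tail v) ηₒ ⟩ + (head v * ⟨ ωₒ , ηᵢ ⟩ + ε * ⟨ ωᵢ , ι (tail v) ηᵢ ⟩)
      ≈⟨ trans (solve 3 (λ a b c → (a :+ (b :+ c)) := ((b :+ a) :+ c)) refl _ _ _)
           (+-cong (+-congˡ (sym (*-identityˡ _))) (sym (trans (+-congˡ (zeroˡ _)) (+-identityʳ _)))) ⟩
    (head v * ⟨ ωₒ , ηᵢ ⟩ + 1# * ⟨ ωₒ , ι (tail v) ηₒ ⟩)
      + (ε * ⟨ ωᵢ , ι (tail v) ηᵢ ⟩ + 0# * ⟨ ωᵢ , ι (tail v) ηᵢ ⟩)
      ≈⟨ +-cong (∑ₛ-linear {n} (head v) 1# _ _) (∑ₛ-linear {n} ε 0# _ _) ⟨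
    ∑ₛ (λ S → head v * (ωₒ S * ηᵢ S) + 1# * (ωₒ S * ι (tail v) ηₒ S))
      + ∑ₛ (λ S → ε * (ωᵢ S * ι (tail v) ηᵢ S) + 0# * (ωᵢ S * ι (tail v) ηᵢ S))
      ≈⟨ +-cong
           (∑ₛ-cong {n} λ S → trans (+-congˡ (*-identityˡ _))
              (solve 4 (λ a b c d → (a :* (b :* c) :+ b :* d) := (b :* (a :* c :+ d))) refl _ _ _ _))
           (∑ₛ-cong {n} λ S → trans (+-congˡ (zeroˡ _)) (trans (+-identityʳ _)
              (solve 3 (λ e a b → (e :* (a :* b)) := (a :* (e :* b))) refl ε _ _))) ⟩
    ⟨ ωₒ , ι v η ∘ (outside ∷_) ⟩ + ⟨ ωᵢ , ι v η ∘ (inside ∷_) ⟩ ∎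
    where
    ωₒ = ω ∘ (outside ∷_)
    ωᵢ = ω ∘ (inside ∷_)
    ηₒ = η ∘ (outside ∷_)
    ηᵢ = η ∘ (inside ∷_)

  -- Each use of `ι-∧` moves the contraction past one more vector at the cost of a factor `ε`, so
  -- that `w j` is reached with `ε` to the power j.
  ι-⋀ : ∀ {k n} (v : Vector Carrier n) (w : Fin (suc k) → Vector Carrier n) → ∀ S →
        ι v (⋀ w) S ≈ sum λ j → (ε ^ toℕ j * v • w j) * ⋀ (w ∘ punchIn j) S
  ι-⋀ {zero} v w S = begin
    ι v (w zero ∧ one) S                             ≈⟨ ι-∧ v (w zero) one S ⟩
    v • w zero * one S + ε * (w zero ∧ ι v one) S
      ≈⟨ +-cong (*-congʳ (sym (*-identityˡ _)))
           (trans (*-congˡ (∧-zero (w zero) (ι-one v) S)) (zeroʳ ε)) ⟩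
    1# * v • w zero * one S + 0#                     ∎
  ι-⋀ {suc k} v w S = begin
    ι v (w zero ∧ ⋀ (w ∘ suc)) S
      ≈⟨ ι-∧ v (w zero) (⋀ (w ∘ suc)) S ⟩
    v • w zero * ⋀ (w ∘ suc) S + ε * (w zero ∧ ι v (⋀ (w ∘ suc))) S
      ≈⟨ +-cong (*-congʳ (sym (*-identityˡ _))) (*-congˡ (begin
           (w zero ∧ ι v (⋀ (w ∘ suc))) S
             ≈⟨ ∧-cong (λ _ → refl) (ι-⋀ v (w ∘ suc)) S ⟩
           (w zero ∧ (λ S → sum λ j → (ε ^ toℕ j * v • w (suc j)) * ⋀ (w ∘ suc ∘ punchIn j) S)) S
             ≈⟨ linear-sum (w zero ∧_) (∧-cong (λ _ → refl)) (∧-linear (w zero))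
                  (λ j → ε ^ toℕ j * v • w (suc j)) (λ j → ⋀ (w ∘ suc ∘ punchIn j)) S ⟩
           sum (λ j → (ε ^ toℕ j * v • w (suc j)) * ⋀ (w ∘ punchIn (suc j)) S) ∎)) ⟩
    1# * v • w zero * ⋀ (w ∘ suc) S
      + ε * sum (λ j → (ε ^ toℕ j * v • w (suc j)) * ⋀ (w ∘ punchIn (suc j)) S)
      ≈⟨ +-congˡ (*-distribˡ-sum ε (λ j → (ε ^ toℕ j * v • w (suc j)) * ⋀ (w ∘ punchIn (suc j)) S)) ⟩
    1# * v • w zero * ⋀ (w ∘ suc) S
      + sum (λ j → ε * ((ε ^ toℕ j * v • w (suc j)) * ⋀ (w ∘ punchIn (suc j)) S))
      ≈⟨ +-congˡ (sum-cong-≋ {suc k} λ j →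
           trans (sym (*-assoc ε _ (⋀ (w ∘ punchIn (suc j)) S)))
               (*-congʳ (sym (*-assoc ε (ε ^ toℕ j) (v • w (suc j)))))) ⟩
    sum (λ j → (ε ^ toℕ j * v • w j) * ⋀ (w ∘ punchIn j) S) ∎

  det-cong : ∀ {k} {M N : Matrix Carrier k k} → (∀ i j → M i j ≈ N i j) → det M ≈ det N
  det-cong {zero}  M≈N = refl
  det-cong {suc k} M≈N = sum-cong-≋ λ j →
    *-cong (*-congˡ {ε ^ toℕ j} (M≈N zero j)) (det-cong λ i k → M≈N (suc i) (punchIn j k))

  -- Moving the factors of ⋀ v one by one across the pairing turns them into
  -- contractions of ⋀ w, and ι-⋀ is the expansion of det along the first row.
  cauchy-binet : ∀ {k n} (v w : Fin k → Vector Carrier n) →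
                 det (λ i j → v i • w j) ≈ ⟨ ⋀ v , ⋀ w ⟩
  cauchy-binet {zero} {n} v w = sym (⟨one,one⟩ {n})
    where
    ⟨one,one⟩ : ∀ {n} → ⟨ one {n} , one ⟩ ≈ 1#
    ⟨one,one⟩ {zero}  = *-identityˡ 1#
    ⟨one,one⟩ {suc n} = trans (+-cong (⟨one,one⟩ {n}) (∑ₛ-zero {n} λ S → zeroˡ _)) (+-identityʳ 1#)
  cauchy-binet {suc k} {n} v w = begin
    sum (λ j → ε ^ toℕ j * v zero • w j * det (λ i k → v (suc i) • w (punchIn j k)))
      ≈⟨ sum-cong-≋ {suc k} (λ j → *-congˡ {ε ^ toℕ j * v zero • w j}
           (cauchy-binet (v ∘ suc) (w ∘ punchIn j))) ⟩
    sum (λ j → ε ^ toℕ j * v zero • w j * ⟨ ⋀ (v ∘ suc) , ⋀ (w ∘ punchIn j) ⟩)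
      ≈⟨ ⟨⟩-sum (⋀ (v ∘ suc)) (λ j → ε ^ toℕ j * v zero • w j) (λ j → ⋀ (w ∘ punchIn j)) ⟨
    ⟨ ⋀ (v ∘ suc) , (λ S → sum λ j → ε ^ toℕ j * v zero • w j * ⋀ (w ∘ punchIn j) S) ⟩
      ≈⟨ ∑ₛ-cong {n} (λ S → *-congˡ (ι-⋀ (v zero) w S)) ⟨
    ⟨ ⋀ (v ∘ suc) , ι (v zero) (⋀ w) ⟩
      ≈⟨ adjoint (v zero) (⋀ (v ∘ suc)) (⋀ w) ⟨
    ⟨ ⋀ v , ⋀ w ⟩ ∎
    where
    ⟨⟩-sum : ∀ {k n} (ω : Λ n) (a : Vector Carrier k) (η : Fin k → Λ n) →
             ⟨ ω , (λ S → sum λ j → a j * η j S) ⟩ ≈ sum λ j → a j * ⟨ ω , η j ⟩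
    ⟨⟩-sum {zero} {n}  ω a η = ∑ₛ-zero {n} λ S → zeroʳ (ω S)
    ⟨⟩-sum {suc k} {n} ω a η = begin
      ∑ₛ (λ S → ω S * (a zero * η zero S + rest S))
        ≈⟨ ∑ₛ-cong {n} (λ S → trans
             (solve 4 (λ w a h r → (w :* (a :* h :+ r)) := (a :* (w :* h) :+ w :* r)) refl _ _ _ _)
             (+-congˡ (sym (*-identityˡ _)))) ⟩
      ∑ₛ (λ S → a zero * (ω S * η zero S) + 1# * (ω S * rest S))
        ≈⟨ ∑ₛ-linear {n} (a zero) 1# _ _ ⟩
      a zero * ⟨ ω , η zero ⟩ + 1# * ⟨ ω , rest ⟩
        ≈⟨ +-congˡ (trans (*-identityˡ _) (⟨⟩-sum ω (a ∘ suc) (η ∘ suc))) ⟩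
      sum (λ j → a j * ⟨ ω , η j ⟩) ∎
      where rest = λ S → sum λ j → a (suc j) * η (suc j) S

  -- Diagonal scaling, degrees, and coordinates as minors.

  -- Recursion on S, instead of the product behind `∏[∈_]_`, unfolds in step with `_∧_`.
  monomial : ∀ {n} → Vector Carrier n → Λ n
  monomial z []            = 1#
  monomial z (outside ∷ S) = monomial (tail z) S
  monomial z (inside  ∷ S) = head z * monomial (tail z) S

  -- The map e_S ↦ z^S e_S is the algebra endomorphism induced by diag(z), hence multiplicative for
  -- the wedge. At coordinates with e₀, the factor z₀ is first moved into ω so that the induction
  -- hypothesis applies to the tails.
  ∧-scale : ∀ {n} (z v : Vector Carrier n) (ω : Λ n) → ∀ S →
            ((λ i → z i * v i) ∧ (λ S → monomial z S * ω S)) S ≈ monomial z S * (v ∧ ω) S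
  ∧-scale z v ω []            = sym (zeroʳ _)
  ∧-scale z v ω (outside ∷ S) = ∧-scale (tail z) (tail v) (ω ∘ (outside ∷_)) S
  ∧-scale z v ω (inside  ∷ S) = begin
    head z * head v * (monomial (tail z) S * ωₒ S)
      + ε * (tailzv ∧ (λ S → head z * monomial (tail z) S * ωᵢ S)) S
      ≈⟨ +-congˡ (*-congˡ (∧-cong (λ _ → refl) (λ S →
           trans (*-congʳ (*-comm _ _)) (*-assoc _ _ _)) S)) ⟩
    head z * head v * (monomial (tail z) S * ωₒ S)
      + ε * (tailzv ∧ (λ S → monomial (tail z) S * (head z * ωᵢ S))) S
      ≈⟨ +-congˡ (*-congˡ (∧-scale (tail z) (tail v) (λ S → head z * ωᵢ S) S)) ⟩
    head z * head v * (monomial (tail z) S * ωₒ S)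
      + ε * (monomial (tail z) S * (tail v ∧ (λ S → head z * ωᵢ S)) S)
      ≈⟨ +-congˡ (*-congˡ (*-congˡ (begin
           (tail v ∧ (λ S → head z * ωᵢ S)) S
             ≈⟨ ∧-cong (λ _ → refl) (λ S → trans (+-congˡ (zeroˡ _)) (+-identityʳ _)) S ⟨
           (tail v ∧ (λ S → head z * ωᵢ S + 0# * ωᵢ S)) S
             ≈⟨ ∧-linear (tail v) (head z) 0# ωᵢ ωᵢ S ⟩
           head z * (tail v ∧ ωᵢ) S + 0# * (tail v ∧ ωᵢ) S
             ≈⟨ trans (+-congˡ (zeroˡ _)) (+-identityʳ _) ⟩
           head z * (tail v ∧ ωᵢ) S ∎))) ⟩
    head z * head v * (monomial (tail z) S * ωₒ S)
      + ε * (monomial (tail z) S * (head z * (tail v ∧ ωᵢ) S))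
      ≈⟨ solve 6 (λ e z v m o i → (z :* v :* (m :* o) :+ e :* (m :* (z :* i))) :=
           (z :* m :* (v :* o :+ e :* i))) refl ε _ _ _ _ _ ⟩
    head z * monomial (tail z) S * (head v * ωₒ S + ε * (tail v ∧ ωᵢ) S) ∎
    where
    ωₒ = ω ∘ (outside ∷_)
    ωᵢ = ω ∘ (inside ∷_)
    tailzv = λ i → tail z i * tail v i

  ⋀-scale : ∀ {k n} (z : Vector Carrier n) (v : Fin k → Vector Carrier n) → ∀ S →
            ⋀ (λ i j → z j * v i j) S ≈ monomial z S * ⋀ v S
  ⋀-scale {zero}  z v []            = sym (*-identityˡ 1#)
  ⋀-scale {zero}  z v (outside ∷ S) = ⋀-scale {zero} (tail z) (λ ()) S
  ⋀-scale {zero}  z v (inside  ∷ S) = sym (zeroʳ _)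
  ⋀-scale {suc k} z v S = trans
    (∧-cong (λ _ → refl) (⋀-scale z (v ∘ suc)) S) (∧-scale z (v zero) (⋀ (v ∘ suc)) S)

  -- Homogeneity, with an offset a so that the degree can drop in the recursion.
  ∧-homogeneous : ∀ {n} a k (v : Vector Carrier n) (ω : Λ n) →
                  (∀ S → a +ℕ ∣ S ∣ ≢ k → ω S ≈ 0#) → ∀ S → a +ℕ ∣ S ∣ ≢ suc k → (v ∧ ω) S ≈ 0#
  ∧-homogeneous a k v ω h []            ≢ = refl
  ∧-homogeneous a k v ω h (outside ∷ S) ≢ = ∧-homogeneous a k (tail v) (ω ∘ (outside ∷_))
      (h ∘ (outside ∷_)) S ≢
  ∧-homogeneous a k v ω h (inside  ∷ S) ≢ = trans
    (+-cong (trans (*-congˡ (h (outside ∷ S) λ eq → ≢ (≡.trans (ℕ.+-suc a ∣ S ∣) (cong suc eq))))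
        (zeroʳ _))
            (trans (*-congˡ (∧-homogeneous (suc a) k (tail v) (ω ∘ (inside ∷_))
                      (λ S ≢k → h (inside ∷ S) λ eq → ≢k (≡.trans (≡.sym (ℕ.+-suc a ∣ S ∣)) eq)) S
                      λ eq → ≢ (≡.trans (ℕ.+-suc a ∣ S ∣) eq)))
                   (zeroʳ ε)))
    (+-identityˡ 0#)

  ⋀-homogeneous : ∀ {k n} (v : Fin k → Vector Carrier n) → ∀ S → ∣ S ∣ ≢ k → ⋀ v S ≈ 0#
  ⋀-homogeneous {zero}  v []            ≢ = contradiction ≡.refl ≢
  ⋀-homogeneous {zero}  v (outside ∷ S) ≢ = ⋀-homogeneous {zero} (λ ()) S ≢
  ⋀-homogeneous {zero}  v (inside  ∷ S) ≢ = refl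
  ⋀-homogeneous {suc k} v S ≢ = ∧-homogeneous 0 k (v zero) (⋀ (v ∘ suc)) (⋀-homogeneous (v ∘ suc)) S ≢

  ∧-zeroˡ : ∀ {n} {v : Vector Carrier n} (ω : Λ n) → (∀ i → v i ≈ 0#) → ∀ S → (v ∧ ω) S ≈ 0#
  ∧-zeroˡ ω v≈0 []            = refl
  ∧-zeroˡ ω v≈0 (outside ∷ S) = ∧-zeroˡ (ω ∘ (outside ∷_)) (v≈0 ∘ suc) S
  ∧-zeroˡ ω v≈0 (inside  ∷ S) = trans
    (+-cong (trans (*-congʳ (v≈0 zero)) (zeroˡ _))
            (trans (*-congˡ (∧-zeroˡ (ω ∘ (inside ∷_)) (v≈0 ∘ suc) S)) (zeroʳ ε)))
    (+-identityˡ 0#)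

  ⋀-outside : ∀ {k n} (v : Fin k → Vector Carrier (suc n)) → ∀ S →
              ⋀ v (outside ∷ S) ≈ ⋀ (tail ∘ v) S
  ⋀-outside {zero}  v S = refl
  ⋀-outside {suc k} v S = ∧-cong (λ _ → refl) (⋀-outside (v ∘ suc)) S

  ⋀-inside : ∀ {k n} (v : Fin k → Vector Carrier (suc n)) → (∀ i → v i zero ≈ 0#) →
             ∀ S → ⋀ v (inside ∷ S) ≈ 0#
  ⋀-inside {zero}  v v₀≈0 S = refl
  ⋀-inside {suc k} v v₀≈0 S = trans
    (+-cong (trans (*-congʳ (v₀≈0 zero)) (zeroˡ _))
            (trans (*-congˡ (∧-zero (tail (v zero)) (⋀-inside (v ∘ suc) (v₀≈0 ∘ suc)) S)) (zeroʳ ε)))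
    (+-identityˡ 0#)

  sum-Id : ∀ {n} (v : Vector Carrier n) j → v • Id j ≈ v j
  sum-Id v zero = trans
    (+-cong (*-identityʳ (v zero)) (sum-zero λ i → zeroʳ (v (suc i)))) (+-identityʳ (v zero))
  sum-Id v (suc j) = trans (+-cong (zeroʳ (v zero)) (sum-Id (v ∘ suc) j)) (+-identityˡ _)

  sum-Idˡ : ∀ {n} i (a : Vector Carrier n) → sum (λ j → Id i j * a j) ≈ a i
  sum-Idˡ {n} i a = trans (sum-cong-≋ {n} λ j → *-comm (Id i j) (a j)) (sum-Id a i)

  Id-sym : ∀ {p} (i j : Fin p) → Id i j ≈ Id j i
  Id-sym zero    zero    = refl
  Id-sym zero    (suc j) = refl
  Id-sym (suc i) zero    = refl
  Id-sym (suc i) (suc j) = Id-sym i j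

  sum-Idʳ : ∀ {n} (a : Vector Carrier n) j → sum (λ i → a i * Id i j) ≈ a j
  sum-Idʳ {n} a j = trans (sum-cong-≋ {n} λ i → *-congˡ (Id-sym i j)) (sum-Id a j)

  Id-refl : ∀ {n} (i : Fin n) → Id i i ≈ 1#
  Id-refl zero    = refl
  Id-refl (suc i) = Id-refl i

  Id-≢ : ∀ {n} {i j : Fin n} → i ≢ j → Id i j ≈ 0#
  Id-≢ {i = zero}  {zero}  i≢j = contradiction ≡.refl i≢j
  Id-≢ {i = zero}  {suc j} i≢j = refl
  Id-≢ {i = suc i} {zero}  i≢j = refl
  Id-≢ {i = suc i} {suc j} i≢j = Id-≢ (i≢j ∘ cong suc)

  -- An exchange of two finite sums. Every regrouping of matrix products further on is this identity
  -- for a row a and a column b.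
  sum-assoc : ∀ {m n} (a : Vector Carrier m) (M : Matrix Carrier m n) (b : Vector Carrier n) →
              sum (λ j → sum (λ i → a i * M i j) * b j) ≈ sum (λ i → a i * sum (λ j → M i j * b j))
  sum-assoc {m} {n} a M b = begin
    sum (λ j → sum (λ i → a i * M i j) * b j)
        ≈⟨ sum-cong-≋ {n} (λ j → *-distribʳ-sum {m} (b j) (λ i → a i * M i j)) ⟩
    sum (λ j → sum (λ i → a i * M i j * b j))    ≈⟨ ∑-comm {n} {m} (λ j i → a i * M i j * b j) ⟩
    sum (λ i → sum (λ j → a i * M i j * b j))
        ≈⟨ sum-cong-≋ {m} (λ i → sum-cong-≋ {n} λ j → *-assoc (a i) (M i j) (b j)) ⟩
    sum (λ i → sum (λ j → a i * (M i j * b j)))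
        ≈⟨ sum-cong-≋ {m} (λ i → *-distribˡ-sum {n} (a i) (λ j → M i j * b j)) ⟨
    sum (λ i → a i * sum (λ j → M i j * b j))    ∎

  basis : ∀ {n} → Subset n → Λ n
  basis []            []            = 1#
  basis (outside ∷ S) (outside ∷ T) = basis S T
  basis (outside ∷ S) (inside  ∷ T) = 0#
  basis (inside  ∷ S) (outside ∷ T) = 0#
  basis (inside  ∷ S) (inside  ∷ T) = basis S T

  ⟨,basis⟩ : ∀ {n} (ω : Λ n) S → ⟨ ω , basis S ⟩ ≈ ω S
  ⟨,basis⟩ ω []            = *-identityʳ (ω [])
  ⟨,basis⟩ {suc n} ω (outside ∷ S) = trans
    (+-cong (⟨,basis⟩ (ω ∘ (outside ∷_)) S) (∑ₛ-zero {n} λ T → zeroʳ _)) (+-identityʳ _)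
  ⟨,basis⟩ {suc n} ω (inside  ∷ S) = trans
    (+-cong (∑ₛ-zero {n} λ T → zeroʳ _) (⟨,basis⟩ (ω ∘ (inside ∷_)) S)) (+-identityˡ _)

  ⋀-e₀∧ : ∀ {k n} (v : Fin (suc k) → Vector Carrier (suc n)) →
          v zero zero ≈ 1# → (∀ j → v zero (suc j) ≈ 0#) →
          ∀ S → ⋀ v (inside ∷ S) ≈ ⋀ (tail ∘ v ∘ suc) S
  ⋀-e₀∧ v v₀₀≈1 v₀≈0 S = trans
    (+-cong (trans (*-congʳ v₀₀≈1) (*-identityˡ _))
            (trans (*-congˡ (∧-zeroˡ _ v₀≈0 S)) (zeroʳ ε)))
    (trans (+-identityʳ _) (⋀-outside (v ∘ suc) S))

  -- The selected rows of `Id` are the basis vectors of S in increasing order, so their wedge is e_S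
  -- without a sign.
  ⋀-basis : ∀ {n} (S : Subset n) → ∀ T → ⋀ (Id ∘ enum S) T ≈ basis S T
  ⋀-basis []            []            = refl
  ⋀-basis (outside ∷ S) (outside ∷ T) = trans (⋀-outside (Id ∘ suc ∘ enum S) T) (⋀-basis S T)
  ⋀-basis (outside ∷ S) (inside  ∷ T) = ⋀-inside (Id ∘ suc ∘ enum S) (λ _ → refl) T
  ⋀-basis (inside  ∷ S) (outside ∷ T) =
    ∧-zeroˡ (⋀ (Id ∘ suc ∘ enum S) ∘ (outside ∷_)) (λ _ → refl) T
  ⋀-basis (inside  ∷ S) (inside  ∷ T) =
    trans (⋀-e₀∧ (Id ∘ enum (inside ∷ S)) refl (λ _ → refl) T) (⋀-basis S T)

  -- Cauchy-Binet with the basis vectors of S as second family: the pairing reads off the coordinate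
  -- at S, and the scalar products read off the columns in S.
  ⋀-minor : ∀ {k n} (W : Matrix Carrier k n) S (eq : ∣ S ∣ ≡ k) →
            ⋀ W S ≈ det (λ i j → W i (enum S (≡.subst Fin (≡.sym eq) j)))
  ⋀-minor {n = n} W S ≡.refl = begin
    ⋀ W S                              ≈⟨ ⟨,basis⟩ (⋀ W) S ⟨
    ⟨ ⋀ W , basis S ⟩                  ≈⟨ ∑ₛ-cong {n} (λ T → *-congˡ (⋀-basis S T)) ⟨
    ⟨ ⋀ W , ⋀ (Id ∘ enum S) ⟩          ≈⟨ cauchy-binet W (Id ∘ enum S) ⟨
    det (λ i j → W i • Id (enum S j))  ≈⟨ det-cong (λ i j → sum-Id (W i) (enum S j)) ⟩
    det (λ i j → W i (enum S j))       ∎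

  ∑ₛ-⊤ : ∀ {n} (ω : Λ n) → (∀ S → ∣ S ∣ ≢ n → ω S ≈ 0#) → ∑ₛ ω ≈ ω ⊤
  ∑ₛ-⊤ {zero}  ω h = refl
  ∑ₛ-⊤ {suc n} ω h = trans
    (+-cong (∑ₛ-zero {n} λ S → h (outside ∷ S) λ eq → ℕ.<-irrefl eq (ℕ.s≤s (∣p∣≤n S)))
            (∑ₛ-⊤ (ω ∘ (inside ∷_)) λ S ≢n → h (inside ∷ S) (≢n ∘ ℕ.suc-injective)))
    (+-identityˡ _)

  ⟨⋀,⋀⟩-⊤ : ∀ {n} (v w : Matrix Carrier n n) → ⟨ ⋀ v , ⋀ w ⟩ ≈ ⋀ v ⊤ * ⋀ w ⊤
  ⟨⋀,⋀⟩-⊤ v w = ∑ₛ-⊤ (λ S → ⋀ v S * ⋀ w S) λ S ≢n →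
    trans (*-congʳ (⋀-homogeneous v S ≢n)) (zeroˡ _)

  ⋀-Id : ∀ {n} → ⋀ (Id {n}) ⊤ ≈ 1#
  ⋀-Id {zero}  = refl
  ⋀-Id {suc n} = trans (⋀-e₀∧ {n} Id refl (λ _ → refl) ⊤) (⋀-Id {n})

  det≈⋀⊤ : ∀ {n} (M : Matrix Carrier n n) → det M ≈ ⋀ M ⊤
  det≈⋀⊤ {n} M = begin
    det M                       ≈⟨ det-cong (λ i j → sum-Id (M i) j) ⟨
    det (λ i j → M i • Id j)    ≈⟨ cauchy-binet M Id ⟩
    ⟨ ⋀ M , ⋀ (Id {n}) ⟩        ≈⟨ ⟨⋀,⋀⟩-⊤ M (Id {n}) ⟩
    ⋀ M ⊤ * ⋀ (Id {n}) ⊤        ≈⟨ *-congˡ (⋀-Id {n}) ⟩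
    ⋀ M ⊤ * 1#                  ≈⟨ *-identityʳ _ ⟩
    ⋀ M ⊤                       ∎

  -- Cauchy-Binet for the rows of M and the columns of N, where only the full set contributes. The
  -- second factor is left as a top coordinate, since `det-divides` uses it only as a cofactor.
  det-⊗ : ∀ {n} (M N : Matrix Carrier n n) → det (M ⊗ N) ≈ det M * ⋀ (λ k j → N j k) ⊤
  det-⊗ M N = begin
    det (M ⊗ N)                 ≈⟨ cauchy-binet M (λ k j → N j k) ⟩
    ⟨ ⋀ M , ⋀ (λ k j → N j k) ⟩           ≈⟨ ⟨⋀,⋀⟩-⊤ M (λ k j → N j k) ⟩
    ⋀ M ⊤ * ⋀ (λ k j → N j k) ⊤           ≈⟨ *-congʳ (det≈⋀⊤ M) ⟨
    det M * ⋀ (λ k j → N j k) ⊤           ∎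

  -- Splitting the columns of `Id∣ D` and expanding the determinant.

  sum-split : ∀ p {q} (v : Vector Carrier (p +ℕ q)) →
              sum v ≈ sum (λ i → v (i ↑ˡ q)) + sum (λ j → v (p ↑ʳ j))
  sum-split zero    v = sym (+-identityˡ _)
  sum-split (suc p) v = trans (+-congˡ (sum-split p (v ∘ suc))) (sym (+-assoc _ _ _))

  ∑ₛ-split : ∀ p {q} (ω : Λ (p +ℕ q)) → ∑ₛ ω ≈ ∑ₛ {p} λ R → ∑ₛ {q} λ F → ω (R ++ F)
  ∑ₛ-split zero    ω = refl
  ∑ₛ-split (suc p) ω = +-cong (∑ₛ-split p (ω ∘ (outside ∷_))) (∑ₛ-split p (ω ∘ (inside ∷_)))

  monomial-cong : ∀ {n} {z w : Vector Carrier n} → (∀ i → z i ≈ w i) →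
                  ∀ S → monomial z S ≈ monomial w S
  monomial-cong z≈w []            = refl
  monomial-cong z≈w (outside ∷ S) = monomial-cong (z≈w ∘ suc) S
  monomial-cong z≈w (inside  ∷ S) = *-cong (z≈w zero) (monomial-cong (z≈w ∘ suc) S)

  monomial-++ : ∀ {p q} (z : Vector Carrier (p +ℕ q)) (R : Subset p) (F : Subset q) →
                monomial z (R ++ F) ≈ monomial (λ i → z (i ↑ˡ q)) R * monomial (λ j → z (p ↑ʳ j)) F
  monomial-++ z []            F = sym (*-identityˡ _)
  monomial-++ z (outside ∷ R) F = monomial-++ (tail z) R F
  monomial-++ z (inside  ∷ R) F = trans (*-congˡ (monomial-++ (tail z) R F)) (sym (*-assoc _ _ _))

  ∏≈monomial : ∀ {n} (z : Vector Carrier n) S → ∏[∈ S ] z ≈ monomial z S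
  ∏≈monomial z []            = refl
  ∏≈monomial z (outside ∷ S) = trans (*-identityˡ _) (∏≈monomial (tail z) S)
  ∏≈monomial z (inside  ∷ S) = *-congˡ (∏≈monomial (tail z) S)

  Id∣_ : ∀ {p q} → Matrix Carrier p q → Matrix Carrier p (p +ℕ q)
  (Id∣ D) i = Id i ++ᶠ D i

  diagonal-Id : ∀ {p} (x : Vector Carrier p) i j → (x i * Id i j) ≈ diagonal x i j
  diagonal-Id x i j with does (i Fin.≟ j)
  ... | true  = *-identityʳ (x i)
  ... | false = zeroʳ (x i)

  -- D Y Dᵀ + X = [I∣D] diag(x,y) [I∣D]ᵀ, to which Cauchy–Binet applies.
  det-expansion : ∀ {p q} (D : Matrix Carrier p q) (x : Vector Carrier p) (y : Vector Carrier q) →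
    let c = λ R F → ⋀ (Id∣ D) (R ++ F) in
    det (λ i j → sum (λ f → D i f * (y f * D j f)) + diagonal x i j)
      ≈ ∑ₛ λ R → ∑ₛ λ F → (c R F * c R F) * (monomial x R * monomial y F)
  det-expansion {p} {q} D x y = begin
    det (λ i j → sum (λ f → D i f * (y f * D j f)) + diagonal x i j)
      ≈⟨ det-cong entry ⟩
    det (λ i j → W i • (λ k → z k * W j k))
      ≈⟨ cauchy-binet W (λ j k → z k * W j k) ⟩
    ⟨ ⋀ W , ⋀ (λ j k → z k * W j k) ⟩
      ≈⟨ ∑ₛ-cong {p +ℕ q} (λ S → trans (*-congˡ (⋀-scale z W S))
           (solve 2 (λ m w → (w :* (m :* w)) := (w :* w :* m)) refl (monomial z S) (⋀ W S))) ⟩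
    ∑ₛ (λ S → (⋀ W S * ⋀ W S) * monomial z S)
      ≈⟨ ∑ₛ-split p _ ⟩
    ∑ₛ {p} (λ R → ∑ₛ {q} λ F → (⋀ W (R ++ F) * ⋀ W (R ++ F)) * monomial z (R ++ F))
      ≈⟨ ∑ₛ-cong {p} (λ R → ∑ₛ-cong {q} λ F → *-congˡ (trans (monomial-++ z R F)
           (*-cong (monomial-cong (λ i → reflexive (lookup-++ˡ x y i)) R)
                   (monomial-cong (λ j → reflexive (lookup-++ʳ x y j)) F)))) ⟩
    ∑ₛ {p} (λ R → ∑ₛ {q} λ F → (⋀ W (R ++ F) * ⋀ W (R ++ F)) * (monomial x R * monomial y F)) ∎
    where
    W = Id∣ D
    z = x ++ᶠ y
    entry : ∀ i j → sum (λ f → D i f * (y f * D j f)) + diagonal x i j ≈ W i • (λ k → z k * W j k)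
    entry i j = sym (begin
      W i • (λ k → z k * W j k)
        ≈⟨ sum-split p _ ⟩
      sum (λ r → W i (r ↑ˡ q) * (z (r ↑ˡ q) * W j (r ↑ˡ q)))
        + sum (λ f → W i (p ↑ʳ f) * (z (p ↑ʳ f) * W j (p ↑ʳ f)))
        ≈⟨ +-cong
             (sum-cong-≋ {p} λ r → *-cong (reflexive (lookup-++ˡ (Id i) (D i) r))
               (*-cong (reflexive (lookup-++ˡ x y r)) (reflexive (lookup-++ˡ (Id j) (D j) r))))
             (sum-cong-≋ {q} λ f → *-cong (reflexive (lookup-++ʳ (Id i) (D i) f))
               (*-cong (reflexive (lookup-++ʳ x y f)) (reflexive (lookup-++ʳ (Id j) (D j) f)))) ⟩
      sum (λ r → Id i r * (x r * Id j r)) + sum (λ f → D i f * (y f * D j f))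
        ≈⟨ +-congʳ (begin
             sum (λ r → Id i r * (x r * Id j r))
                 ≈⟨ sum-cong-≋ {p} (λ r → sym (*-assoc (Id i r) (x r) (Id j r))) ⟩
             (λ r → Id i r * x r) • Id j           ≈⟨ sum-Id (λ r → Id i r * x r) j ⟩
             Id i j * x j                          ≈⟨ trans (*-congʳ (Id-sym i j)) (*-comm _ _) ⟩
             x j * Id j i                          ≈⟨ diagonal-Id x j i ⟩
             diagonal x j i                        ≈⟨ diagonal-sym x j i ⟩
             diagonal x i j                        ∎) ⟩
      diagonal x i j + sum (λ f → D i f * (y f * D j f))
        ≈⟨ +-comm _ _ ⟩
      sum (λ f → D i f * (y f * D j f)) + diagonal x i j ∎)
      where
      diagonal-sym : ∀ {p} (x : Vector Carrier p) i j → diagonal x i j ≈ diagonal x j i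
      diagonal-sym x zero    zero    = refl
      diagonal-sym x zero    (suc j) = refl
      diagonal-sym x (suc i) zero    = refl
      diagonal-sym x (suc i) (suc j) = diagonal-sym (x ∘ suc) i j

-- Sums over lists of subsets.

module SubsetSums {c ℓ} (A : CommutativeRing c ℓ) where
  open import Data.Fin.Subset using (∣_∣)
  open CommutativeRing A hiding (zero)
  open LinearAlgebra rawRing using (∑-list; _^_)
  open Exterior A using (∑ₛ; ∑ₛ-cong; ∑ₛ-linear; monomial)
  open import Relation.Binary.Reasoning.Setoid setoid

  ∑-list-++ : ∀ {B : Set} (xs ys : List B) f → ∑-list (xs List.++ ys) f ≈ ∑-list xs f + ∑-list ys f
  ∑-list-++ []       ys f = sym (+-identityˡ _)
  ∑-list-++ (x ∷ xs) ys f = trans (+-congˡ (∑-list-++ xs ys f)) (sym (+-assoc _ _ _))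

  ∑-list-map : ∀ {B C : Set} (g : B → C) xs f → ∑-list (List.map g xs) f ≈ ∑-list xs (f ∘ g)
  ∑-list-map g []       f = refl
  ∑-list-map g (x ∷ xs) f = +-congˡ (∑-list-map g xs f)

  ∑-list-cong : ∀ {B : Set} (xs : List B) {f g} → (∀ x → f x ≈ g x) → ∑-list xs f ≈ ∑-list xs g
  ∑-list-cong []       f≈g = refl
  ∑-list-cong (x ∷ xs) f≈g = +-cong (f≈g x) (∑-list-cong xs f≈g)

  -- Lets the sum over rooted forests run over all pairs, since the minor at every other pair is
  -- zero.
  ∑-list-filter : ∀ {B : Set} {ℓ′} {P : Pred B ℓ′} (P? : Decidable P) xs f → (∀ x → ¬ P x → f x ≈ 0#) →
                  ∑-list (filter P? xs) f ≈ ∑-list xs f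
  ∑-list-filter P? []       f vanish = refl
  ∑-list-filter P? (x ∷ xs) f vanish with P? x
  ... | yes _ = +-congˡ (∑-list-filter P? xs f vanish)
  ... | no ¬p = trans (∑-list-filter P? xs f vanish)
      (sym (trans (+-congʳ (vanish x ¬p)) (+-identityˡ _)))

  ∑-list-× : ∀ {B C : Set} (xs : List B) (ys : List C) f →
             ∑-list (cartesianProduct xs ys) f ≈ ∑-list xs λ x → ∑-list ys λ y → f (x , y)
  ∑-list-× []       ys f = refl
  ∑-list-× (x ∷ xs) ys f = trans (∑-list-++ (List.map (x ,_) ys) (cartesianProduct xs ys) f)
    (+-cong (∑-list-map (x ,_) ys f) (∑-list-× xs ys f))

  ∑-list-subsets : ∀ n f → ∑-list (subsets n) f ≈ ∑ₛ f
  ∑-list-subsets zero    f = +-identityʳ (f [])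
  ∑-list-subsets (suc n) f = trans
      (∑-list-++ (List.map (outside ∷_) (subsets n)) (List.map (inside ∷_) (subsets n)) f)
    (+-cong (trans (∑-list-map (outside ∷_) (subsets n) f) (∑-list-subsets n (f ∘ (outside ∷_))))
            (trans (∑-list-map (inside ∷_) (subsets n) f) (∑-list-subsets n (f ∘ (inside ∷_)))))

  -- Reconciles two orders: pairs are listed by F first, whereas the columns of `Id∣ D` place R
  -- first.
  ∑ₛ-comm : ∀ p q (f : Subset p → Subset q → Carrier) →
            (∑ₛ λ R → ∑ₛ λ F → f R F) ≈ (∑ₛ λ F → ∑ₛ λ R → f R F)
  ∑ₛ-comm zero    q f = refl
  ∑ₛ-comm (suc p) q f = begin
    ∑ₛ {p} (λ R → ∑ₛ {q} λ F → f (outside ∷ R) F) + ∑ₛ {p} (λ R → ∑ₛ {q} λ F → f (inside ∷ R) F)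
      ≈⟨ +-cong (∑ₛ-comm p q (λ R → f (outside ∷ R))) (∑ₛ-comm p q (λ R → f (inside ∷ R))) ⟩
    ∑ₛ fₒ + ∑ₛ fᵢ
      ≈⟨ +-cong (*-identityˡ _) (*-identityˡ _) ⟨
    1# * ∑ₛ fₒ + 1# * ∑ₛ fᵢ
      ≈⟨ ∑ₛ-linear {q} 1# 1# fₒ fᵢ ⟨
    ∑ₛ (λ F → 1# * fₒ F + 1# * fᵢ F)
      ≈⟨ ∑ₛ-cong {q} (λ F → +-cong (*-identityˡ _) (*-identityˡ _)) ⟩
    ∑ₛ (λ F → fₒ F + fᵢ F) ∎
    where
    fₒ fᵢ : Subset q → Carrier
    fₒ F = ∑ₛ {p} λ R → f (outside ∷ R) F
    fᵢ F = ∑ₛ {p} λ R → f (inside ∷ R) F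

  ∑-list-pairs : ∀ {p q} (f : Subset q × Subset p → Carrier) →
                 ∑-list (cartesianProduct (subsets q) (subsets p)) f ≈ ∑ₛ λ R → ∑ₛ λ F → f (F , R)
  ∑-list-pairs {p} {q} f = begin
    ∑-list (cartesianProduct (subsets q) (subsets p)) f
      ≈⟨ ∑-list-× (subsets q) (subsets p) f ⟩
    ∑-list (subsets q) (λ F → ∑-list (subsets p) λ R → f (F , R))
      ≈⟨ ∑-list-cong (subsets q) (λ F → ∑-list-subsets p (λ R → f (F , R))) ⟩
    ∑-list (subsets q) (λ F → ∑ₛ {p} λ R → f (F , R))
      ≈⟨ ∑-list-subsets q _ ⟩
    ∑ₛ {q} (λ F → ∑ₛ {p} λ R → f (F , R))
      ≈⟨ ∑ₛ-comm p q (λ R F → f (F , R)) ⟨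
    ∑ₛ {p} (λ R → ∑ₛ {q} λ F → f (F , R)) ∎

  monomial-const : ∀ {n} x (S : Subset n) → monomial (λ _ → x) S ≈ x ^ ∣ S ∣
  monomial-const x []            = refl
  monomial-const x (outside ∷ S) = monomial-const x S
  monomial-const x (inside  ∷ S) = *-congˡ (monomial-const x S)

  monomial-one : ∀ {n} (S : Subset n) → monomial (λ _ → 1#) S ≈ 1#
  monomial-one []            = refl
  monomial-one (outside ∷ S) = monomial-one S
  monomial-one (inside  ∷ S) = trans (*-identityˡ _) (monomial-one S)

-- Carrying integer minors into a ring with indeterminates.

module FromIntegers {ℓ} (A : CommutativeRing 0ℓ ℓ) (h : ℤ → CommutativeRing.Carrier A)
  (h-isRingHomomorphism : IsRingHomomorphism ℤ.+-*-rawRing (CommutativeRing.rawRing A) h) where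
  open import Data.Vec.Base using (_++_)
  open import Data.Fin.Subset using (∣_∣)

  open CommutativeRing A hiding (zero)
  open LinearAlgebra rawRing
  open Exterior A
  open SubsetSums A
  open IsRingHomomorphism h-isRingHomomorphism
  open import Algebra.Properties.Semiring.Sum semiring using (sum-cong-≋)
  open import Relation.Binary.Reasoning.Setoid setoid
  private
    module ℤE = Exterior ℤ.+-*-commutativeRing
    module ℤLin = LinearAlgebra ℤ.+-*-rawRing

  ε-homo′ : h -1ℤ ≈ ε
  ε-homo′ = trans (-‿homo 1ℤ) (-‿cong 1#-homo)

  ∧-homo : ∀ {n} (v : Vector ℤ n) {ω : Λ n} {η : ℤE.Λ n} → (∀ S → ω S ≈ h (η S)) →
           ∀ S → ((h ∘ v) ∧ ω) S ≈ h ((v ℤE.∧ η) S)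
  ∧-homo v ω≈η []            = sym 0#-homo
  ∧-homo v ω≈η (outside ∷ S) = ∧-homo (tail v) (ω≈η ∘ (outside ∷_)) S
  ∧-homo v {ω} {η} ω≈η (inside  ∷ S) = begin
    h (v zero) * ω (outside ∷ S) + ε * ((h ∘ tail v) ∧ (ω ∘ (inside ∷_))) S
      ≈⟨ +-cong (*-congˡ (ω≈η (outside ∷ S)))
           (*-cong (sym ε-homo′) (∧-homo (tail v) (ω≈η ∘ (inside ∷_)) S)) ⟩
    h (v zero) * h (η (outside ∷ S)) + h -1ℤ * h ((tail v ℤE.∧ (η ∘ (inside ∷_))) S)
      ≈⟨ +-cong (*-homo (v zero) (η (outside ∷ S))) (*-homo -1ℤ ((tail v ℤE.∧ (η ∘ (inside ∷_))) S)) ⟨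
    h (v zero ℤ.* η (outside ∷ S)) + h (-1ℤ ℤ.* (tail v ℤE.∧ (η ∘ (inside ∷_))) S)
      ≈⟨ +-homo (v zero ℤ.* η (outside ∷ S)) (-1ℤ ℤ.* (tail v ℤE.∧ (η ∘ (inside ∷_))) S) ⟨
    h ((v ℤE.∧ η) (inside ∷ S)) ∎

  ⋀-homo : ∀ {k n} (v : Matrix ℤ k n) → ∀ S → ⋀ (λ i j → h (v i j)) S ≈ h (ℤE.⋀ v S)
  ⋀-homo {zero}  v []            = sym 1#-homo
  ⋀-homo {zero}  v (outside ∷ S) = ⋀-homo {zero} (λ ()) S
  ⋀-homo {zero}  v (inside  ∷ S) = sym 0#-homo
  ⋀-homo {suc k} v S             = ∧-homo (v zero) (⋀-homo (v ∘ suc)) S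

  Id-homo : ∀ {n} (i j : Fin n) → Id i j ≈ h (ℤLin.Id i j)
  Id-homo zero    zero    = sym 1#-homo
  Id-homo zero    (suc j) = sym 0#-homo
  Id-homo (suc i) zero    = sym 0#-homo
  Id-homo (suc i) (suc j) = Id-homo i j

  Id∣-homo : ∀ {p q} (M : Matrix ℤ p q) i j → (Id∣ (λ i j → h (M i j))) i j ≈ h ((ℤE.Id∣ M) i j)
  Id∣-homo {p} M i j with splitAt p j
  ... | inj₁ r = Id-homo i r
  ... | inj₂ f = refl

  sum-homo : ∀ {n} (a b : Vector ℤ n) → h (ℤLin.sum λ i → a i ℤ.* b i) ≈ sum λ i → h (a i) * h (b i)
  sum-homo {zero}  a b = 0#-homo
  sum-homo {suc n} a b = trans (+-homo (a zero ℤ.* b zero) (ℤLin.sum λ i → a (suc i) ℤ.* b (suc i)))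
    (+-cong (*-homo (a zero) (b zero)) (sum-homo (a ∘ suc) (b ∘ suc)))

  -- Squaring removes the sign by which the minor may differ from the order of the homology group.
  ∣∣²-homo : ∀ z → h (+ ℤ.∣ z ∣) ^ 2 ≈ h z * h z
  ∣∣²-homo z = begin
    h (+ ℤ.∣ z ∣) * (h (+ ℤ.∣ z ∣) * 1#)   ≈⟨ *-congˡ (*-identityʳ _) ⟩
    h (+ ℤ.∣ z ∣) * h (+ ℤ.∣ z ∣)          ≈⟨ *-homo (+ ℤ.∣ z ∣) (+ ℤ.∣ z ∣) ⟨
    h (+ ℤ.∣ z ∣ ℤ.* + ℤ.∣ z ∣)            ≈⟨ reflexive (≡.cong h (square z)) ⟩
    h (z ℤ.* z)                            ≈⟨ *-homo z z ⟩
    h z * h z                              ∎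
    where
    square : ∀ z → + ℤ.∣ z ∣ ℤ.* + ℤ.∣ z ∣ ≡ z ℤ.* z
    square (+ n)    = ≡.refl
    square -[1+ n ] = ≡.refl

  module _ {p q} (M : Matrix ℤ p q) (x : Vector Carrier p) (y : Vector Carrier q)
           {ℓ′} {P : Pred (Subset q × Subset p) ℓ′} (P? : Decidable P)
           (minor≡0 : ∀ FR → ¬ P FR → ℤE.⋀ (ℤE.Id∣ M) (proj₂ FR ++ proj₁ FR) ≡ 0ℤ) where

    private
      D : Matrix Carrier p q
      D i j = h (M i j)

      minor : Subset q × Subset p → ℤ
      minor (F , R) = ℤE.⋀ (ℤE.Id∣ M) (R ++ F)

    -- The weight is a parameter because the two identities of the theorem write it differently, as
    -- a power of x and as a pair of products.
    det-expansion-list : ∀ (w : Subset q × Subset p → Carrier) →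
      (∀ F R → w (F , R) ≈ monomial x R * monomial y F) →
      ∑-list (filter P? (cartesianProduct (subsets q) (subsets p)))
          (λ FR → h (+ ℤ.∣ minor FR ∣) ^ 2 * w FR)
        ≈ det (λ i j → sum (λ f → D i f * (y f * D j f)) + diagonal x i j)
    det-expansion-list w w≈ = begin
      ∑-list (filter P? (cartesianProduct (subsets q) (subsets p))) term
        ≈⟨ ∑-list-filter P? (cartesianProduct (subsets q) (subsets p)) term vanish ⟩
      ∑-list (cartesianProduct (subsets q) (subsets p)) term
        ≈⟨ ∑-list-pairs term ⟩
      ∑ₛ {p} (λ R → ∑ₛ {q} λ F → term (F , R))
        ≈⟨ ∑ₛ-cong {p} (λ R → ∑ₛ-cong {q} λ F → *-cong (begin
             h (+ ℤ.∣ minor (F , R) ∣) ^ 2      ≈⟨ ∣∣²-homo (minor (F , R)) ⟩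
             h (minor (F , R)) * h (minor (F , R)) ≈⟨ *-cong (⋀-minor≈ R F) (⋀-minor≈ R F) ⟨
             ⋀ (Id∣ D) (R ++ F) * ⋀ (Id∣ D) (R ++ F) ∎) (w≈ F R)) ⟩
      ∑ₛ {p} (λ R → ∑ₛ {q} λ F → (⋀ (Id∣ D) (R ++ F) * ⋀ (Id∣ D) (R ++ F)) *
          (monomial x R * monomial y F))
        ≈⟨ det-expansion D x y ⟨
      det (λ i j → sum (λ f → D i f * (y f * D j f)) + diagonal x i j) ∎
      where
      term : Subset q × Subset p → Carrier
      term FR = h (+ ℤ.∣ minor FR ∣) ^ 2 * w FR
      ⋀-minor≈ : ∀ R F → ⋀ (Id∣ D) (R ++ F) ≈ h (minor (F , R))
      ⋀-minor≈ R F = trans (⋀-cong (Id∣-homo M) (R ++ F)) (⋀-homo (ℤE.Id∣ M) (R ++ F))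
      vanish : ∀ FR → ¬ P FR → term FR ≈ 0#
      vanish FR ¬p = trans (*-congʳ (begin
        h (+ ℤ.∣ minor FR ∣) * (h (+ ℤ.∣ minor FR ∣) * 1#)
          ≈⟨ *-congʳ (trans (reflexive (≡.cong (λ z → h (+ ℤ.∣ z ∣)) (minor≡0 FR ¬p))) 0#-homo) ⟩
        0# * (h (+ ℤ.∣ minor FR ∣) * 1#)
          ≈⟨ zeroˡ _ ⟩
        0# ∎)) (zeroˡ _)

    D≗ : ∀ i j → sum (λ f → D i f * (y f * D j f)) ≈ (D ⊗ diagonal y ⊗ D ᵀ) i j
    D≗ i j = sum-cong-≋ {q} λ f → begin
      D i f * (y f * D j f)                               ≈⟨ *-assoc (D i f) (y f) (D j f) ⟨
      D i f * y f * D j f                                 ≈⟨ *-congʳ (sum-Idʳ (λ k → D i k * y k) f) ⟨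
      sum (λ k → D i k * y k * Id k f) * D j f
        ≈⟨ *-congʳ (sum-cong-≋ {q} λ k → trans (*-assoc (D i k) (y k) (Id k f))
             (*-congˡ (diagonal-Id y k f))) ⟩
      sum (λ k → D i k * diagonal y k f) * D j f          ∎

    det-weighted :
      ∑-list (filter P? (cartesianProduct (subsets q) (subsets p)))
        (λ (F , R) → h (+ ℤ.∣ minor (F , R) ∣) ^ 2 * (∏[∈ R ] x) * (∏[∈ F ] y))
        ≈ det (D ⊗ diagonal y ⊗ D ᵀ ⊕ diagonal x)
    det-weighted = begin
      ∑-list rooted (λ (F , R) → h (+ ℤ.∣ minor (F , R) ∣) ^ 2 * (∏[∈ R ] x) * (∏[∈ F ] y))
        ≈⟨ ∑-list-cong rooted (λ _ → *-assoc _ _ _) ⟩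
      ∑-list rooted (λ (F , R) → h (+ ℤ.∣ minor (F , R) ∣) ^ 2 * ((∏[∈ R ] x) * (∏[∈ F ] y)))
        ≈⟨ det-expansion-list (λ (F , R) → (∏[∈ R ] x) * (∏[∈ F ] y))
             (λ F R → *-cong (∏≈monomial x R) (∏≈monomial y F)) ⟩
      det (λ i j → sum (λ f → D i f * (y f * D j f)) + diagonal x i j)
        ≈⟨ det-cong (λ i j → +-congʳ (D≗ i j)) ⟩
      det (D ⊗ diagonal y ⊗ D ᵀ ⊕ diagonal x) ∎
      where rooted = filter P? (cartesianProduct (subsets q) (subsets p))

  module _ {p q} (M : Matrix ℤ p q) (x : Carrier)
           {ℓ′} {P : Pred (Subset q × Subset p) ℓ′} (P? : Decidable P)
           (minor≡0 : ∀ FR → ¬ P FR → ℤE.⋀ (ℤE.Id∣ M) (proj₂ FR ++ proj₁ FR) ≡ 0ℤ) where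

    -- The general expansion with all x equal and all y equal to 1, taken in the ring itself; this
    -- avoids substituting into polynomials in p + q indeterminates.
    det-uniform :
      ∑-list (filter P? (cartesianProduct (subsets q) (subsets p)))
        (λ (F , R) → h (+ ℤ.∣ ℤE.⋀ (ℤE.Id∣ M) (R ++ F) ∣) ^ 2 * x ^ ∣ R ∣)
        ≈ det (mapMatrix h (M ℤLin.⊗ M ᵀ) ⊕ x · Id)
    det-uniform = begin
      ∑-list (filter P? (cartesianProduct (subsets q) (subsets p)))
        (λ (F , R) → h (+ ℤ.∣ ℤE.⋀ (ℤE.Id∣ M) (R ++ F) ∣) ^ 2 * x ^ ∣ R ∣)
        ≈⟨ det-expansion-list M (λ _ → x) (λ _ → 1#) P? minor≡0 (λ (F , R) → x ^ ∣ R ∣)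
             (λ F R → sym (trans
             (*-cong (monomial-const x R) (monomial-one F)) (*-identityʳ _))) ⟩
      det (λ i j → sum (λ f → h (M i f) * (1# * h (M j f))) + diagonal (λ _ → x) i j)
        ≈⟨ det-cong (λ i j → +-cong
             (trans (sum-cong-≋ {q} λ f → *-congˡ (*-identityˡ (h (M j f))))
                 (sym (sum-homo (M i) (M j))))
             (sym (diagonal-Id (λ _ → x) i j))) ⟩
      det (mapMatrix h (M ℤLin.⊗ M ᵀ) ⊕ x · Id) ∎

-- The commutative ring of integer polynomials.

module Polynomial (N : ℕ) where
  open ≡ using (refl; sym; trans)
  open import Data.List.Base using (map; _++_)
  open import Data.Integer.Base using (_+_; _*_; -_)
  private
    module P = RawRing ℤ[ N ]
  open ℤ.+-*-Solver using (solve; _:=_; _:+_; _:*_; :-_; con)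
  open ≡-Reasoning

  infixl 6 _⊹_
  _⊹_ : ∀ {N} → Monomial N → Monomial N → Monomial N
  _⊹_ = Vec.zipWith ℕ._+_

  -- The value at f of the ℤ-linear functional sending the monomial u to φ u.
  ⟦_⟧ : Poly N → (Monomial N → ℤ) → ℤ
  ⟦ []          ⟧ φ = 0ℤ
  ⟦ (c , u) ∷ f ⟧ φ = c * φ u + ⟦ f ⟧ φ

  δ : ∀ {N} → Monomial N → Monomial N → ℤ
  δ m u = if does (Vec.≡-dec ℕ._≟_ u m) then 1ℤ else 0ℤ

  coeff≡⟦δ⟧ : ∀ f m → coeff f m ≡ ⟦ f ⟧ (δ m)
  coeff≡⟦δ⟧ []            m = refl
  coeff≡⟦δ⟧ ((c , u) ∷ f) m with Vec.≡-dec ℕ._≟_ u m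
  ... | yes _ = cong₂ _+_ (sym (ℤ.*-identityʳ c)) (coeff≡⟦δ⟧ f m)
  ... | no  _ = cong₂ _+_ (sym (ℤ.*-zeroʳ c)) (coeff≡⟦δ⟧ f m)

  -- Coefficients are particular linear functionals. Testing against all functionals is the
  -- convenient form, because multiplication replaces a functional by its translates, which need not
  -- be coefficients.
  ≈-from-⟦⟧ : ∀ f g → (∀ φ → ⟦ f ⟧ φ ≡ ⟦ g ⟧ φ) → f P.≈ g
  ≈-from-⟦⟧ f g eq m = begin
    coeff f m    ≡⟨ coeff≡⟦δ⟧ f m ⟩
    ⟦ f ⟧ (δ m)  ≡⟨ eq (δ m) ⟩
    ⟦ g ⟧ (δ m)  ≡⟨ coeff≡⟦δ⟧ g m ⟨
    coeff g m    ∎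

  ⟦⟧-cong : ∀ f {φ ψ} → (∀ u → φ u ≡ ψ u) → ⟦ f ⟧ φ ≡ ⟦ f ⟧ ψ
  ⟦⟧-cong []            eq = refl
  ⟦⟧-cong ((c , u) ∷ f) eq = cong₂ (λ a b → c * a + b) (eq u) (⟦⟧-cong f eq)

  ⟦⟧-zero : ∀ f → ⟦ f ⟧ (λ _ → 0ℤ) ≡ 0ℤ
  ⟦⟧-zero []            = refl
  ⟦⟧-zero ((c , u) ∷ f) = cong₂ _+_ (ℤ.*-zeroʳ c) (⟦⟧-zero f)

  ⟦⟧-linear : ∀ f c φ ψ → ⟦ f ⟧ (λ u → c * φ u + ψ u) ≡ c * ⟦ f ⟧ φ + ⟦ f ⟧ ψ
  ⟦⟧-linear []            c φ ψ = solve 1 (λ c → con 0ℤ := c :* con 0ℤ :+ con 0ℤ) refl c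
  ⟦⟧-linear ((b , u) ∷ f) c φ ψ = trans (cong (λ z → b * (c * φ u + ψ u) + z) (⟦⟧-linear f c φ ψ))
    (solve 6 (λ b c x y p q →
        b :* (c :* x :+ y) :+ (c :* p :+ q) := c :* (b :* x :+ p) :+ (b :* y :+ q)) refl
      b c (φ u) (ψ u) (⟦ f ⟧ φ) (⟦ f ⟧ ψ))

  ⟦⟧-++ : ∀ f g φ → ⟦ f ++ g ⟧ φ ≡ ⟦ f ⟧ φ + ⟦ g ⟧ φ
  ⟦⟧-++ []            g φ = sym (ℤ.+-identityˡ _)
  ⟦⟧-++ ((c , u) ∷ f) g φ =
    trans (cong (λ z → c * φ u + z) (⟦⟧-++ f g φ)) (sym (ℤ.+-assoc (c * φ u) (⟦ f ⟧ φ) (⟦ g ⟧ φ)))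

  ⟦⟧-neg : ∀ f φ → ⟦ P.- f ⟧ φ ≡ - ⟦ f ⟧ φ
  ⟦⟧-neg []            φ = refl
  ⟦⟧-neg ((c , u) ∷ f) φ = trans (cong (λ z → - c * φ u + z) (⟦⟧-neg f φ))
    (solve 3 (λ c x y → :- c :* x :+ :- y := :- (c :* x :+ y)) refl c (φ u) (⟦ f ⟧ φ))

  -- Reduces the ring laws for formal sums to linearity and to the laws of addition of exponent
  -- vectors.
  ⟦⟧-* : ∀ f g φ → ⟦ f P.* g ⟧ φ ≡ ⟦ f ⟧ (λ u → ⟦ g ⟧ (λ v → φ (u ⊹ v)))
  ⟦⟧-* []            g φ = refl
  ⟦⟧-* ((c , u) ∷ f) g φ = trans (⟦⟧-++ (map (λ (d , v) → c * d , u ⊹ v) g) (f P.* g) φ)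
    (cong₂ _+_ (scale g) (⟦⟧-* f g φ))
    where
    scale : ∀ g → ⟦ map (λ (d , v) → c * d , u ⊹ v) g ⟧ φ ≡ c * ⟦ g ⟧ (λ v → φ (u ⊹ v))
    scale []            = sym (ℤ.*-zeroʳ c)
    scale ((d , v) ∷ g) = trans (cong (λ z → c * d * φ (u ⊹ v) + z) (scale g))
      (solve 4 (λ c d x y → c :* d :* x :+ c :* y := c :* (d :* x :+ y)) refl
        c d (φ (u ⊹ v)) (⟦ g ⟧ (λ v → φ (u ⊹ v))))

  ⟦⟧-swap : ∀ f g (ψ : Monomial N → Monomial N → ℤ) →
            ⟦ f ⟧ (λ u → ⟦ g ⟧ (ψ u)) ≡ ⟦ g ⟧ (λ v → ⟦ f ⟧ (λ u → ψ u v))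
  ⟦⟧-swap []            g ψ = sym (⟦⟧-zero g)
  ⟦⟧-swap ((c , u) ∷ f) g ψ = trans (cong (λ z → c * ⟦ g ⟧ (ψ u) + z) (⟦⟧-swap f g ψ))
    (sym (⟦⟧-linear g c (ψ u) (λ v → ⟦ f ⟧ (λ u → ψ u v))))

  subtract? : ∀ {N} (u m : Monomial N) → Dec (∃ λ w → u ⊹ w ≡ m)
  subtract? []      []      = yes ([] , refl)
  subtract? (a ∷ u) (b ∷ m) with a ℕ.≤? b | subtract? u m
  ... | yes a≤b | yes (w , eq) = yes (b ℕ.∸ a ∷ w , cong₂ _∷_ (ℕ.m+[n∸m]≡n a≤b) eq)
  ... | no  a≰b | _            = no λ { (c ∷ w , eq) → a≰b
        (≡.subst (a ℕ.≤_) (Vec.∷-injectiveˡ eq) (ℕ.m≤m+n a c)) }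
  ... | yes _   | no ¬w        = no λ { (c ∷ w , eq) → ¬w (w , Vec.∷-injectiveʳ eq) }

  ⊹-cancelˡ : ∀ {N} (u v w : Monomial N) → u ⊹ v ≡ u ⊹ w → v ≡ w
  ⊹-cancelˡ []      []      []      eq = refl
  ⊹-cancelˡ (a ∷ u) (b ∷ v) (c ∷ w) eq = cong₂ _∷_
    (ℕ.+-cancelˡ-≡ a b c (Vec.∷-injectiveˡ eq)) (⊹-cancelˡ u v w (Vec.∷-injectiveʳ eq))

  -- A translate of δ m is again some δ w or vanishes, so the coefficients of
  -- g determine the inner functional in ⟦⟧-*.
  *-congˡ : ∀ f {g h} → g P.≈ h → f P.* g P.≈ f P.* h
  *-congˡ f {g} {h} g≈h m = begin
    coeff (f P.* g) m                           ≡⟨ coeff≡⟦δ⟧ (f P.* g) m ⟩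
    ⟦ f P.* g ⟧ (δ m)                           ≡⟨ ⟦⟧-* f g (δ m) ⟩
    ⟦ f ⟧ (λ u → ⟦ g ⟧ (λ v → δ m (u ⊹ v)))     ≡⟨ ⟦⟧-cong f translate ⟩
    ⟦ f ⟧ (λ u → ⟦ h ⟧ (λ v → δ m (u ⊹ v)))     ≡⟨ ⟦⟧-* f h (δ m) ⟨
    ⟦ f P.* h ⟧ (δ m)                           ≡⟨ coeff≡⟦δ⟧ (f P.* h) m ⟨
    coeff (f P.* h) m                           ∎
    where
    δ-yes : ∀ u w v → δ (u ⊹ w) (u ⊹ v) ≡ δ w v
    δ-yes u w v with Vec.≡-dec ℕ._≟_ (u ⊹ v) (u ⊹ w) | Vec.≡-dec ℕ._≟_ v w
    ... | yes _  | yes _  = refl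
    ... | yes eq | no v≢w = contradiction (⊹-cancelˡ u v w eq) v≢w
    ... | no ≢   | yes eq = contradiction (cong (u ⊹_) eq) ≢
    ... | no _   | no _   = refl
    δ-no : ∀ m u → (∀ w → u ≢ m) → δ m u ≡ 0ℤ
    δ-no m u ≢ with Vec.≡-dec ℕ._≟_ u m
    ... | yes eq = contradiction eq (≢ u)
    ... | no _   = refl
    translate : ∀ u → ⟦ g ⟧ (λ v → δ m (u ⊹ v)) ≡ ⟦ h ⟧ (λ v → δ m (u ⊹ v))
    translate u with subtract? u m
    ... | yes (w , refl) = begin
      ⟦ g ⟧ (λ v → δ m (u ⊹ v))  ≡⟨ ⟦⟧-cong g (δ-yes u w) ⟩
      ⟦ g ⟧ (δ w)                ≡⟨ coeff≡⟦δ⟧ g w ⟨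
      coeff g w                  ≡⟨ g≈h w ⟩
      coeff h w                  ≡⟨ coeff≡⟦δ⟧ h w ⟩
      ⟦ h ⟧ (δ w)                ≡⟨ ⟦⟧-cong h (δ-yes u w) ⟨
      ⟦ h ⟧ (λ v → δ m (u ⊹ v))  ∎
    ... | no ¬w = begin
      ⟦ g ⟧ (λ v → δ m (u ⊹ v))  ≡⟨ ⟦⟧-cong g (λ v → δ-no m (u ⊹ v) λ _ eq → ¬w (v , eq)) ⟩
      ⟦ g ⟧ (λ _ → 0ℤ)           ≡⟨ ⟦⟧-zero g ⟩
      0ℤ                         ≡⟨ ⟦⟧-zero h ⟨
      ⟦ h ⟧ (λ _ → 0ℤ)           ≡⟨ ⟦⟧-cong h (λ v → δ-no m (u ⊹ v) λ _ eq → ¬w (v , eq)) ⟨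
      ⟦ h ⟧ (λ v → δ m (u ⊹ v))  ∎

  *-comm : ∀ f g → f P.* g P.≈ g P.* f
  *-comm f g = ≈-from-⟦⟧ (f P.* g) (g P.* f) λ φ → begin
    ⟦ f P.* g ⟧ φ                           ≡⟨ ⟦⟧-* f g φ ⟩
    ⟦ f ⟧ (λ u → ⟦ g ⟧ (λ v → φ (u ⊹ v)))   ≡⟨ ⟦⟧-swap f g (λ u v → φ (u ⊹ v)) ⟩
    ⟦ g ⟧ (λ v → ⟦ f ⟧ (λ u → φ (u ⊹ v)))
      ≡⟨ ⟦⟧-cong g (λ v → ⟦⟧-cong f (λ u → cong φ (Vec.zipWith-comm ℕ.+-comm u v))) ⟩
    ⟦ g ⟧ (λ v → ⟦ f ⟧ (λ u → φ (v ⊹ u)))   ≡⟨ ⟦⟧-* g f φ ⟨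
    ⟦ g P.* f ⟧ φ                           ∎

  *-assoc : ∀ f g h → (f P.* g) P.* h P.≈ f P.* (g P.* h)
  *-assoc f g h = ≈-from-⟦⟧ ((f P.* g) P.* h) (f P.* (g P.* h)) λ φ → begin
    ⟦ (f P.* g) P.* h ⟧ φ
      ≡⟨ trans (⟦⟧-* (f P.* g) h φ) (⟦⟧-* f g _) ⟩
    ⟦ f ⟧ (λ u → ⟦ g ⟧ (λ v → ⟦ h ⟧ (λ w → φ ((u ⊹ v) ⊹ w))))
      ≡⟨ ⟦⟧-cong f (λ u → ⟦⟧-cong g λ v → ⟦⟧-cong h λ w →
           cong φ (Vec.zipWith-assoc ℕ.+-assoc u v w)) ⟩
    ⟦ f ⟧ (λ u → ⟦ g ⟧ (λ v → ⟦ h ⟧ (λ w → φ (u ⊹ (v ⊹ w)))))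
      ≡⟨ ⟦⟧-cong f (λ u → ⟦⟧-* g h (λ v → φ (u ⊹ v))) ⟨
    ⟦ f ⟧ (λ u → ⟦ g P.* h ⟧ (λ v → φ (u ⊹ v)))
      ≡⟨ ⟦⟧-* f (g P.* h) φ ⟨
    ⟦ f P.* (g P.* h) ⟧ φ ∎

  *-identityˡ : ∀ f → P.1# P.* f P.≈ f
  *-identityˡ f = ≈-from-⟦⟧ (P.1# P.* f) f λ φ → begin
    ⟦ P.1# P.* f ⟧ φ                              ≡⟨ ⟦⟧-* P.1# f φ ⟩
    1ℤ * ⟦ f ⟧ (λ v → φ (0̂ ⊹ v)) + 0ℤ             ≡⟨ trans (ℤ.+-identityʳ _) (ℤ.*-identityˡ _) ⟩
    ⟦ f ⟧ (λ v → φ (0̂ ⊹ v))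
        ≡⟨ ⟦⟧-cong f (λ v → cong φ (Vec.zipWith-identityˡ ℕ.+-identityˡ v)) ⟩
    ⟦ f ⟧ φ                                       ∎
    where 0̂ = Vec.replicate N 0

  distribˡ : ∀ f g h → f P.* (g P.+ h) P.≈ (f P.* g) P.+ (f P.* h)
  distribˡ f g h = ≈-from-⟦⟧ (f P.* (g P.+ h)) ((f P.* g) P.+ (f P.* h)) λ φ →
    let φ* = λ k u → ⟦ k ⟧ (λ v → φ (u ⊹ v)) in begin
    ⟦ f P.* (g P.+ h) ⟧ φ                         ≡⟨ ⟦⟧-* f (g P.+ h) φ ⟩
    ⟦ f ⟧ (φ* (g P.+ h))
      ≡⟨ ⟦⟧-cong f (λ u → trans (⟦⟧-++ g h _) (cong (_+ φ* h u) (sym (ℤ.*-identityˡ (φ* g u))))) ⟩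
    ⟦ f ⟧ (λ u → 1ℤ * φ* g u + φ* h u)            ≡⟨ ⟦⟧-linear f 1ℤ (φ* g) (φ* h) ⟩
    1ℤ * ⟦ f ⟧ (φ* g) + ⟦ f ⟧ (φ* h)
        ≡⟨ cong₂ _+_ (trans (ℤ.*-identityˡ _) (sym (⟦⟧-* f g φ))) (sym (⟦⟧-* f h φ)) ⟩
    ⟦ f P.* g ⟧ φ + ⟦ f P.* h ⟧ φ                 ≡⟨ ⟦⟧-++ (f P.* g) (f P.* h) φ ⟨
    ⟦ (f P.* g) P.+ (f P.* h) ⟧ φ                 ∎

  coeff-++ : ∀ f g m → coeff (f ++ g) m ≡ coeff f m + coeff g m
  coeff-++ f g m = trans (coeff≡⟦δ⟧ (f ++ g) m) (trans (⟦⟧-++ f g (δ m))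
    (sym (cong₂ _+_ (coeff≡⟦δ⟧ f m) (coeff≡⟦δ⟧ g m))))

  coeff-neg : ∀ f m → coeff (P.- f) m ≡ - coeff f m
  coeff-neg f m = trans (coeff≡⟦δ⟧ (P.- f) m) (trans (⟦⟧-neg f (δ m))
    (sym (cong -_ (coeff≡⟦δ⟧ f m))))

  commutativeRing : CommutativeRing 0ℓ 0ℓ
  commutativeRing = record
    { Carrier = P.Carrier ; _≈_ = P._≈_ ; _+_ = P._+_ ; _*_ = P._*_ ; -_ = P.-_ ; 0# = P.0# ; 1# = P.1#
    ; isCommutativeRing = record
      { isRing = record
        { +-isAbelianGroup = record
          { isGroup = record
            { isMonoid = record
              { isSemigroup = record
                { isMagma = record
                  { isEquivalence = record
                    { refl  = λ _ → refl
                    ; sym   = λ eq m → sym (eq m)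
                    ; trans = λ eq eq′ m → trans (eq m) (eq′ m)
                    }
                  ; ∙-cong = λ {f} {f′} {g} {g′} f≈f′ g≈g′ m → trans (coeff-++ f g m)
                      (trans (cong₂ _+_ (f≈f′ m) (g≈g′ m)) (sym (coeff-++ f′ g′ m)))
                  }
                ; assoc = λ f g h → ≈-from-⟦⟧ ((f ++ g) ++ h) (f ++ (g ++ h)) λ φ →
                    trans (trans (⟦⟧-++ (f ++ g) h φ) (cong (_+ ⟦ h ⟧ φ) (⟦⟧-++ f g φ)))
                    (trans (ℤ.+-assoc (⟦ f ⟧ φ) (⟦ g ⟧ φ) (⟦ h ⟧ φ))
                    (sym (trans (⟦⟧-++ f (g ++ h) φ) (cong (λ z → ⟦ f ⟧ φ + z) (⟦⟧-++ g h φ)))))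
                }
              ; identity = (λ f m → refl)
                         , (λ f m → trans (coeff-++ f [] m) (ℤ.+-identityʳ _))
              }
            ; inverse = (λ f m → trans (coeff-++ (P.- f) f m)
                            (trans (cong (_+ coeff f m) (coeff-neg f m)) (ℤ.+-inverseˡ (coeff f m))))
                      , (λ f m → trans (coeff-++ f (P.- f) m)
                            (trans (cong (λ z → coeff f m + z) (coeff-neg f m))
                                (ℤ.+-inverseʳ (coeff f m))))
            ; ⁻¹-cong = λ {f} {g} f≈g m →
                trans (coeff-neg f m) (trans (cong -_ (f≈g m)) (sym (coeff-neg g m)))
            }
          ; comm = λ f g m → trans (coeff-++ f g m)
              (trans (ℤ.+-comm (coeff f m) (coeff g m)) (sym (coeff-++ g f m)))
          }
        ; *-cong = λ {f} {f′} {g} {g′} f≈f′ g≈g′ → ≈-trans {f P.* g} {f P.* g′} {f′ P.* g′}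
            (*-congˡ f {g} {g′} g≈g′) (*-congʳ g′ {f} {f′} f≈f′)
        ; *-assoc = *-assoc
        ; *-identity = *-identityˡ
                     , λ f → ≈-trans {f P.* P.1#} {P.1# P.* f} {f} (*-comm f P.1#) (*-identityˡ f)
        ; distrib = distribˡ
                  , λ f g h m → trans (*-comm (g P.+ h) f m) (trans (distribˡ f g h m)
                      (trans (coeff-++ (f P.* g) (f P.* h) m)
                      (trans (cong₂ _+_ (*-comm f g m) (*-comm f h m))
                      (sym (coeff-++ (g P.* f) (h P.* f) m)))))
        }
      ; *-comm = *-comm
      }
    }
    where
    ≈-trans : ∀ {f g h} → f P.≈ g → g P.≈ h → f P.≈ h
    ≈-trans f≈g g≈h m = trans (f≈g m) (g≈h m)
    *-congʳ : ∀ g {f f′} → f P.≈ f′ → f P.* g P.≈ f′ P.* g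
    *-congʳ g {f} {f′} f≈f′ m =
      trans (*-comm f g m) (trans (*-congˡ g {f} {f′} f≈f′ m) (*-comm g f′ m))

  const-isRingHomomorphism : IsRingHomomorphism ℤ.+-*-rawRing ℤ[ N ] const
  const-isRingHomomorphism = record
    { isSemiringHomomorphism = record
      { isNearSemiringHomomorphism = record
        { +-isMonoidHomomorphism = record
          { isMagmaHomomorphism = record
            { isRelHomomorphism = record { cong = λ { refl m → refl } }
            ; homo = λ a b → ≈-from-⟦⟧ (const (a + b)) (const a ++ const b) λ φ →
                solve 3 (λ a b x → (a :+ b) :* x :+ con 0ℤ := a :* x :+ (b :* x :+ con 0ℤ)) refl
                  a b (φ (Vec.replicate N 0))
            }
          ; ε-homo = ≈-from-⟦⟧ (const 0ℤ) [] λ φ → refl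
          }
        ; *-homo = λ a b → ≈-from-⟦⟧ (const (a * b)) (const a P.* const b) λ φ →
            cong (λ u → a * b * φ u + 0ℤ) (sym
                (Vec.zipWith-identityˡ ℕ.+-identityˡ (Vec.replicate N 0)))
        }
      ; 1#-homo = λ m → refl
      }
    ; -‿homo = λ a m → refl
    }

-- Column operations on integer matrices.

module IntegerMatrix where
  open ≡ using (refl; sym; trans)
  open import Data.Integer.Base using (_+_; _-_; _*_; -_; ∣_∣)
  open LinearAlgebra ℤ.+-*-rawRing using (sum; det; _⊗_; Id; _^_)
  open SemiringSum ℤ.+-*-semiring using (sum-cong-≗; ∑-distrib-+; *-distribˡ-sum; *-distribʳ-sum)
  open Exterior ℤ.+-*-commutativeRing public
    using (⋀; sum-zero; sum-Idˡ; sum-Idʳ; Id-refl; Id-≢; sum-assoc; det-cong; det-⊗; ⋀-minor;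
        ⋀-homogeneous)
  open ℤ.+-*-Solver using (solve; _:=_; _:+_; _:*_; _:-_; :-_; con)
  open ≡-Reasoning

  infixr 7 _⊙_
  _⊙_ : ∀ {p q} → Matrix ℤ p q → Vector ℤ q → Vector ℤ p
  (M ⊙ x) i = sum λ j → M i j * x j

  ⊙-cong : ∀ {p q} {M N : Matrix ℤ p q} {x : Vector ℤ q} → (∀ i j → M i j ≡ N i j) →
           ∀ i → (M ⊙ x) i ≡ (N ⊙ x) i
  ⊙-cong {x = x} eq i = sum-cong-≗ λ j → cong (_* x j) (eq i j)

  ⊗-congˡ : ∀ {p q r} {M N : Matrix ℤ p q} (B : Matrix ℤ q r) → (∀ i j → M i j ≡ N i j) →
            ∀ i j → (M ⊗ B) i j ≡ (N ⊗ B) i j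
  ⊗-congˡ B eq i j = sum-cong-≗ λ k → cong (_* B k j) (eq i k)

  ⊗-congʳ : ∀ {p q r} (B : Matrix ℤ p q) {M N : Matrix ℤ q r} → (∀ i j → M i j ≡ N i j) →
            ∀ i j → (B ⊗ M) i j ≡ (B ⊗ N) i j
  ⊗-congʳ B eq i j = sum-cong-≗ λ k → cong (B i k *_) (eq k j)

  infix 4 _~_
  -- Equivalence under unimodular column operations. The two-sided inverse is carried as data in
  -- place of the condition det V = ±1.
  record _~_ {p k} (M N : Matrix ℤ p k) : Set where
    field
      V       : Matrix ℤ k k
      V⁻¹     : Matrix ℤ k k
      V⊗V⁻¹   : ∀ i j → (V ⊗ V⁻¹) i j ≡ Id i j
      V⁻¹⊗V   : ∀ i j → (V⁻¹ ⊗ V) i j ≡ Id i j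
      N≡M⊗V   : ∀ i j → N i j ≡ (M ⊗ V) i j

    M≡N⊗V⁻¹ : ∀ i j → M i j ≡ (N ⊗ V⁻¹) i j
    M≡N⊗V⁻¹ i j = sym $ begin
      (N ⊗ V⁻¹) i j                    ≡⟨ ⊗-congˡ V⁻¹ N≡M⊗V i j ⟩
      ((M ⊗ V) ⊗ V⁻¹) i j              ≡⟨ sum-assoc (M i) V (λ l → V⁻¹ l j) ⟩
      (M ⊗ (V ⊗ V⁻¹)) i j              ≡⟨ ⊗-congʳ M V⊗V⁻¹ i j ⟩
      (M ⊗ Id) i j                     ≡⟨ sum-Idʳ (M i) j ⟩
      M i j                            ∎

  ~-refl : ∀ {p k} {M : Matrix ℤ p k} → M ~ M
  ~-refl {M = M} = record
    { V = Id ; V⁻¹ = Id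
    ; V⊗V⁻¹ = λ i j → sum-Idʳ (Id i) j
    ; V⁻¹⊗V = λ i j → sum-Idʳ (Id i) j
    ; N≡M⊗V = λ i j → sym (sum-Idʳ (M i) j)
    }

  ~-trans : ∀ {p k} {L M N : Matrix ℤ p k} → L ~ M → M ~ N → L ~ N
  ~-trans {L = L} {M} {N} L~M M~N = record
    { V = V L~M ⊗ V M~N ; V⁻¹ = V⁻¹ M~N ⊗ V⁻¹ L~M
    ; V⊗V⁻¹ = middle (V L~M) (V M~N) (V⁻¹ M~N) (V⁻¹ L~M) (V⊗V⁻¹ M~N) (V⊗V⁻¹ L~M)
    ; V⁻¹⊗V = middle (V⁻¹ M~N) (V⁻¹ L~M) (V L~M) (V M~N) (V⁻¹⊗V L~M) (V⁻¹⊗V M~N)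
    ; N≡M⊗V = λ i j → begin
        N i j                          ≡⟨ N≡M⊗V M~N i j ⟩
        (M ⊗ V M~N) i j                ≡⟨ ⊗-congˡ (V M~N) (N≡M⊗V L~M) i j ⟩
        ((L ⊗ V L~M) ⊗ V M~N) i j      ≡⟨ sum-assoc (L i) (V L~M) (λ l → V M~N l j) ⟩
        (L ⊗ (V L~M ⊗ V M~N)) i j      ∎
    }
    where
    open _~_
    middle : ∀ {k} (A B C D : Matrix ℤ k k) → (∀ i j → (B ⊗ C) i j ≡ Id i j) →
             (∀ i j → (A ⊗ D) i j ≡ Id i j) → ∀ i j → ((A ⊗ B) ⊗ (C ⊗ D)) i j ≡ Id i j
    middle A B C D BC AD i j = begin
      ((A ⊗ B) ⊗ (C ⊗ D)) i j    ≡⟨ sum-assoc (A i) B (λ l → (C ⊗ D) l j) ⟩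
      (A ⊗ (B ⊗ (C ⊗ D))) i j    ≡⟨ ⊗-congʳ A (λ i j → sum-assoc (B i) C (λ l → D l j)) i j ⟨
      (A ⊗ ((B ⊗ C) ⊗ D)) i j    ≡⟨ ⊗-congʳ A
          (λ i j → trans (⊗-congˡ D BC i j) (sum-Idˡ i (λ l → D l j))) i j ⟩
      (A ⊗ D) i j                ≡⟨ AD i j ⟩
      Id i j                     ∎

  -- The elementary matrix with off-diagonal entry t at (i , j) has the one with -t as inverse:
  -- since i ≢ j, the quadratic term contains `Id j i` and drops out.
  addColumn : ∀ {p k} (M : Matrix ℤ p k) {i j : Fin k} → i ≢ j → ∀ t →
              M ~ (λ r c → M r c + M r i * (t * Id j c))
  addColumn {k = k} M {i} {j} i≢j t = record
    { V = T t ; V⁻¹ = T (- t)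
    ; V⊗V⁻¹ = T-inverse t (- t) (ℤ.+-inverseʳ t)
    ; V⁻¹⊗V = T-inverse (- t) t (ℤ.+-inverseˡ t)
    ; N≡M⊗V = λ r c → sym (⊗T M t r c)
    }
    where
    T : ℤ → Matrix ℤ k k
    T t r c = Id r c + Id r i * (t * Id j c)
    ⊗T : ∀ {p} (M : Matrix ℤ p k) t r c → (M ⊗ T t) r c ≡ M r c + M r i * (t * Id j c)
    ⊗T M t r c = begin
      sum (λ l → M r l * (Id l c + Id l i * (t * Id j c)))
        ≡⟨ sum-cong-≗ (λ l → solve 4 (λ m x y z → m :* (x :+ y :* z) := m :* x :+ m :* y :* z) refl
             (M r l) (Id l c) (Id l i) (t * Id j c)) ⟩
      sum (λ l → M r l * Id l c + M r l * Id l i * (t * Id j c))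
        ≡⟨ ∑-distrib-+ (λ l → M r l * Id l c) (λ l → M r l * Id l i * (t * Id j c)) ⟩
      sum (λ l → M r l * Id l c) + sum (λ l → M r l * Id l i * (t * Id j c))
        ≡⟨ cong₂ _+_ (sum-Idʳ (M r) c) (trans
             (sym (*-distribʳ-sum (t * Id j c) (λ l → M r l * Id l i)))
             (cong (_* (t * Id j c)) (sum-Idʳ (M r) i))) ⟩
      M r c + M r i * (t * Id j c) ∎
    T-inverse : ∀ t s → t + s ≡ 0ℤ → ∀ r c → (T t ⊗ T s) r c ≡ Id r c
    T-inverse t s t+s≡0 r c = begin
      (T t ⊗ T s) r c
        ≡⟨ ⊗T (T t) s r c ⟩
      Id r c + Id r i * (t * Id j c) + (Id r i + Id r i * (t * Id j i)) * (s * Id j c)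
        ≡⟨ cong (λ z → Id r c + Id r i * (t * Id j c) + (Id r i + Id r i * (t * z)) * (s * Id j c))
             (Id-≢ (i≢j ∘ sym)) ⟩
      Id r c + Id r i * (t * Id j c) + (Id r i + Id r i * (t * 0ℤ)) * (s * Id j c)
        ≡⟨ solve 5 (λ a x y t s → a :+ x :* (t :* y) :+ (x :+ x :* (t :* con 0ℤ)) :* (s :* y)
                              := a :+ (t :+ s) :* (x :* y)) refl (Id r c) (Id r i) (Id j c) t s ⟩
      Id r c + (t + s) * (Id r i * Id j c)
        ≡⟨ cong (λ z → Id r c + z * (Id r i * Id j c)) t+s≡0 ⟩
      Id r c + 0ℤ
        ≡⟨ ℤ.+-identityʳ (Id r c) ⟩
      Id r c ∎

  -- One step of Euclid's algorithm: (a , b) ↦ (b , - (a mod b)) in columns 0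
  -- and j, as a product of four column additions.
  clear : ∀ {p k} (j : Fin k) fuel (M : Matrix ℤ (suc p) (suc k)) → ∣ M zero (suc j) ∣ ℕ.< fuel →
          ∃ λ N → M ~ N × N zero (suc j) ≡ 0ℤ × (∀ l → l ≢ j → N zero (suc l) ≡ M zero (suc l))
  clear {p} {k} j (suc fuel) M (ℕ.s≤s ≤fuel) with M zero (suc j) ℤ.≟ 0ℤ
  ... | yes b≡0 = M , ~-refl , b≡0 , λ _ _ → refl
  ... | no  b≢0 = let N , M₄~N , N≡0 , same = clear j fuel M₄ smaller in
      N , ~-trans M~M₄ M₄~N , N≡0 , λ l l≢j → trans (same l l≢j) (unchanged l l≢j)
    where
    a = M zero zero
    b = M zero (suc j)
    instance
      b-nonZero : ℤ.NonZero b
      b-nonZero = ℤ.≢-nonZero b≢0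
    q = a ℤ./ b
    r = a ℤ.% b
    M₁ M₂ M₃ M₄ : Matrix ℤ (suc p) (suc k)
    -- In the first row, columns 0 and j run through (a , b), (r , b), (r , b - r), (b , b - r), (b
    -- , -r). The first addition divides; the other three exchange the columns up to a sign.
    M₁ i c = M  i c + M  i (suc j) * (- q * Id zero c)
    M₂ i c = M₁ i c + M₁ i zero    * (-1ℤ * Id (suc j) c)
    M₃ i c = M₂ i c + M₂ i (suc j) * (1ℤ * Id zero c)
    M₄ i c = M₃ i c + M₃ i zero    * (-1ℤ * Id (suc j) c)
    M~M₄ : M ~ M₄
    M~M₄ = ~-trans {M = M₁} (addColumn M {suc j} {zero} (λ ()) (- q))
          (~-trans {M = M₂} (addColumn M₁ {zero} {suc j} (λ ()) -1ℤ)
          (~-trans {M = M₃} (addColumn M₂ {suc j} {zero} (λ ()) 1ℤ)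
                            (addColumn M₃ {zero} {suc j} (λ ()) -1ℤ)))
    hit : ∀ x y t {e} → e ≡ 1ℤ → x + y * (t * e) ≡ x + y * t
    hit x y t refl = cong (λ z → x + y * z) (ℤ.*-identityʳ t)
    miss : ∀ x y t {e} → e ≡ 0ℤ → x + y * (t * e) ≡ x
    miss x y t refl = trans (cong (λ z → x + y * z) (ℤ.*-zeroʳ t))
      (trans (cong (λ z → x + z) (ℤ.*-zeroʳ y)) (ℤ.+-identityʳ x))
    M₁₀ : M₁ zero zero ≡ + r
    M₁₀ = begin
      M₁ zero zero                ≡⟨ hit a b (- q) refl ⟩
      a + b * - q                 ≡⟨ cong (_+ b * - q) (ℤ.a≡a%n+[a/n]*n a b) ⟩
      + r + q * b + b * - q       ≡⟨ solve 3 (λ r q b → r :+ q :* b :+ b :* :- q := r) refl (+ r) q b ⟩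
      + r                         ∎
    M₁ⱼ : ∀ l → M₁ zero (suc l) ≡ M zero (suc l)
    M₁ⱼ l = miss (M zero (suc l)) b (- q) refl
    M₂₀ : M₂ zero zero ≡ + r
    M₂₀ = trans (miss (M₁ zero zero) (M₁ zero zero) -1ℤ refl) M₁₀
    M₂ⱼ : M₂ zero (suc j) ≡ b + + r * -1ℤ
    M₂ⱼ = trans (hit (M₁ zero (suc j)) (M₁ zero zero) -1ℤ (Id-refl j))
      (cong₂ (λ x y → x + y * -1ℤ) (M₁ⱼ j) M₁₀)
    M₃₀ : M₃ zero zero ≡ b
    M₃₀ = begin
      M₃ zero zero                    ≡⟨ hit (M₂ zero zero) (M₂ zero (suc j)) 1ℤ refl ⟩
      M₂ zero zero + M₂ zero (suc j) * 1ℤ ≡⟨ cong₂ (λ x y → x + y * 1ℤ) M₂₀ M₂ⱼ ⟩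
      + r + (b + + r * -1ℤ) * 1ℤ
          ≡⟨ solve 2 (λ r b → r :+ (b :+ r :* con -1ℤ) :* con 1ℤ := b) refl (+ r) b ⟩
      b                               ∎
    M₃ⱼ : ∀ l → M₃ zero (suc l) ≡ M₂ zero (suc l)
    M₃ⱼ l = miss (M₂ zero (suc l)) (M₂ zero (suc j)) 1ℤ refl
    M₄ⱼ : M₄ zero (suc j) ≡ - (+ r)
    M₄ⱼ = begin
      M₄ zero (suc j)                 ≡⟨ hit (M₃ zero (suc j)) (M₃ zero zero) -1ℤ (Id-refl j) ⟩
      M₃ zero (suc j) + M₃ zero zero * -1ℤ ≡⟨ cong₂ (λ x y → x + y * -1ℤ) (trans (M₃ⱼ j) M₂ⱼ) M₃₀ ⟩
      b + + r * -1ℤ + b * -1ℤ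
          ≡⟨ solve 2 (λ r b → b :+ r :* con -1ℤ :+ b :* con -1ℤ := :- r) refl (+ r) b ⟩
      - (+ r)                         ∎
    smaller : ∣ M₄ zero (suc j) ∣ ℕ.< fuel
    smaller = ℕ.<-≤-trans (subst (ℕ._< ∣ b ∣) (sym (trans (cong ∣_∣ M₄ⱼ) (ℤ.∣-i∣≡∣i∣ (+ r))))
        (ℤ.n%d<d a b)) ≤fuel
    unchanged : ∀ l → l ≢ j → M₄ zero (suc l) ≡ M zero (suc l)
    unchanged l l≢j = begin
      M₄ zero (suc l)   ≡⟨ miss (M₃ zero (suc l)) (M₃ zero zero) -1ℤ (Id-≢ (l≢j ∘ sym)) ⟩
      M₃ zero (suc l)   ≡⟨ M₃ⱼ l ⟩
      M₂ zero (suc l)   ≡⟨ miss (M₁ zero (suc l)) (M₁ zero zero) -1ℤ (Id-≢ (l≢j ∘ sym)) ⟩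
      M₁ zero (suc l)   ≡⟨ M₁ⱼ l ⟩
      M zero (suc l)    ∎

  -- The entries are cleared from left to right; zeros already obtained survive because `clear`
  -- leaves the other entries to the right of column 0 alone.
  reduceRow : ∀ {p k} (M : Matrix ℤ (suc p) (suc k)) → ∃ λ N → M ~ N × (∀ l → N zero (suc l) ≡ 0ℤ)
  reduceRow {p} {k} M = let N , M~N , zeros = clearBelow k in N , M~N , λ l → zeros l (Fin.toℕ<n l)
    where
    clearBelow : ∀ m → ∃ λ N → M ~ N × (∀ (l : Fin k) → toℕ l ℕ.< m → N zero (suc l) ≡ 0ℤ)
    clearBelow zero    = M , ~-refl , λ _ ()
    clearBelow (suc m) with clearBelow m | m ℕ.<? k
    ... | N , M~N , zeros | no  m≮k = N , M~N , λ l _ →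
      zeros l (ℕ.<-≤-trans (Fin.toℕ<n l) (ℕ.≮⇒≥ m≮k))
    -- The inferred fuel is the successor of the absolute value of the entry to be cleared, the
    -- least that `clear` accepts.
    ... | N , M~N , zeros | yes m<k with clear (fromℕ< m<k) _ N ℕ.≤-refl
    ...   | N′ , N~N′ , N′≡0 , same = N′ , ~-trans M~N N~N′ , zeros′
      where
      zeros′ : ∀ l → toℕ l ℕ.< suc m → N′ zero (suc l) ≡ 0ℤ
      zeros′ l l<1+m with l Fin.≟ fromℕ< m<k
      ... | yes refl = N′≡0
      ... | no  l≢m  = trans (same l l≢m) (zeros l (ℕ.≤∧≢⇒< (ℕ.s≤s⁻¹ l<1+m)
        λ l≡m → l≢m (Fin.toℕ-injective (trans l≡m (sym (Fin.toℕ-fromℕ< m<k))))))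

  module _ {p k} (M : Matrix ℤ (suc p) (suc k)) where

    minor₀₀ : Matrix ℤ p k
    minor₀₀ i j = M (suc i) (suc j)

  det-divides : ∀ {p} {M N : Matrix ℤ p p} (V : Matrix ℤ p p) → (∀ i j → N i j ≡ (M ⊗ V) i j) →
                ∣ det M ∣ ℕ.∣ ∣ det N ∣
  det-divides {M = M} {N} V N≡M⊗V =
    subst (λ d → ∣ det M ∣ ℕ.∣ ∣ d ∣) (sym (trans (det-cong N≡M⊗V) (det-⊗ M V)))
      (subst (∣ det M ∣ ℕ.∣_) (sym (ℤ.abs-* (det M) _)) (ℕ.m∣m*n _))

  -- Each matrix is a right multiple of the other, so the determinants divide each other and agree
  -- up to sign.
  ∣det∣-~ : ∀ {p} {M N : Matrix ℤ p p} → M ~ N → ∣ det M ∣ ≡ ∣ det N ∣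
  ∣det∣-~ M~N = ℕ.∣-antisym (det-divides V N≡M⊗V) (det-divides V⁻¹ M≡N⊗V⁻¹)
    where open _~_ M~N

  det-block : ∀ {p} (M : Matrix ℤ (suc p) (suc p)) → (∀ l → M zero (suc l) ≡ 0ℤ) →
              det M ≡ M zero zero * det (minor₀₀ M)
  det-block M zeros = trans
    (cong₂ _+_ (cong (_* det (minor₀₀ M)) (ℤ.*-identityˡ (M zero zero)))
               (sum-zero {v = λ l → sign l * M zero (suc l) * cofactor l} λ l → vanish (sign l)
                   (cofactor l) (zeros l)))
    (ℤ.+-identityʳ _)
    where
    sign = λ l → -1ℤ ^ toℕ (suc l)
    cofactor = λ l → det (λ i k → M (suc i) (punchIn (suc l) k))
    vanish : ∀ s t {m} → m ≡ 0ℤ → s * m * t ≡ 0ℤ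
    vanish s t refl = cong (_* t) (ℤ.*-zeroʳ s)

  -- Integer null vectors.

  NullVector : ∀ {p k} → Matrix ℤ p k → Set
  NullVector M = ∃ λ x → (∀ r → (M ⊙ x) r ≡ 0ℤ) × ∃ λ j → x j ≢ 0ℤ

  ⊙-zero : ∀ {p k} (M : Matrix ℤ p k) {x : Vector ℤ k} → (∀ j → x j ≡ 0ℤ) → ∀ r → (M ⊙ x) r ≡ 0ℤ
  ⊙-zero M x≡0 r = sum-zero λ j → trans (cong (M r j *_) (x≡0 j)) (ℤ.*-zeroʳ (M r j))

  nullVector-~ : ∀ {p k} {M N : Matrix ℤ p k} → M ~ N → NullVector N → NullVector M
  nullVector-~ {k = k} {M} {N} M~N (x , Nx≡0 , j , xj≢0) = V ⊙ x
    , (λ r → trans (sym (trans (⊙-cong N≡M⊗V r) (sum-assoc (M r) V x))) (Nx≡0 r))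
    -- A nonzero coordinate of V x is found by search: if all of them vanished, then so would x =
    -- V⁻¹ V x.
    , Fin.¬∀⟶∃¬ k _ (λ i → (V ⊙ x) i ℤ.≟ 0ℤ) λ Vx≡0 → xj≢0 (begin
        x j                  ≡⟨ sum-Idˡ j x ⟨
        (Id ⊙ x) j           ≡⟨ ⊙-cong V⁻¹⊗V j ⟨
        ((V⁻¹ ⊗ V) ⊙ x) j    ≡⟨ sum-assoc (V⁻¹ j) V x ⟩
        (V⁻¹ ⊙ V ⊙ x) j      ≡⟨ ⊙-zero V⁻¹ Vx≡0 j ⟩
        0ℤ                   ∎)
    where open _~_ M~N

  nullVector-block : ∀ {p k} (M : Matrix ℤ (suc p) (suc k)) → (∀ l → M zero (suc l) ≡ 0ℤ) →
                     NullVector (minor₀₀ M) → NullVector M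
  nullVector-block M zeros (x , Mx≡0 , j , xj≢0) = 0ℤ ∷ᶠ x , (λ
    { zero    → cong₂ _+_ (ℤ.*-zeroʳ (M zero zero)) (sum-zero λ l → cong (_* x l) (zeros l))
    ; (suc r) → cong₂ _+_ (ℤ.*-zeroʳ (M (suc r) zero)) (Mx≡0 r)
    }) , suc j , xj≢0

  -- After reduction the first row meets only column 0. Dropping both keeps more columns than rows,
  -- until no row is left and every vector is null.
  nullVector-wide : ∀ {p k} → p ℕ.< k → (M : Matrix ℤ p k) → NullVector M
  nullVector-wide {zero}  {suc k} _           M = (λ _ → 1ℤ) , (λ ()) , zero , λ ()
  nullVector-wide {suc p} {suc k} (ℕ.s≤s p<k) M =
    let N , M~N , zeros = reduceRow M
    in nullVector-~ {N = N} M~N (nullVector-block N zeros (nullVector-wide p<k (minor₀₀ N)))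

  -- The reduced determinant is the corner entry times a smaller determinant. If the corner is zero,
  -- the whole first row is zero and the remaining rows form a wide matrix; otherwise the smaller
  -- matrix is singular.
  nullVector-singular : ∀ {p} (M : Matrix ℤ p p) → det M ≡ 0ℤ → NullVector M
  nullVector-singular {zero}  M ()
  nullVector-singular {suc p} M det≡0 =
    let N , M~N , zeros = reduceRow M
    in nullVector-~ {N = N} M~N (factor {N} zeros $ ℤ.i*j≡0⇒i≡0∨j≡0 (N zero zero) $
         trans (sym (det-block N zeros)) (ℤ.∣i∣≡0⇒i≡0 (trans (sym (∣det∣-~ M~N)) (cong ∣_∣ det≡0))))
    where
    factor : ∀ {N : Matrix ℤ (suc p) (suc p)} → (∀ l → N zero (suc l) ≡ 0ℤ) →
             N zero zero ≡ 0ℤ ⊎ det (minor₀₀ N) ≡ 0ℤ → NullVector N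
    factor {N} zeros (inj₁ N₀₀≡0) =
      let x , Nx≡0 , nonzero = nullVector-wide (ℕ.n<1+n p) (N ∘ suc)
      in x , (λ
           { zero    → sum-zero {v = λ j → N zero j * x j} λ
                         { zero    → cong (_* x zero) N₀₀≡0
                         ; (suc l) → cong (_* x (suc l)) (zeros l) }
           ; (suc r) → Nx≡0 r
           }) , nonzero
    factor {N} zeros (inj₂ det₀₀≡0) = nullVector-block N zeros (nullVector-singular (minor₀₀ N) det₀₀≡0)

  -- Inverses up to a nonzero scalar.

  -- A rational inverse with denominators cleared, so that the elimination stays inside ℤ. Any
  -- nonzero common denominator may serve as `scale`.
  record ScaledInverse {p} (M : Matrix ℤ p p) : Set where
    field
      scale     : ℤ
      scale≢0   : scale ≢ 0ℤ
      inverse   : Matrix ℤ p p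
      M⊗inverse : ∀ i j → (M ⊗ inverse) i j ≡ scale * Id i j
      inverse⊗M : ∀ i j → (inverse ⊗ M) i j ≡ scale * Id i j

  scaledInverse-~ : ∀ {p} {M N : Matrix ℤ p p} → M ~ N → ScaledInverse N → ScaledInverse M
  scaledInverse-~ {M = M} {N} M~N N⁻¹ = record
    { scale     = scale
    ; scale≢0   = scale≢0
    ; inverse   = V ⊗ inverse
    ; M⊗inverse = λ i j → begin
        (M ⊗ (V ⊗ inverse)) i j        ≡⟨ sum-assoc (M i) V (λ l → inverse l j) ⟨
        ((M ⊗ V) ⊗ inverse) i j        ≡⟨ ⊗-congˡ inverse N≡M⊗V i j ⟨
        (N ⊗ inverse) i j              ≡⟨ M⊗inverse i j ⟩
        scale * Id i j                 ∎
    ; inverse⊗M = λ i j → begin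
        ((V ⊗ inverse) ⊗ M) i j          ≡⟨ ⊗-congʳ (V ⊗ inverse) M≡N⊗V⁻¹ i j ⟩
        ((V ⊗ inverse) ⊗ (N ⊗ V⁻¹)) i j  ≡⟨ sum-assoc (V i) inverse (λ l → (N ⊗ V⁻¹) l j) ⟩
        (V ⊗ (inverse ⊗ (N ⊗ V⁻¹))) i j
          ≡⟨ ⊗-congʳ V (λ r c → sum-assoc (inverse r) N (λ l → V⁻¹ l c)) i j ⟨
        (V ⊗ ((inverse ⊗ N) ⊗ V⁻¹)) i j
          ≡⟨ ⊗-congʳ V (λ r c → trans (⊗-congˡ V⁻¹ inverse⊗M r c) (scaled-Id r λ l → V⁻¹ l c)) i j ⟩
        sum (λ l → V i l * (scale * V⁻¹ l j))
          ≡⟨ sum-cong-≗ (λ l → solve 3 (λ a s b → a :* (s :* b) := s :* (a :* b)) refl (V i l) scale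
               (V⁻¹ l j)) ⟩
        sum (λ l → scale * (V i l * V⁻¹ l j))
          ≡⟨ *-distribˡ-sum scale (λ l → V i l * V⁻¹ l j) ⟨
        scale * (V ⊗ V⁻¹) i j            ≡⟨ cong (scale *_) (V⊗V⁻¹ i j) ⟩
        scale * Id i j                   ∎
    }
    where
    open _~_ M~N
    open ScaledInverse N⁻¹
    scaled-Id : ∀ {n} i (a : Vector ℤ n) → sum (λ l → scale * Id i l * a l) ≡ scale * a i
    scaled-Id i a = trans (sum-cong-≗ λ l → ℤ.*-assoc scale (Id i l) (a l))
      (trans (sym (*-distribˡ-sum scale (λ l → Id i l * a l))) (cong (scale *_) (sum-Idˡ i a)))

  -- For M = [d 0; c M′] and M′ B′ = B′ M′ = s the inverse is [s 0; -B′c dB′].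
  scaledInverse-block : ∀ {p} (M : Matrix ℤ (suc p) (suc p)) → (∀ l → M zero (suc l) ≡ 0ℤ) →
                        M zero zero ≢ 0ℤ → ScaledInverse (minor₀₀ M) → ScaledInverse M
  scaledInverse-block {p} M zeros d≢0 M′⁻¹ = record
    { scale     = d * s
    ; scale≢0   = λ ds≡0 → case-⊎ (ℤ.i*j≡0⇒i≡0∨j≡0 d ds≡0)
    ; inverse   = B
    ; M⊗inverse = λ
        { zero zero → trans (cong (λ z → d * s + z) (sum-zero λ l → cong (_* B (suc l) zero) (zeros l)))
            (solve 1 (λ x → x :+ con 0ℤ := x :* con 1ℤ) refl (d * s))
        ; zero (suc j) → trans (cong₂ _+_ (ℤ.*-zeroʳ d)
            (sum-zero λ l → cong (_* B (suc l) (suc j)) (zeros l)))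
            (sym (ℤ.*-zeroʳ (d * s)))
        ; (suc i) zero → begin
            c i * s + sum (λ l → M′ i l * - (inverse ⊙ c) l)
              ≡⟨ cong (λ z → c i * s + z) (sum-neg (M′ i) (inverse ⊙ c)) ⟩
            c i * s - sum (λ l → M′ i l * (inverse ⊙ c) l)
              ≡⟨ cong (λ z → c i * s - z) (trans (sym (sum-assoc (M′ i) inverse c))
                   (trans (⊙-cong M⊗inverse i) (scaled-Id i c))) ⟩
            c i * s - s * c i
              ≡⟨ solve 3 (λ x s d → x :* s :- s :* x := d :* s :* con 0ℤ) refl (c i) s d ⟩
            d * s * 0ℤ ∎
        ; (suc i) (suc j) → begin
            c i * 0ℤ + sum (λ l → M′ i l * (d * inverse l j))
              ≡⟨ cong₂ _+_ (ℤ.*-zeroʳ (c i)) (trans (sum-scale (M′ i) d (λ l → inverse l j))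
                   (cong (d *_) (M⊗inverse i j))) ⟩
            0ℤ + d * (s * Id i j)
              ≡⟨ trans (ℤ.+-identityˡ _) (sym (ℤ.*-assoc d s (Id i j))) ⟩
            d * s * Id i j ∎
        }
    ; inverse⊗M = λ
        { zero zero → trans (cong (λ z → s * d + z) (sum-zero {p} λ l → refl))
            (solve 2 (λ s d → s :* d :+ con 0ℤ := d :* s :* con 1ℤ) refl s d)
        ; zero (suc j) → trans (cong₂ _+_ (trans (cong (s *_) (zeros j)) (ℤ.*-zeroʳ s))
            (sum-zero {p} λ l → refl))
            (sym (ℤ.*-zeroʳ (d * s)))
        ; (suc i) zero → begin
            - (inverse ⊙ c) i * d + sum (λ l → d * inverse i l * c l)
              ≡⟨ cong (λ z → - (inverse ⊙ c) i * d + z) (sum-scaleˡ d (inverse i) c) ⟩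
            - (inverse ⊙ c) i * d + d * (inverse ⊙ c) i
              ≡⟨ solve 3 (λ x s d → :- x :* d :+ d :* x := d :* s :* con 0ℤ) refl
                   ((inverse ⊙ c) i) s d ⟩
            d * s * 0ℤ ∎
        ; (suc i) (suc j) → begin
            - (inverse ⊙ c) i * M zero (suc j) + sum (λ l → d * inverse i l * M′ l j)
              ≡⟨ cong₂ _+_ (trans (cong (- (inverse ⊙ c) i *_) (zeros j))
                   (ℤ.*-zeroʳ (- (inverse ⊙ c) i)))
                   (trans (sum-scaleˡ d (inverse i) (λ l → M′ l j)) (cong (d *_) (inverse⊗M i j))) ⟩
            0ℤ + d * (s * Id i j)
              ≡⟨ trans (ℤ.+-identityˡ _) (sym (ℤ.*-assoc d s (Id i j))) ⟩
            d * s * Id i j ∎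
        }
    }
    where
    open ScaledInverse M′⁻¹ renaming (scale to s; scale≢0 to s≢0)
    M′ = minor₀₀ M
    d = M zero zero
    c : Vector ℤ p
    c i = M (suc i) zero
    B : Matrix ℤ (suc p) (suc p)
    B zero    zero    = s
    B zero    (suc j) = 0ℤ
    B (suc i) zero    = - (inverse ⊙ c) i
    B (suc i) (suc j) = d * inverse i j
    case-⊎ : ¬ (d ≡ 0ℤ ⊎ s ≡ 0ℤ)
    case-⊎ (inj₁ d≡0) = d≢0 d≡0
    case-⊎ (inj₂ s≡0) = s≢0 s≡0
    sum-scaleˡ : ∀ {n} t (a b : Vector ℤ n) → sum (λ l → t * a l * b l) ≡ t * sum (λ l → a l * b l)
    sum-scaleˡ t a b = trans (sum-cong-≗ λ l → ℤ.*-assoc t (a l) (b l))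
        (sym (*-distribˡ-sum t (λ l → a l * b l)))
    sum-scale : ∀ {n} (a : Vector ℤ n) t (b : Vector ℤ n) → sum (λ l → a l * (t * b l)) ≡ t * sum
        (λ l → a l * b l)
    sum-scale a t b = trans (sum-cong-≗ λ l → solve 3 (λ a t b → a :* (t :* b) := t :* (a :* b)) refl
        (a l) t (b l))
      (sym (*-distribˡ-sum t (λ l → a l * b l)))
    sum-neg : ∀ {n} (a b : Vector ℤ n) → sum (λ l → a l * - b l) ≡ - sum (λ l → a l * b l)
    sum-neg a b = trans (sum-cong-≗ λ l → solve 2 (λ a b → a :* :- b := con -1ℤ :* (a :* b)) refl (a l)
        (b l))
      (trans (sym (*-distribˡ-sum -1ℤ (λ l → a l * b l))) (ℤ.-1*i≡-i _))
    scaled-Id : ∀ {n} i (a : Vector ℤ n) → sum (λ l → s * Id i l * a l) ≡ s * a i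
    scaled-Id i a = trans (sum-scaleˡ s (Id i) a) (cong (s *_) (sum-Idˡ i a))

  scaledInverse : ∀ {p} (M : Matrix ℤ p p) → det M ≢ 0ℤ → ScaledInverse M
  scaledInverse {zero}  M det≢0 = record
    { scale = 1ℤ ; scale≢0 = λ () ; inverse = λ () ; M⊗inverse = λ () ; inverse⊗M = λ () }
  scaledInverse {suc p} M det≢0 =
    let N , M~N , zeros = reduceRow M
        det-N≢0 = λ eq → det≢0 (ℤ.∣i∣≡0⇒i≡0
            (trans (∣det∣-~ M~N) (cong ∣_∣ (trans (det-block N zeros) eq))))
    in scaledInverse-~ M~N (scaledInverse-block N zeros
         (λ N₀₀≡0 → det-N≢0 (cong (_* det (minor₀₀ N)) N₀₀≡0))
         (scaledInverse (minor₀₀ N) λ det₀₀≡0 → det-N≢0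
            (trans (cong (N zero zero *_) det₀₀≡0) (ℤ.*-zeroʳ (N zero zero)))))

  -- The order of the cokernel.

  infix 4 _∼[_]_
  _∼[_]_ : ∀ {p k} → Vector ℤ p → Matrix ℤ p k → Vector ℤ p → Set
  u ∼[ M ] v = ∃ λ x → ∀ r → u r - v r ≡ (M ⊙ x) r

  -- No quotient is formed: `to` is a complete invariant of the classes modulo the column span, and
  -- `from` chooses representatives.
  record CokernelHasSize {p k} (M : Matrix ℤ p k) (m : ℕ) : Set where
    field
      to           : Vector ℤ p → Fin m
      from         : Fin m → Vector ℤ p
      to-cong      : ∀ u v → u ∼[ M ] v → to u ≡ to v
      to-injective : ∀ u v → to u ≡ to v → u ∼[ M ] v
      to∘from      : ∀ i → to (from i) ≡ i

  -- Equivalent matrices span the same subgroup, so the invariant and the representatives are kept;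
  -- only the witnessing coefficients are transformed by V or its inverse.
  cokernel-~ : ∀ {p k m} {M N : Matrix ℤ p k} → M ~ N → CokernelHasSize N m → CokernelHasSize M m
  cokernel-~ {M = M} {N} M~N coker = record
    { to           = to
    ; from         = from
    ; to-cong      = λ u v (x , u-v≡Mx) → to-cong u v (V⁻¹ ⊙ x , λ r →
        trans (u-v≡Mx r) (trans (⊙-cong M≡N⊗V⁻¹ r) (sum-assoc (N r) V⁻¹ x)))
    ; to-injective = λ u v eq → let x , u-v≡Nx = to-injective u v eq in V ⊙ x , λ r →
        trans (u-v≡Nx r) (trans (⊙-cong N≡M⊗V r) (sum-assoc (M r) V x))
    ; to∘from      = to∘from
    }
    where
    open CokernelHasSize coker
    open _~_ M~N

  -- The difference of two remainders is a multiple of d smaller than |d| in absolute value, hence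
  -- zero.
  %-/-unique : ∀ d q q′ {r r′} → r ℕ.< ∣ d ∣ → r′ ℕ.< ∣ d ∣ →
               + r + q * d ≡ + r′ + q′ * d → r ≡ r′ × q ≡ q′
  %-/-unique d q q′ {r} {r′} r<d r′<d eq = r≡r′ , q≡q′
    where
    distance : ∀ {m n k} → m ℕ.< k → n ℕ.< k → ∣ + m - + n ∣ ℕ.< k
    distance {m} {n} m<k n<k with ℕ.≤-total m n
    ... | inj₁ m≤n = subst (ℕ._< _) (sym (trans (cong ∣_∣ (ℤ.[+m]-[+n]≡m⊖n m n)) (ℤ.∣⊖∣-≤ m≤n)))
                       (ℕ.≤-<-trans (ℕ.m∸n≤m n m) n<k)
    ... | inj₂ n≤m = subst (ℕ._< _)
        (sym (trans (cong ∣_∣ (trans (ℤ.[+m]-[+n]≡m⊖n m n) (ℤ.⊖-≥ n≤m))) refl))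
                       (ℕ.≤-<-trans (ℕ.m∸n≤m m n) m<k)
    small : ∀ m n → m ℕ.* n ℕ.< n → m ≡ 0
    small zero    n _   = refl
    small (suc m) n m*n<n = contradiction (ℕ.m≤m+n n (m ℕ.* n)) (ℕ.<⇒≱ m*n<n)
    difference : (q - q′) * d ≡ + r′ - + r
    difference = begin
      (q - q′) * d
          ≡⟨ solve 4 (λ q q′ d r → (q :- q′) :* d := (r :+ q :* d) :- (r :+ q′ :* d)) refl q q′ d
          (+ r) ⟩
      (+ r + q * d) - (+ r + q′ * d)      ≡⟨ cong (_- (+ r + q′ * d)) eq ⟩
      (+ r′ + q′ * d) - (+ r + q′ * d)
          ≡⟨ solve 3 (λ x r r′ → (r′ :+ x) :- (r :+ x) := r′ :- r) refl (q′ * d) (+ r) (+ r′) ⟩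
      + r′ - + r                          ∎
    q≡q′ : q ≡ q′
    q≡q′ = ℤ.i-j≡0⇒i≡j q q′ (ℤ.∣i∣≡0⇒i≡0 (small ∣ q - q′ ∣ ∣ d ∣
      (subst (ℕ._< ∣ d ∣) (trans (cong ∣_∣ (sym difference)) (ℤ.abs-* (q - q′) d))
          (distance r′<d r<d))))
    r≡r′ : r ≡ r′
    r≡r′ = sym (ℤ.+-injective (ℤ.i-j≡0⇒i≡j (+ r′) (+ r) (trans (sym difference)
      (cong (_* d) (ℤ.i≡j⇒i-j≡0 q≡q′)))))

  -- The first coordinate is reduced modulo d = M₀₀ by subtracting a multiple
  -- of the first column.
  cokernel-block : ∀ {p m} (M : Matrix ℤ (suc p) (suc p)) → (∀ l → M zero (suc l) ≡ 0ℤ) →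
                   M zero zero ≢ 0ℤ → CokernelHasSize (minor₀₀ M) m →
                   CokernelHasSize M (∣ M zero zero ∣ ℕ.* m)
  cokernel-block {p} {m} M zeros d≢0 coker = record
    { to           = to′
    ; from         = from′
    ; to-cong      = to′-cong
    ; to-injective = to′-injective
    ; to∘from      = to′∘from′
    }
    where
    open CokernelHasSize coker
    M′ = minor₀₀ M
    d = M zero zero
    instance
      d-nonZero : ℤ.NonZero d
      d-nonZero = ℤ.≢-nonZero d≢0
    c : Vector ℤ p
    c i = M (suc i) zero
    rest : ℤ → Vector ℤ (suc p) → Vector ℤ p
    rest q u r = u (suc r) - c r * q
    remainder : ℤ → Fin ∣ d ∣
    remainder a = fromℕ< (ℤ.n%d<d a d)
    to′ : Vector ℤ (suc p) → Fin (∣ d ∣ ℕ.* m)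
    to′ u = combine (remainder (u zero)) (to (rest (u zero ℤ./ d) u))
    from″ : Fin ∣ d ∣ × Fin m → Vector ℤ (suc p)
    from″ (a , b) zero    = + toℕ a
    from″ (a , b) (suc r) = from b r
    from′ : Fin (∣ d ∣ ℕ.* m) → Vector ℤ (suc p)
    from′ i = from″ (remQuot m i)

    split : ∀ u v a → u zero - v zero ≡ d * a →
            remainder (u zero) ≡ remainder (v zero) × u zero ℤ./ d ≡ v zero ℤ./ d + a
    split u v a eq = Fin.toℕ-injective
        (trans (Fin.toℕ-fromℕ< _) (trans (proj₁ unique) (sym (Fin.toℕ-fromℕ< _)))) , proj₂ unique
      where
      q = u zero ℤ./ d
      q′ = v zero ℤ./ d
      unique = %-/-unique d q (q′ + a) (ℤ.n%d<d (u zero) d) (ℤ.n%d<d (v zero) d) (begin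
        + (u zero ℤ.% d) + q * d              ≡⟨ ℤ.a≡a%n+[a/n]*n (u zero) d ⟨
        u zero
            ≡⟨ solve 2 (λ u v → u := v :+ (u :- v)) refl (u zero) (v zero) ⟩
        v zero + (u zero - v zero)            ≡⟨ cong₂ _+_ (ℤ.a≡a%n+[a/n]*n (v zero) d) eq ⟩
        + (v zero ℤ.% d) + q′ * d + d * a
            ≡⟨ solve 4 (λ r q d a → r :+ q :* d :+ d :* a := r :+ (q :+ a) :* d) refl
            (+ (v zero ℤ.% d)) q′ d a ⟩
        + (v zero ℤ.% d) + (q′ + a) * d       ∎)

    row₀ : ∀ x → (M ⊙ x) zero ≡ d * x zero
    row₀ x = trans (cong (λ z → d * x zero + z)
        (sum-zero {v = λ l → M zero (suc l) * x (suc l)} λ l → cong (_* x (suc l)) (zeros l)))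
      (ℤ.+-identityʳ (d * x zero))

    to′-cong : ∀ u v → u ∼[ M ] v → to′ u ≡ to′ v
    to′-cong u v (x , u-v≡Mx) =
      let r≡r′ , q≡q′+x₀ = split u v (x zero) (trans (u-v≡Mx zero) (row₀ x))
      in cong₂ combine r≡r′ (to-cong _ _ (tail x , λ r → begin
           (u (suc r) - c r * q) - (v (suc r) - c r * q′)
             ≡⟨ solve 5 (λ u v c q q′ → (u :- c :* q) :- (v :- c :* q′) := (u :- v) :- c :* (q :- q′))
                  refl (u (suc r)) (v (suc r)) (c r) q q′ ⟩
           (u (suc r) - v (suc r)) - c r * (q - q′)
             ≡⟨ cong₂ (λ y z → y - c r * (z - q′)) (u-v≡Mx (suc r)) q≡q′+x₀ ⟩
           (c r * x zero + (M′ ⊙ tail x) r) - c r * ((q′ + x zero) - q′)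
             ≡⟨ solve 4 (λ c x y q → (c :* x :+ y) :- c :* ((q :+ x) :- q) := y) refl (c r) (x zero)
                  ((M′ ⊙ tail x) r) q′ ⟩
           (M′ ⊙ tail x) r ∎))
      where
      q = u zero ℤ./ d
      q′ = v zero ℤ./ d

    to′-injective : ∀ u v → to′ u ≡ to′ v → u ∼[ M ] v
    to′-injective u v eq =
      let r≡r′ , to≡to = Fin.combine-injective (remainder (u zero)) (to (rest q u))
                          (remainder (v zero)) (to (rest q′ v)) eq
          x , eq′ = to-injective _ _ to≡to
          %≡% = trans (sym (Fin.toℕ-fromℕ< (ℤ.n%d<d (u zero) d)))
              (trans (cong toℕ r≡r′) (Fin.toℕ-fromℕ< (ℤ.n%d<d (v zero) d)))
      -- With equal remainders, the first coordinates differ by d times the difference of the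
      -- quotients, which is thus the coefficient of the first column.
      in (q - q′) ∷ᶠ x , λ
         { zero → begin
             u zero - v zero
               ≡⟨ cong₂ _-_ (ℤ.a≡a%n+[a/n]*n (u zero) d) (ℤ.a≡a%n+[a/n]*n (v zero) d) ⟩
             (+ (u zero ℤ.% d) + q * d) - (+ (v zero ℤ.% d) + q′ * d)
               ≡⟨ cong (λ z → (+ z + q * d) - (+ (v zero ℤ.% d) + q′ * d)) %≡% ⟩
             (+ (v zero ℤ.% d) + q * d) - (+ (v zero ℤ.% d) + q′ * d)
               ≡⟨ solve 4 (λ r q q′ d → (r :+ q :* d) :- (r :+ q′ :* d) := d :* (q :- q′)) refl
                    (+ (v zero ℤ.% d)) q q′ d ⟩
             d * (q - q′)
               ≡⟨ row₀ ((q - q′) ∷ᶠ x) ⟨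
             (M ⊙ ((q - q′) ∷ᶠ x)) zero ∎
         ; (suc r) → begin
             u (suc r) - v (suc r)
               ≡⟨ solve 5 (λ u v c q q′ → u :- v := c :* (q :- q′) :+ ((u :- c :* q) :- (v :- c :* q′)))
                    refl (u (suc r)) (v (suc r)) (c r) q q′ ⟩
             c r * (q - q′) + (rest q u r - rest q′ v r)
               ≡⟨ cong (λ z → c r * (q - q′) + z) (eq′ r) ⟩
             c r * (q - q′) + (M′ ⊙ x) r ∎
         }
      where
      q = u zero ℤ./ d
      q′ = v zero ℤ./ d

    to′∘from″ : ∀ a b → to′ (from″ (a , b)) ≡ combine a b
    to′∘from″ a b =
      -- A first coordinate a below |d| is its own remainder with quotient 0, so no multiple of the
      -- first column is subtracted from the representative.
      let r≡a , q≡0 = %-/-unique d (+ toℕ a ℤ./ d) 0ℤ (ℤ.n%d<d (+ toℕ a) d) (Fin.toℕ<n a)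
                        (trans (sym (ℤ.a≡a%n+[a/n]*n (+ toℕ a) d)) (sym (ℤ.+-identityʳ (+ toℕ a))))
      in cong₂ combine (Fin.toℕ-injective (trans (Fin.toℕ-fromℕ< _) r≡a))
           (trans (to-cong (rest (+ toℕ a ℤ./ d) (from″ (a , b))) (from b) ((λ _ → 0ℤ) , λ r → begin
               (from b r - c r * (+ toℕ a ℤ./ d)) - from b r
                   ≡⟨ cong (λ z → (from b r - c r * z) - from b r) q≡0 ⟩
               (from b r - c r * 0ℤ) - from b r
                   ≡⟨ solve 2 (λ x c → (x :- c :* con 0ℤ) :- x := con 0ℤ) refl (from b r) (c r) ⟩
               0ℤ                                              ≡⟨ ⊙-zero M′ (λ _ → refl) r ⟨
               (M′ ⊙ (λ _ → 0ℤ)) r                             ∎))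
             (to∘from b))

    to′∘from′ : ∀ i → to′ (from′ i) ≡ i
    to′∘from′ i = trans (to′∘from″ _ _) (Fin.combine-remQuot {∣ d ∣} m i)

  -- For the reduced matrix the cokernel is an extension of ℤ modulo the corner entry by the
  -- cokernel of the smaller matrix; its order is multiplicative in the same way as the determinant.
  cokernel-size : ∀ {p} (M : Matrix ℤ p p) → det M ≢ 0ℤ → CokernelHasSize M ∣ det M ∣
  cokernel-size {zero}  M _ = record
    { to = λ _ → zero ; from = λ _ () ; to-cong = λ _ _ _ → refl
    ; to-injective = λ _ _ _ → (λ ()) , λ () ; to∘from = λ { zero → refl } }
  cokernel-size {suc p} M det≢0 =
    let N , M~N , zeros = reduceRow M
        det-N≢0 = λ eq → det≢0 (ℤ.∣i∣≡0⇒i≡0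
            (trans (∣det∣-~ M~N) (cong ∣_∣ (trans (det-block N zeros) eq))))
    in subst (CokernelHasSize M)
         (sym (trans (∣det∣-~ M~N) (trans (cong ∣_∣ (det-block N zeros))
             (ℤ.abs-* (N zero zero) (det (minor₀₀ N))))))
         (cokernel-~ M~N (cokernel-block N zeros
           (λ N₀₀≡0 → det-N≢0 (cong (_* det (minor₀₀ N)) N₀₀≡0))
           (cokernel-size (minor₀₀ N) λ det₀₀≡0 → det-N≢0
              (trans (cong (N zero zero *_) det₀₀≡0) (ℤ.*-zeroʳ (N zero zero))))))

-- Square submatrices selected by a set of columns.

module SelectedColumns where
  open ≡ using (refl; sym; trans)
  open import Data.Vec.Base using (_++_)
  open IntegerMatrix
  open import Data.Integer.Base using (_+_; _*_; ∣_∣)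
  open LinearAlgebra ℤ.+-*-rawRing using (sum; _⊗_; Id)
  open SemiringSum ℤ.+-*-semiring using (sum-cong-≗)
  open ≡-Reasoning

  extend : ∀ {n} (S : Subset n) → Vector ℤ Subset.∣ S ∣ → Vector ℤ n
  extend (outside ∷ S) x zero    = 0ℤ
  extend (outside ∷ S) x (suc j) = extend S x j
  extend (inside  ∷ S) x zero    = x zero
  extend (inside  ∷ S) x (suc j) = extend S (x ∘ suc) j

  extend-enum : ∀ {n} (S : Subset n) x i → extend S x (enum S i) ≡ x i
  extend-enum (outside ∷ S) x i       = extend-enum S x i
  extend-enum (inside  ∷ S) x zero    = refl
  extend-enum (inside  ∷ S) x (suc i) = extend-enum S (x ∘ suc) i

  extend-∉ : ∀ {n} (S : Subset n) x {j} → j ∉ S → extend S x j ≡ 0ℤ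
  extend-∉ (outside ∷ S) x {zero}  j∉S = refl
  extend-∉ (outside ∷ S) x {suc j} j∉S = extend-∉ S x (j∉S ∘ there)
  extend-∉ (inside  ∷ S) x {zero}  j∉S = contradiction here j∉S
  extend-∉ (inside  ∷ S) x {suc j} j∉S = extend-∉ S (x ∘ suc) (j∉S ∘ there)

  extend-restrict : ∀ {n} (S : Subset n) y → (∀ j → j ∉ S → y j ≡ 0ℤ) →
                    ∀ j → extend S (y ∘ enum S) j ≡ y j
  extend-restrict (outside ∷ S) y supp zero    = sym (supp zero λ ())
  extend-restrict (inside  ∷ S) y supp zero    = refl
  extend-restrict (outside ∷ S) y supp (suc j) = extend-restrict S (y ∘ suc)
      (λ j j∉S → supp (suc j) (j∉S ∘ drop-there)) j
  extend-restrict (inside  ∷ S) y supp (suc j) = extend-restrict S (y ∘ suc)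
      (λ j j∉S → supp (suc j) (j∉S ∘ drop-there)) j

  sum-extend : ∀ {n} (S : Subset n) (f : Vector ℤ n) x →
               sum (λ j → f j * extend S x j) ≡ sum (λ i → f (enum S i) * x i)
  sum-extend []            f x = refl
  sum-extend (outside ∷ S) f x = trans (cong₂ _+_ (ℤ.*-zeroʳ (f zero)) (sum-extend S (f ∘ suc) x))
      (ℤ.+-identityˡ _)
  sum-extend (inside  ∷ S) f x = cong (λ z → f zero * x zero + z) (sum-extend S (f ∘ suc) (x ∘ suc))

  enum-surjective : ∀ {n} (S : Subset n) {j} → j ∈ S → ∃ λ i → enum S i ≡ j
  enum-surjective (inside  ∷ S) here        = zero , refl
  enum-surjective (inside  ∷ S) (there j∈S) = let i , eq = enum-surjective S j∈S in suc i , cong suc eq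
  enum-surjective (outside ∷ S) (there j∈S) = let i , eq = enum-surjective S j∈S in i , cong suc eq

  Id-enum : ∀ {n} (S : Subset n) i j → Id (enum S i) (enum S j) ≡ Id i j
  Id-enum (outside ∷ S) i       j       = Id-enum S i j
  Id-enum (inside  ∷ S) zero    zero    = refl
  Id-enum (inside  ∷ S) zero    (suc j) = refl
  Id-enum (inside  ∷ S) (suc i) zero    = refl
  Id-enum (inside  ∷ S) (suc i) (suc j) = Id-enum S i j

  select : ∀ {k n} → Matrix ℤ k n → (S : Subset n) → Matrix ℤ k Subset.∣ S ∣
  select W S i j = W i (enum S j)

  ⊙-extend : ∀ {k n} (W : Matrix ℤ k n) S x r → (W ⊙ extend S x) r ≡ (select W S ⊙ x) r
  ⊙-extend W S x r = sum-extend S (W r) x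

  size≡rows : ∀ {k n} (W : Matrix ℤ k n) S → ⋀ W S ≢ 0ℤ → Subset.∣ S ∣ ≡ k
  size≡rows {k} W S c≢0 with Subset.∣ S ∣ ℕ.≟ k
  ... | yes eq = eq
  ... | no  ≢k = contradiction (⋀-homogeneous W S ≢k) c≢0

  cokernel-select : ∀ {k n} (W : Matrix ℤ k n) S → ⋀ W S ≢ 0ℤ →
                    CokernelHasSize (select W S) ∣ ⋀ W S ∣
  cokernel-select W S c≢0 = go W S (size≡rows W S c≢0) c≢0
    where
    -- The selected matrix becomes square only once k is unified with the size of S, so the equation
    -- is an argument open to matching.
    go : ∀ {k n} (W : Matrix ℤ k n) S → Subset.∣ S ∣ ≡ k → ⋀ W S ≢ 0ℤ →
         CokernelHasSize (select W S) ∣ ⋀ W S ∣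
    go W S refl c≢0 = subst (λ d → CokernelHasSize (select W S) ∣ d ∣) (sym (⋀-minor W S refl))
      (cokernel-size (select W S) λ det≡0 → c≢0 (trans (⋀-minor W S refl) det≡0))

  -- The scaled inverse of the selected columns, padded with zero rows outside S; this frees later
  -- arguments from the enumeration of S.
  record ScaledInverseOn {k n} (W : Matrix ℤ k n) (S : Subset n) : Set where
    field
      scale     : ℤ
      scale≢0   : scale ≢ 0ℤ
      inverse   : Matrix ℤ n k
      supported : ∀ {j} → j ∉ S → ∀ i → inverse j i ≡ 0ℤ
      W⊗inverse : ∀ i j → (W ⊗ inverse) i j ≡ scale * Id i j
      inverse⊗W : ∀ {i j} → i ∈ S → j ∈ S → (inverse ⊗ W) i j ≡ scale * Id i j

  scaledInverse-select : ∀ {k n} (W : Matrix ℤ k n) S → ⋀ W S ≢ 0ℤ → ScaledInverseOn W S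
  scaledInverse-select W S c≢0 = go W S (size≡rows W S c≢0) c≢0
    where
    go : ∀ {k n} (W : Matrix ℤ k n) S → Subset.∣ S ∣ ≡ k → ⋀ W S ≢ 0ℤ → ScaledInverseOn W S
    go W S refl c≢0 = record
      { scale     = scale
      ; scale≢0   = scale≢0
      ; inverse   = λ j i → extend S (λ s → inverse s i) j
      ; supported = λ j∉S i → extend-∉ S (λ s → inverse s i) j∉S
      ; W⊗inverse = λ i j → trans (⊙-extend W S (λ s → inverse s j) i) (M⊗inverse i j)
      ; inverse⊗W = λ i∈S j∈S → on-S (enum-surjective S i∈S) (enum-surjective S j∈S)
      }
      where
      open ScaledInverse (scaledInverse (select W S) λ det≡0 → c≢0 (trans (⋀-minor W S refl) det≡0))
      on-S : ∀ {i j} → ∃ (λ s → enum S s ≡ i) → ∃ (λ t → enum S t ≡ j) →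
             sum (λ l → extend S (λ s → inverse s l) i * W l j) ≡ scale * Id i j
      on-S (s , refl) (t , refl) = begin
        sum (λ l → extend S (λ s → inverse s l) (enum S s) * W l (enum S t))
          ≡⟨ sum-cong-≗ (λ l → cong (_* W l (enum S t)) (extend-enum S (λ s → inverse s l) s)) ⟩
        (inverse ⊗ select W S) s t
          ≡⟨ inverse⊗M s t ⟩
        scale * Id s t
          ≡⟨ cong (scale *_) (Id-enum S s t) ⟨
        scale * Id (enum S s) (enum S t) ∎

  NullColumns : ∀ {k n} → Matrix ℤ k n → Subset n → Set
  NullColumns {n = n} W S = ∃ λ (x : Vector ℤ n) → (∀ j → j ∉ S → x j ≡ 0ℤ) × (∀ r → (W ⊙ x) r ≡ 0ℤ) × ¬
      (∀ j → x j ≡ 0ℤ)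

  NullRows : ∀ {k n} → Matrix ℤ k n → Subset n → Set
  NullRows {k} W S = ∃ λ (y : Vector ℤ k) → (∀ j → j ∈ S → sum (λ i → y i * W i j) ≡ 0ℤ) × ¬
      (∀ i → y i ≡ 0ℤ)

  nullVector⇒nullColumns : ∀ {k n} (W : Matrix ℤ k n) S → NullVector (select W S) → NullColumns W S
  nullVector⇒nullColumns W S (x , Nx≡0 , j , xj≢0) = extend S x
    , (λ _ → extend-∉ S x)
    , (λ r → trans (⊙-extend W S x r) (Nx≡0 r))
    , λ x≡0 → xj≢0 (trans (sym (extend-enum S x j)) (x≡0 (enum S j)))

  nullVector⇒nullRows : ∀ {k n} (W : Matrix ℤ k n) S → NullVector
      (λ j i → select W S i j) → NullRows W S
  nullVector⇒nullRows W S (y , yN≡0 , i , yi≢0) = y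
    , (λ j j∈S → on-S (enum-surjective S j∈S)) , λ y≡0 → yi≢0 (y≡0 i)
    where
    on-S : ∀ {j} → ∃ (λ t → enum S t ≡ j) → sum (λ i → y i * W i j) ≡ 0ℤ
    on-S (t , refl) = trans (sum-cong-≗ λ i → ℤ.*-comm (y i) (W i (enum S t))) (yN≡0 t)

  -- With fewer than k columns the transpose is wide and the rows are dependent; with more, the
  -- columns are dependent. In the square case the coordinate is a determinant and the matrix is
  -- singular.
  degenerate : ∀ {k n} (W : Matrix ℤ k n) S → ⋀ W S ≡ 0ℤ → NullColumns W S ⊎ NullRows W S
  degenerate {k} W S c≡0 with ℕ.<-cmp Subset.∣ S ∣ k
  ... | tri< <k _ _ = inj₂ (nullVector⇒nullRows W S (nullVector-wide <k (λ j i → select W S i j)))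
  ... | tri> _ _ >k = inj₁ (nullVector⇒nullColumns W S (nullVector-wide >k (select W S)))
  ... | tri≈ _ eq _ = inj₁ (nullVector⇒nullColumns W S (go W S eq c≡0))
    where
    go : ∀ {k n} (W : Matrix ℤ k n) S → Subset.∣ S ∣ ≡ k → ⋀ W S ≡ 0ℤ → NullVector (select W S)
    go W S refl c≡0 = nullVector-singular (select W S) (trans (sym (⋀-minor W S refl)) c≡0)

  ∈-++ˡ⁺ : ∀ {p q} {R : Subset p} {F : Subset q} {r} → r ∈ R → (r ↑ˡ q) ∈ R ++ F
  ∈-++ˡ⁺ here        = here
  ∈-++ˡ⁺ (there r∈R) = there (∈-++ˡ⁺ r∈R)

  ∈-++ˡ⁻ : ∀ {p q} (R : Subset p) {F : Subset q} {r} → (r ↑ˡ q) ∈ R ++ F → r ∈ R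
  ∈-++ˡ⁻ (inside ∷ R) {r = zero}  here       = here
  ∈-++ˡ⁻ (_ ∷ R)      {r = suc r} (there ∈S) = there (∈-++ˡ⁻ R ∈S)

  ∈-++ʳ⁺ : ∀ {p q} (R : Subset p) {F : Subset q} {f} → f ∈ F → (p ↑ʳ f) ∈ R ++ F
  ∈-++ʳ⁺ []      f∈F = f∈F
  ∈-++ʳ⁺ (_ ∷ R) f∈F = there (∈-++ʳ⁺ R f∈F)

  ∈-++ʳ⁻ : ∀ {p q} (R : Subset p) {F : Subset q} {f} → (p ↑ʳ f) ∈ R ++ F → f ∈ F
  ∈-++ʳ⁻ []      ∈S         = ∈S
  ∈-++ʳ⁻ (_ ∷ R) (there ∈S) = ∈-++ʳ⁻ R ∈S

-- Minors of `Id∣ M` at R ∪ F.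

module _ {p q} (M : Matrix ℤ p q) (F : Subset q) (R : Subset p) where
  open ≡ using (refl; sym; trans)
  open import Data.Vec.Base using (_++_)
  open IntegerMatrix
  open SelectedColumns
  open import Data.Integer.Base using (_+_; _-_; _*_)
  open LinearAlgebra ℤ.+-*-rawRing using (sum; _⊗_; Id)
  open SemiringSum ℤ.+-*-semiring using (sum-cong-≗)
  open Exterior ℤ.+-*-commutativeRing using (Id∣_; sum-split)
  open ℤ.+-*-Solver using (solve; _:=_; _:+_; _:-_)
  open ≡-Reasoning
  private
    W = Id∣ M
    S = R ++ F

  -- Up to sign, the minor of M with rows ∁ R and columns F.
  minorAt : ℤ
  minorAt = ⋀ W S

  private
    ⊙-split : ∀ y r → (W ⊙ y) r ≡ y (r ↑ˡ q) + (M ⊙ (λ f → y (p ↑ʳ f))) r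
    ⊙-split y r = trans (sum-split p (λ j → W r j * y j)) (cong₂ _+_
      (trans (sum-cong-≗ λ i → cong (_* y (i ↑ˡ q)) (lookup-++ˡ (Id r) (M r) i))
          (sum-Idˡ r (λ i → y (i ↑ˡ q))))
      (sum-cong-≗ λ f → cong (_* y (p ↑ʳ f)) (lookup-++ʳ (Id r) (M r) f)))

    columnˡ : ∀ (y : Vector ℤ p) r → sum (λ i → y i * W i (r ↑ˡ q)) ≡ y r
    columnˡ y r = trans (sum-cong-≗ λ i → cong (y i *_) (lookup-++ˡ (Id i) (M i) r)) (sum-Idʳ y r)

    columnʳ : ∀ (y : Vector ℤ p) f → sum (λ i → y i * W i (p ↑ʳ f)) ≡ sum (λ i → y i * M i f)
    columnʳ y f = sum-cong-≗ λ i → cong (y i *_) (lookup-++ʳ (Id i) (M i) f)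

    elsewhere : ∀ {A : Fin (p ℕ.+ q) → Set} → (∀ r → A (r ↑ˡ q)) → (∀ f → A (p ↑ʳ f)) → ∀ j → A j
    elsewhere {A} onˡ onʳ j with splitAt p j | Fin.join-splitAt p q j
    ... | inj₁ r | refl = onˡ r
    ... | inj₂ f | refl = onʳ f

    Id-↑ʳ : ∀ p {q} (f f′ : Fin q) → Id (p ↑ʳ f) (p ↑ʳ f′) ≡ Id f f′
    Id-↑ʳ zero    f f′ = refl
    Id-↑ʳ (suc p) f f′ = Id-↑ʳ p f f′

    Id-↑ʳ-↑ˡ : ∀ {p q} (f : Fin q) (r : Fin p) → Id (p ↑ʳ f) (r ↑ˡ q) ≡ 0ℤ
    Id-↑ʳ-↑ˡ f zero    = refl
    Id-↑ʳ-↑ˡ f (suc r) = Id-↑ʳ-↑ˡ f r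

  -- u - v ∈ M ℤF + ℤR, the relation defining coker Ψ.
  RelationModulo : Vector ℤ p → Vector ℤ p → Set
  RelationModulo u v = ∃ λ (x : Vector ℤ q) → (∀ f → f ∉ F → x f ≡ 0ℤ) ×
      (∀ r → r ∉ R → (u r - v r) - (M ⊙ x) r ≡ 0ℤ)

  -- The slack (u - v) - M x vanishes outside R, so the unit columns at R can absorb it: it supplies
  -- their coefficients, and x those of the columns at F.
  relation⇒∼ : ∀ u v → RelationModulo u v → u ∼[ select W S ] v
  relation⇒∼ u v (x , x∈F , eq) = y ∘ enum S , λ r → sym (begin
    (select W S ⊙ (y ∘ enum S)) r            ≡⟨ ⊙-extend W S (y ∘ enum S) r ⟨
    (W ⊙ extend S (y ∘ enum S)) r
        ≡⟨ sum-cong-≗ (λ j → cong (W r j *_) (extend-restrict S y y∈S j)) ⟩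
    (W ⊙ y) r                                ≡⟨ ⊙-split y r ⟩
    y (r ↑ˡ q) + (M ⊙ (λ f → y (p ↑ʳ f))) r
        ≡⟨ cong₂ _+_ (lookup-++ˡ rest x r) (sum-cong-≗ λ f → cong (M r f *_) (lookup-++ʳ rest x f)) ⟩
    rest r + (M ⊙ x) r
        ≡⟨ solve 2 (λ a b → (a :- b) :+ b := a) refl (u r - v r) ((M ⊙ x) r) ⟩
    u r - v r                                ∎)
    where
    rest : Vector ℤ p
    rest r = (u r - v r) - (M ⊙ x) r
    y = rest ++ᶠ x
    y∈S : ∀ j → j ∉ S → y j ≡ 0ℤ
    y∈S = elsewhere
      (λ r ∉S → trans (lookup-++ˡ rest x r) (eq r (∉S ∘ ∈-++ˡ⁺)))
      (λ f ∉S → trans (lookup-++ʳ rest x f) (x∈F f (∉S ∘ ∈-++ʳ⁺ R)))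

  ∼⇒relation : ∀ u v → u ∼[ select W S ] v → RelationModulo u v
  ∼⇒relation u v (z , eq) = (λ f → y (p ↑ʳ f))
    , (λ f f∉F → extend-∉ S z (f∉F ∘ ∈-++ʳ⁻ R))
    , λ r r∉R → begin
        (u r - v r) - (M ⊙ (λ f → y (p ↑ʳ f))) r
          ≡⟨ cong (_- (M ⊙ (λ f → y (p ↑ʳ f))) r)
               (trans (eq r) (trans (sym (⊙-extend W S z r)) (⊙-split y r))) ⟩
        (y (r ↑ˡ q) + (M ⊙ (λ f → y (p ↑ʳ f))) r) - (M ⊙ (λ f → y (p ↑ʳ f))) r
          ≡⟨ solve 2 (λ a b → (a :+ b) :- b := a) refl (y (r ↑ˡ q)) ((M ⊙ (λ f → y (p ↑ʳ f))) r) ⟩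
        y (r ↑ˡ q)
          ≡⟨ extend-∉ S z (r∉R ∘ ∈-++ˡ⁻ R) ⟩
        0ℤ ∎
    where y = extend S z

  -- Up to `scale`, `Q` inverts the submatrix with rows ∁ R and columns F. It is kept at full size
  -- with zeros elsewhere, which is why `M⊗Q` can speak of every column i, including those in R.
  record MinorInverse : Set where
    field
      scale     : ℤ
      scale≢0   : scale ≢ 0ℤ
      Q         : Matrix ℤ q p
      Q-∉F      : ∀ {f} → f ∉ F → ∀ r → Q f r ≡ 0ℤ
      Q-∈R      : ∀ {r} → r ∈ R → ∀ f → Q f r ≡ 0ℤ
      M⊗Q       : ∀ {r} → r ∉ R → ∀ i → (M ⊗ Q) r i ≡ scale * Id r i
      Q⊗M       : ∀ {f f′} → f ∈ F → f′ ∈ F → (Q ⊗ M) f f′ ≡ scale * Id f f′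

  -- With the rows in R first, the selected columns of W form a block matrix [I A; 0 B], where B has
  -- rows ∁ R and columns F. The rows at F of its inverse are [0 B⁻¹].
  minorInverse : minorAt ≢ 0ℤ → MinorInverse
  minorInverse c≢0 = record
    { scale   = scale
    ; scale≢0 = scale≢0
    ; Q       = Q
    ; Q-∉F    = Q-∉F
    ; Q-∈R    = λ {r} r∈R f → Q-∈R r∈R f
    ; M⊗Q     = λ {r} r∉R i → begin
        (M ⊗ Q) r i
          ≡⟨ ℤ.+-identityˡ _ ⟨
        0ℤ + (M ⊗ Q) r i
          ≡⟨ cong (_+ (M ⊗ Q) r i) (supported (r∉R ∘ ∈-++ˡ⁻ R) i) ⟨
        inverse (r ↑ˡ q) i + (M ⊗ Q) r i
          ≡⟨ ⊙-split (λ j → inverse j i) r ⟨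
        (W ⊗ inverse) r i
          ≡⟨ W⊗inverse r i ⟩
        scale * Id r i ∎
    ; Q⊗M     = λ {f} {f′} f∈F f′∈F → begin
        (Q ⊗ M) f f′                          ≡⟨ columnʳ (Q f) f′ ⟨
        (inverse ⊗ W) (p ↑ʳ f) (p ↑ʳ f′)      ≡⟨ inverse⊗W (∈-++ʳ⁺ R f∈F) (∈-++ʳ⁺ R f′∈F) ⟩
        scale * Id (p ↑ʳ f) (p ↑ʳ f′)         ≡⟨ cong (scale *_) (Id-↑ʳ p f f′) ⟩
        scale * Id f f′                       ∎
    }
    where
    open ScaledInverseOn (scaledInverse-select W S c≢0)
    Q : Matrix ℤ q p
    Q f r = inverse (p ↑ʳ f) r
    Q-∉F : ∀ {f} → f ∉ F → ∀ r → Q f r ≡ 0ℤ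
    Q-∉F f∉F r = supported (f∉F ∘ ∈-++ʳ⁻ R) r
    Q-∈R : ∀ {r} → r ∈ R → ∀ f → Q f r ≡ 0ℤ
    Q-∈R {r} r∈R f with f ∈? F
    ... | no  f∉F = Q-∉F f∉F r
    ... | yes f∈F = begin
      Q f r                                ≡⟨ columnˡ (Q f) r ⟨
      (inverse ⊗ W) (p ↑ʳ f) (r ↑ˡ q)      ≡⟨ inverse⊗W (∈-++ʳ⁺ R f∈F) (∈-++ˡ⁺ r∈R) ⟩
      scale * Id (p ↑ʳ f) (r ↑ˡ q)         ≡⟨ cong (scale *_) (Id-↑ʳ-↑ˡ f r) ⟩
      scale * 0ℤ                           ≡⟨ ℤ.*-zeroʳ scale ⟩
      0ℤ                                   ∎

  DependentColumns : Set
  DependentColumns = ∃ λ (x : Vector ℤ q) → (∀ f → f ∉ F → x f ≡ 0ℤ) ×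
      (∀ r → r ∉ R → (M ⊙ x) r ≡ 0ℤ) × ¬ (∀ f → x f ≡ 0ℤ)

  DependentRows : Set
  DependentRows = ∃ λ (y : Vector ℤ p) → (∀ r → r ∈ R → y r ≡ 0ℤ) ×
      (∀ f → f ∈ F → sum (λ r → y r * M r f) ≡ 0ℤ) × ¬ (∀ r → y r ≡ 0ℤ)

  -- A relation y between rows is orthogonal to the unit columns at R, hence zero on R. A relation
  -- between columns loses its unit columns in the rows outside R, and becomes one between columns
  -- of M there.
  minorAt≡0⇒dependent : minorAt ≡ 0ℤ → DependentColumns ⊎ DependentRows
  minorAt≡0⇒dependent c≡0 with degenerate W S c≡0
  ... | inj₂ (y , yW≡0 , y≢0) = inj₂ (y
    , (λ r r∈R → trans (sym (columnˡ y r)) (yW≡0 (r ↑ˡ q) (∈-++ˡ⁺ r∈R)))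
    , (λ f f∈F → trans (sym (columnʳ y f)) (yW≡0 (p ↑ʳ f) (∈-++ʳ⁺ R f∈F)))
    , y≢0)
  ... | inj₁ (x , x∈S , Wx≡0 , x≢0) = inj₁ ((λ f → x (p ↑ʳ f))
    , (λ f f∉F → x∈S (p ↑ʳ f) (f∉F ∘ ∈-++ʳ⁻ R))
    , (λ r r∉R → trans (sym (ℤ.+-identityˡ _)) (trans
        (cong (_+ (M ⊙ (λ f → x (p ↑ʳ f))) r) (sym (x∈S (r ↑ˡ q) (r∉R ∘ ∈-++ˡ⁻ R)))) (Mx≡0 r)))
    -- If the part of x at F vanished, row r of W x = 0 would read x_r = 0, and the part at R would
    -- vanish as well.
    , λ xF≡0 → x≢0 (elsewhere (λ r → begin
        x (r ↑ˡ q)                                   ≡⟨ ℤ.+-identityʳ _ ⟨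
        x (r ↑ˡ q) + 0ℤ                              ≡⟨ cong (λ z → x (r ↑ˡ q) + z) (⊙-zero M xF≡0 r) ⟨
        x (r ↑ˡ q) + (M ⊙ (λ f → x (p ↑ʳ f))) r      ≡⟨ Mx≡0 r ⟩
        0ℤ                                           ∎) xF≡0))
    where
    Mx≡0 : ∀ r → x (r ↑ˡ q) + (M ⊙ (λ f → x (p ↑ʳ f))) r ≡ 0ℤ
    Mx≡0 r = trans (sym (⊙-split x r)) (Wx≡0 r)

-- Passage to the reals through null sequences.

module Reals where
  open ≡ using (refl; sym; trans)
  open import Data.Rational.Base using (_+_; _-_; _*_; -_; ∣_∣; _≤_; _<_)
  open CommutativeRing ℚ.+-*-commutativeRing using (semiring)
  open LinearAlgebra ℚ.+-*-rawRing using (sum; Id)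
  open SemiringSum semiring using (sum-cong-≗; ∑-distrib-+; *-distribʳ-sum)
  open Exterior ℚ.+-*-commutativeRing using (sum-zero; sum-Idˡ; sum-Idʳ; sum-assoc; Id-≢; Id-sym)
  module ℤLin = LinearAlgebra ℤ.+-*-rawRing
  open ℝ using (seq)
  open ℚ.+-*-Solver using (solve; _:=_; _:+_; _:*_; _:-_; :-_)

  -- Being zero in ℝ, as a property of the representing sequence. The matrices are rational and only
  -- the coefficients are real, so linear algebra over ℝ becomes algebra in ℚ at each index.
  Null : (ℕ → ℚ) → Set
  Null s = ∀ ε → 0ℚ < ε → ∃ λ N → ∀ i → N ℕ.≤ i → ∣ s i ∣ ≤ ε

  null-resp : ∀ {s t} → (∀ i → s i ≡ t i) → Null s → Null t
  null-resp s≗t s-null ε 0<ε = let N , small = s-null ε 0<ε in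
    N , λ i N≤i → subst (λ x → ∣ x ∣ ≤ ε) (s≗t i) (small i N≤i)

  null-zero : ∀ {s} → (∀ i → s i ≡ 0ℚ) → Null s
  null-zero s≡0 ε 0<ε = 0 , λ i _ → subst (λ x → ∣ x ∣ ≤ ε) (sym (s≡0 i)) (ℚ.<⇒≤ 0<ε)

  ½*-pos : ∀ {ε} → 0ℚ < ε → 0ℚ < ½ * ε
  ½*-pos {ε} 0<ε = ℚ.positive⁻¹ (½ * ε) {{ℚ.pos*pos⇒pos ½ ε {{ℚ.positive 0<ε}}}}

  ½+½ : ∀ ε → ½ * ε + ½ * ε ≡ ε
  ½+½ ε = trans (sym (ℚ.*-distribʳ-+ ε ½ ½)) (ℚ.*-identityˡ ε)

  null-+ : ∀ {s t} → Null s → Null t → Null (λ i → s i + t i)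
  null-+ {s} {t} s-null t-null ε 0<ε =
    let M , smallˢ = s-null (½ * ε) (½*-pos 0<ε)
        N , smallᵗ = t-null (½ * ε) (½*-pos 0<ε)
    in M ℕ.⊔ N , λ i ≤i → ℚ.≤-trans (ℚ.∣p+q∣≤∣p∣+∣q∣ (s i) (t i))
         (ℚ.≤-trans (ℚ.+-mono-≤ (smallˢ i (ℕ.m⊔n≤o⇒m≤o M N ≤i)) (smallᵗ i (ℕ.m⊔n≤o⇒n≤o M N ≤i)))
                    (ℚ.≤-reflexive (½+½ ε)))

  null-* : ∀ {s} a → Null s → Null (λ i → s i * a)
  null-* {s} a s-null ε 0<ε = let N , small = s-null δ 0<δ in N , λ i N≤i → begin
    ∣ s i * a ∣          ≡⟨ ℚ.∣p*q∣≡∣p∣*∣q∣ (s i) a ⟩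
    ∣ s i ∣ * ∣ a ∣      ≤⟨ ℚ.*-monoʳ-≤-nonNeg ∣ a ∣ {{ℚ.∣-∣-nonNeg a}} (small i N≤i) ⟩
    δ * ∣ a ∣            ≤⟨ ℚ.*-monoˡ-≤-nonNeg δ {{ℚ.nonNegative (ℚ.<⇒≤ 0<δ)}} ∣a∣≤B ⟩
    ε * ℚ.1/ B * B       ≡⟨ trans (ℚ.*-assoc ε (ℚ.1/ B) B)
        (trans (cong (ε *_) (ℚ.*-inverseˡ B)) (ℚ.*-identityʳ ε)) ⟩
    ε                    ∎
    where
    open ℚ.≤-Reasoning
    -- The summand 1 keeps the divisor positive even for a = 0.
    B = 1ℚ + ∣ a ∣
    instance
      B>0 = ℚ.positive {B} (ℚ.+-mono-<-≤ (ℚ.positive⁻¹ 1ℚ) (ℚ.0≤∣p∣ a))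
      B≢0 = ℚ.pos⇒nonZero B
      1/B>0 = ℚ.1/pos⇒pos B
      ε>0 = ℚ.positive 0<ε
    δ = ε * ℚ.1/ B
    0<δ : 0ℚ < δ
    0<δ = ℚ.positive⁻¹ δ {{ℚ.pos*pos⇒pos ε (ℚ.1/ B)}}
    ∣a∣≤B : ∣ a ∣ ≤ B
    ∣a∣≤B = ℚ.≤-trans (ℚ.≤-reflexive (sym (ℚ.+-identityˡ ∣ a ∣)))
        (ℚ.+-monoˡ-≤ ∣ a ∣ (ℚ.<⇒≤ (ℚ.positive⁻¹ 1ℚ)))

  null-sum : ∀ {n} (s : Fin n → ℕ → ℚ) → (∀ k → Null (s k)) → Null (λ i → sum λ k → s k i)
  null-sum {zero}  s null = null-zero λ _ → refl
  null-sum {suc n} s null = null-+ (null zero) (null-sum (s ∘ suc) (null ∘ suc))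

  -- Inside and outside F or R a summand is small for different reasons: either its sequence is null
  -- or its coefficient is zero.
  null-combination : ∀ {n} (s : Fin n → ℕ → ℚ) (a : Vector ℚ n) →
                     (∀ k → Null (s k) ⊎ a k ≡ 0ℚ) → Null (λ i → sum λ k → s k i * a k)
  null-combination s a null = null-sum (λ k i → s k i * a k) λ k → term k (null k)
    where
    term : ∀ k → Null (s k) ⊎ a k ≡ 0ℚ → Null (λ i → s k i * a k)
    term k (inj₁ sk-null) = null-* (a k) sk-null
    term k (inj₂ ak≡0)    = null-zero λ i → trans (cong (s k i *_) ak≡0) (ℚ.*-zeroʳ (s k i))

  -- The way back from ℝ to ℚ. Equality in ℚ is decidable, so a ≢ 0 may be assumed; the choice ε = ½
  -- |a| then contradicts the bound |a| ≤ ε.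
  null-const : ∀ {a} → Null (λ _ → a) → a ≡ 0ℚ
  null-const {a} null = decidable-stable (a ℚ.≟ 0ℚ) λ a≢0 →
    let 0<∣a∣ = ℚ.≰⇒> λ ∣a∣≤0 → a≢0 (ℚ.∣p∣≡0⇒p≡0 a (ℚ.≤-antisym ∣a∣≤0 (ℚ.0≤∣p∣ a)))
        N , small = null (½ * ∣ a ∣) (½*-pos 0<∣a∣)
    in ℚ.<-irrefl refl (ℚ.≤-<-trans (small N ℕ.≤-refl) (half<whole 0<∣a∣))
    where
    half<whole : ∀ {x} → 0ℚ < x → ½ * x < x
    half<whole {x} 0<x = subst₂ _<_ (ℚ.+-identityʳ (½ * x)) (½+½ x) (ℚ.+-monoʳ-< (½ * x) (½*-pos 0<x))

  -- Stated over an abstract ring, since unfolding the operations of ℝ would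
  -- also unfold the proofs of the Cauchy property.
  module _ {a ℓ} (A : RawRing a ℓ) (e : RawRing.Carrier A → ℚ) where
    open RawRing A renaming (_+_ to _⊕_; _*_ to _⊗_)
    open LinearAlgebra A using (combination)

    combination-homo : e 0# ≡ 0ℚ → (∀ x y → e (x ⊕ y) ≡ e x + e y) → (∀ x y → e (x ⊗ y) ≡ e x * e y) →
      ∀ {J : Set} {n} (c : Vector Carrier n) (v : Fin n → J → Carrier) j →
      e (combination c v j) ≡ sum λ i → e (c i) * e (v i j)
    combination-homo 0-homo +-homo *-homo {n = zero}  c v j = 0-homo
    combination-homo 0-homo +-homo *-homo {n = suc n} c v j =
      trans (+-homo (c zero ⊗ v zero j) (combination (c ∘ suc) (v ∘ suc) j))
        (cong₂ _+_ (*-homo (c zero) (v zero j))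
            (combination-homo 0-homo +-homo *-homo (c ∘ suc) (v ∘ suc) j))

  seq-combination : ∀ {J : Set} {n} (c : Vector ℝ n) (v : Fin n → J → ℝ) j k →
                    seq (LinearAlgebra.combination ℝ-rawRing c v j) k ≡ sum λ i → seq (c i) k * seq
                        (v i j) k
  seq-combination c v j k =
    combination-homo ℝ-rawRing (λ x → seq x k) refl (λ _ _ → refl) (λ _ _ → refl) c v j

  ≃0⇒null : ∀ x → x ≃ fromℚ 0ℚ → Null (seq x)
  ≃0⇒null x x≃0 = null-resp {λ i → seq x i - 0ℚ} (λ i → ℚ.+-identityʳ (seq x i)) x≃0

  null⇒≃0 : ∀ x → Null (seq x) → x ≃ fromℚ 0ℚ
  null⇒≃0 x null = null-resp {seq x} (λ i → sym (ℚ.+-identityʳ (seq x i))) null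

  infix 9 _/1
  _/1 : ℤ → ℚ
  z /1 = z ℚ./ 1

  private
    fromℚᵘ-* : ∀ x y → fromℚᵘ (x ℚᵘ.* y) ≡ fromℚᵘ x * fromℚᵘ y
    fromℚᵘ-* x y = ℚ.toℚᵘ-injective (ℚᵘ.≃-trans (ℚ.toℚᵘ-fromℚᵘ (x ℚᵘ.* y)) (ℚᵘ.≃-sym (ℚᵘ.≃-trans
      (ℚ.toℚᵘ-homo-* (fromℚᵘ x) (fromℚᵘ y)) (ℚᵘ.*-cong (ℚ.toℚᵘ-fromℚᵘ x) (ℚ.toℚᵘ-fromℚᵘ y)))))

    fromℚᵘ-+ : ∀ x y → fromℚᵘ (x ℚᵘ.+ y) ≡ fromℚᵘ x + fromℚᵘ y
    fromℚᵘ-+ x y = ℚ.toℚᵘ-injective (ℚᵘ.≃-trans (ℚ.toℚᵘ-fromℚᵘ (x ℚᵘ.+ y)) (ℚᵘ.≃-sym (ℚᵘ.≃-trans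
      (ℚ.toℚᵘ-homo-+ (fromℚᵘ x) (fromℚᵘ y)) (ℚᵘ.+-cong (ℚ.toℚᵘ-fromℚᵘ x) (ℚ.toℚᵘ-fromℚᵘ y)))))

  /1-* : ∀ a b → (a ℤ.* b) /1 ≡ a /1 * b /1
  /1-* a b = fromℚᵘ-* (mkℚᵘ a 0) (mkℚᵘ b 0)

  /1-+ : ∀ a b → (a ℤ.+ b) /1 ≡ a /1 + b /1
  /1-+ a b = trans (cong _/1 (sym (cong₂ ℤ._+_ (ℤ.*-identityʳ a) (ℤ.*-identityʳ b))))
    (fromℚᵘ-+ (mkℚᵘ a 0) (mkℚᵘ b 0))

  /1-injective : ∀ a → a /1 ≡ 0ℚ → a ≡ 0ℤ
  /1-injective a a/1≡0 with ℚ.fromℚᵘ-injective {mkℚᵘ a 0} {mkℚᵘ 0ℤ 0} a/1≡0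
  ... | ℚᵘ.*≡* eq = trans (sym (ℤ.*-identityʳ a)) eq

  /1-sum : ∀ {n} (a b : Vector ℤ n) → ℤLin.sum (λ i → a i ℤ.* b i) /1 ≡ sum λ i → a i /1 * b i /1
  /1-sum {zero}  a b = refl
  /1-sum {suc n} a b = trans (/1-+ (a zero ℤ.* b zero) (ℤLin.sum λ i → a (suc i) ℤ.* b (suc i)))
    (cong₂ _+_ (/1-* (a zero) (b zero)) (/1-sum (a ∘ suc) (b ∘ suc)))

  /1-Id : ∀ {n} (i j : Fin n) → ℤLin.Id i j /1 ≡ Id i j
  /1-Id zero    zero    = refl
  /1-Id zero    (suc j) = refl
  /1-Id (suc i) zero    = refl
  /1-Id (suc i) (suc j) = /1-Id i j

  -- sᵢ is recovered from s A up to an error that only involves the sₗ for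
  -- which row l of A a is not a unit vector.
  null-recover : ∀ {m n} (A : Matrix ℚ m n) (s : Fin m → ℕ → ℚ) (a : Vector ℚ n) i →
    (∀ j → Null (λ k → sum λ l → s l k * A l j) ⊎ a j ≡ 0ℚ) →
    (∀ l → Null (s l) ⊎ sum (λ j → A l j * a j) ≡ Id l i) → Null (s i)
  null-recover A s a i sA-null Aa≡Id = null-resp recover (null-+
    (null-combination (λ j k → sum λ l → s l k * A l j) a sA-null)
    (null-combination s (λ l → Id l i - Aa l) λ l → error l (Aa≡Id l)))
    where
    open ≡-Reasoning
    Aa = λ l → sum λ j → A l j * a j
    error : ∀ l → Null (s l) ⊎ Aa l ≡ Id l i → Null (s l) ⊎ Id l i - Aa l ≡ 0ℚ
    error l (inj₁ null) = inj₁ null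
    error l (inj₂ eq)   = inj₂ (trans (cong (λ z → Id l i - z) eq) (ℚ.+-inverseʳ (Id l i)))
    recover : ∀ k → sum (λ j → sum (λ l → s l k * A l j) * a j) + sum
        (λ l → s l k * (Id l i - Aa l)) ≡ s i k
    recover k = begin
      sum (λ j → sum (λ l → s l k * A l j) * a j) + sum (λ l → s l k * (Id l i - Aa l))
        ≡⟨ cong (_+ sum (λ l → s l k * (Id l i - Aa l))) (sum-assoc (λ l → s l k) A a) ⟩
      sum (λ l → s l k * Aa l) + sum (λ l → s l k * (Id l i - Aa l))
        ≡⟨ ∑-distrib-+ (λ l → s l k * Aa l) (λ l → s l k * (Id l i - Aa l)) ⟨
      sum (λ l → s l k * Aa l + s l k * (Id l i - Aa l))
        ≡⟨ sum-cong-≗ (λ l → solve 3 (λ s x y → s :* x :+ s :* (y :- x) := s :* y) refl (s l k) (Aa l)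
             (Id l i)) ⟩
      sum (λ l → s l k * Id l i)
        ≡⟨ sum-Idʳ (λ l → s l k) i ⟩
      s i k ∎

  -- Independence and bases over ℝ for a rational matrix.

  -- The real families enter only through the terms of their sequences, which are constant with
  -- entries of M. One M thus serves both the columns and the rows cut down to F.
  module RationalMatrix {p q} (M : Matrix ℚ p q) (F : Subset q) (R : Subset p)
    (cols : Fin q → Fin p → RawRing.Carrier ℝ-rawRing) (seq-cols : ∀ f r k → seq (cols f r) k ≡ M r f)
    (rows : Fin p → (∃ λ f → f ∈ F) → RawRing.Carrier ℝ-rawRing)
        (seq-rows : ∀ r j k → seq (rows r j) k ≡ M r (proj₁ j))
    where

    combine-cols : ∀ (c : Vector ℝ q) r k → seq
        (LinearAlgebra.combination ℝ-rawRing c cols r) k ≡ sum λ f → seq (c f) k * M r f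
    combine-cols c r k = trans (seq-combination c cols r k)
        (sum-cong-≗ λ f → cong (seq (c f) k *_) (seq-cols f r k))

    combine-rows : ∀ (c : Vector ℝ p) j k → seq
        (LinearAlgebra.combination ℝ-rawRing c rows j) k ≡ sum λ r → seq (c r) k * M r (proj₁ j)
    combine-rows c j k = trans (seq-combination c rows j k)
        (sum-cong-≗ λ r → cong (seq (c r) k *_) (seq-rows r j k))

    IndependentColumns BasisRows : Set
    IndependentColumns = LinearAlgebra.LinearlyIndependent ℝ-rawRing cols F
    BasisRows = LinearAlgebra.IsBasis ℝ-rawRing rows (∁ R) (LinearAlgebra.RowSpace ℝ-rawRing rows)

    module _ (Q : Matrix ℚ q p)
             (Q-∉F : ∀ {f} → f ∉ F → ∀ r → Q f r ≡ 0ℚ)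
             (Q-∈R : ∀ {r} → r ∈ R → ∀ f → Q f r ≡ 0ℚ)
             (M⊗Q  : ∀ {r} → r ∉ R → ∀ i → sum (λ f → M r f * Q f i) ≡ Id r i)
             (Q⊗M  : ∀ {f f′} → f ∈ F → f′ ∈ F → sum (λ r → Q f r * M r f′) ≡ Id f f′)
             where
      open ≡-Reasoning

      -- Multiplying M c = 0 by row f of Q returns c_f, because Q M is the identity on F and the
      -- coefficients outside F are null already.
      independentColumns : IndependentColumns
      independentColumns c c∈F cM≃0 f = case f ∈? F of λ
        { (no f∉F) → c∈F f f∉F
        ; (yes f∈F) → null⇒≃0 (c f) (null-recover (λ f r → M r f) (λ f → seq (c f)) (Q f) f
          (λ r → inj₁ (null-resp {seq (LinearAlgebra.combination ℝ-rawRing c cols r)} (combine-cols c r)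
            (≃0⇒null (LinearAlgebra.combination ℝ-rawRing c cols r) (cM≃0 r)))) (unit f∈F))
        }
        where
        unit : f ∈ F → ∀ f′ → Null (seq (c f′)) ⊎ sum (λ r → M r f′ * Q f r) ≡ Id f′ f
        unit f∈F f′ = case f′ ∈? F of λ
          { (no f′∉F) → inj₁ (≃0⇒null (c f′) (c∈F f′ f′∉F))
          ; (yes f′∈F) → inj₂ (trans (sum-cong-≗ λ r → ℚ.*-comm (M r f′) (Q f r))
            (trans (Q⊗M f∈F f′∈F) (Id-sym f f′)))
          }

      -- For independence, multiplying c M = 0 on the right by Q returns the coefficients outside R.
      -- For spanning, arbitrary coefficients are pushed into ∁ R by the matrix M Q.
      basisRows : BasisRows
      basisRows = independent , λ w → mk⇔
        (λ (c , _ , eq) → c , (λ i i∉⊤ → contradiction ∈⊤ i∉⊤) , eq)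
        -- For G = M Q one has G M = M on the columns in F, and G has zero columns at R. So c G
        -- gives the same combination of rows as c and is supported on ∁ R.
        (λ (c , _ , eq) → LinearAlgebra.combination ℝ-rawRing c Gℝ , supported c , respan w c eq)
        where
        independent : LinearAlgebra.LinearlyIndependent ℝ-rawRing rows (∁ R)
        independent c c∈∁R cM≃0 i = case i ∈? R of λ
          { (yes i∈R) → c∈∁R i (x∈p⇒x∉∁p i∈R)
          ; (no i∉R) → null⇒≃0 (c i) (null-recover M (λ r → seq (c r)) (λ f → Q f i) i known unit)
          }
          where
          known : ∀ f → Null (λ k → sum λ r → seq (c r) k * M r f) ⊎ Q f i ≡ 0ℚ
          known f = case f ∈? F of λ
            { (no f∉F) → inj₂ (Q-∉F f∉F i)
            ; (yes f∈F) → inj₁ (null-resp {seq (LinearAlgebra.combination ℝ-rawRing c rows (f , f∈F))}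
                (combine-rows c (f , f∈F))
              (≃0⇒null (LinearAlgebra.combination ℝ-rawRing c rows (f , f∈F)) (cM≃0 (f , f∈F))))
            }
          unit : ∀ r → Null (seq (c r)) ⊎ sum (λ f → M r f * Q f i) ≡ Id r i
          unit r = case r ∈? R of λ
            { (yes r∈R) → inj₁ (≃0⇒null (c r) (c∈∁R r (x∈p⇒x∉∁p r∈R)))
            ; (no r∉R) → inj₂ (M⊗Q r∉R i)
            }

        G : Matrix ℚ p p
        G r i = sum λ f → M r f * Q f i

        Gℝ : Matrix ℝ p p
        Gℝ r i = fromℚ (G r i)

        supported : ∀ (c : Vector ℝ p) → LinearAlgebra.SupportedOn ℝ-rawRing (∁ R)
            (LinearAlgebra.combination ℝ-rawRing c Gℝ)
        supported c i i∉∁R = null⇒≃0 (LinearAlgebra.combination ℝ-rawRing c Gℝ i)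
            (null-zero λ k → trans (seq-combination c Gℝ i k)
          (sum-zero λ r → trans (cong (seq (c r) k *_) (sum-zero λ f →
            trans (cong (M r f *_) ((Q-∈R (x∉∁p⇒x∈p i∉∁R) f))) (ℚ.*-zeroʳ (M r f))))
            (ℚ.*-zeroʳ (seq (c r) k))))

        G⊗M : ∀ r {f} → f ∈ F → sum (λ i → G r i * M i f) ≡ M r f
        G⊗M r {f} f∈F = begin
          sum (λ i → G r i * M i f)
            ≡⟨ sum-assoc (M r) Q (λ i → M i f) ⟩
          sum (λ f′ → M r f′ * sum (λ i → Q f′ i * M i f))
            ≡⟨ sum-cong-≗ (λ f′ → cong (M r f′ *_) (entry f′)) ⟩
          sum (λ f′ → M r f′ * Id f′ f)
            ≡⟨ sum-Idʳ (M r) f ⟩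
          M r f ∎
          where
          entry : ∀ f′ → sum (λ i → Q f′ i * M i f) ≡ Id f′ f
          entry f′ = case f′ ∈? F of λ
            { (yes f′∈F) → Q⊗M f′∈F f∈F
            ; (no f′∉F) → trans (sum-zero λ i → trans (cong (_* M i f) (Q-∉F f′∉F i))
                (ℚ.*-zeroˡ (M i f)))
              (sym (Id-≢ {i = f′} {f} λ { refl → f′∉F f∈F }))
            }

        same : ∀ (c : Vector ℝ p) {f} (f∈F : f ∈ F) k →
               seq (LinearAlgebra.combination ℝ-rawRing (LinearAlgebra.combination ℝ-rawRing c Gℝ) rows
                   (f , f∈F)) k ≡ seq (LinearAlgebra.combination ℝ-rawRing c rows (f , f∈F)) k
        same c {f} f∈F k = begin
          seq (LinearAlgebra.combination ℝ-rawRing (LinearAlgebra.combination ℝ-rawRing c Gℝ) rows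
              (f , f∈F)) k
            ≡⟨ combine-rows (LinearAlgebra.combination ℝ-rawRing c Gℝ) (f , f∈F) k ⟩
          sum (λ i → seq (LinearAlgebra.combination ℝ-rawRing c Gℝ i) k * M i f)
            ≡⟨ sum-cong-≗ (λ i → cong (_* M i f) (seq-combination c Gℝ i k)) ⟩
          sum (λ i → sum (λ r → seq (c r) k * G r i) * M i f)
            ≡⟨ sum-assoc (λ r → seq (c r) k) G (λ i → M i f) ⟩
          sum (λ r → seq (c r) k * sum (λ i → G r i * M i f))
            ≡⟨ sum-cong-≗ (λ r → cong (seq (c r) k *_) (G⊗M r f∈F)) ⟩
          sum (λ r → seq (c r) k * M r f)
            ≡⟨ combine-rows c (f , f∈F) k ⟨
          seq (LinearAlgebra.combination ℝ-rawRing c rows (f , f∈F)) k ∎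

        respan : ∀ (w : (∃ λ f → f ∈ F) → ℝ) (c : Vector ℝ p) →
            (∀ j → LinearAlgebra.combination ℝ-rawRing c rows j ≃ w j) →
                 ∀ j → LinearAlgebra.combination ℝ-rawRing
                     (LinearAlgebra.combination ℝ-rawRing c Gℝ) rows j ≃ w j
        respan w c eq (f , f∈F) = null-resp
          {λ k → seq (LinearAlgebra.combination ℝ-rawRing c rows (f , f∈F)) k - seq (w (f , f∈F)) k}
          {λ k → seq (LinearAlgebra.combination ℝ-rawRing
              (LinearAlgebra.combination ℝ-rawRing c Gℝ) rows (f , f∈F)) k - seq (w (f , f∈F)) k}
          (λ k → cong (_- seq (w (f , f∈F)) k) (sym (same c f∈F k))) (eq (f , f∈F))

    module _ (x : Vector ℚ q) (x∈F : ∀ f → f ∉ F → x f ≡ 0ℚ)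
             (Mx≡0 : ∀ r → r ∉ R → sum (λ f → M r f * x f) ≡ 0ℚ) where
      open ≡-Reasoning
      private
        Mx : Vector ℚ p
        Mx r = sum λ f → M r f * x f

      -- Row r lies in the row space by a unit vector, hence is a combination of the rows outside R
      -- on the columns in F. As x is supported on F, (M x)_r is the same combination of the entries
      -- of M x outside R, all of which vanish.
      spanned : BasisRows → ∀ r → Null (λ _ → Mx r)
      spanned (_ , spans) r = relate (Equivalence.from (spans (rows r))
          (unit , (λ i i∉⊤ → contradiction ∈⊤ i∉⊤) , unit-combination))
        where
        unit : Vector ℝ p
        unit i = fromℚ (Id r i)
        unit-combination : ∀ j → LinearAlgebra.combination ℝ-rawRing unit rows j ≃ rows r j
        unit-combination (f , f∈F) = null-zero
            {λ k → seq (LinearAlgebra.combination ℝ-rawRing unit rows (f , f∈F)) k - seq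
            (rows r (f , f∈F)) k} λ k →
          trans (cong₂ _-_ (trans (combine-rows unit (f , f∈F) k) (sum-Idˡ r (λ i → M i f)))
              (seq-rows r (f , f∈F) k))
                (ℚ.+-inverseʳ (M r f))
        relate : LinearAlgebra.Span ℝ-rawRing rows (∁ R) (rows r) → Null (λ _ → Mx r)
        -- (M x)_r equals Σᵢ cᵢ (M x)ᵢ minus the pairing with x of the error c M - M_r, which is
        -- null on F.
        relate (c , c∈∁R , cM≃Mr) = null-resp recombine (null-+
              (null-combination (λ i → seq (c i)) Mx vanish)
              (null-combination (λ f k → sum (λ i → seq (c i) k * M i f) - M r f) (λ f → - x f) close))
          where
          vanish : ∀ i → Null (seq (c i)) ⊎ Mx i ≡ 0ℚ
          vanish i = case i ∈? R of λ
            { (yes i∈R) → inj₁ (≃0⇒null (c i) (c∈∁R i (x∈p⇒x∉∁p i∈R)))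
            ; (no i∉R) → inj₂ (Mx≡0 i i∉R)
            }
          close : ∀ f → Null (λ k → sum (λ i → seq (c i) k * M i f) - M r f) ⊎ - x f ≡ 0ℚ
          close f = case f ∈? F of λ
            { (no f∉F) → inj₂ (cong -_ (x∈F f f∉F))
            ; (yes f∈F) → inj₁ (null-resp {λ k → seq
                (LinearAlgebra.combination ℝ-rawRing c rows (f , f∈F)) k - seq (rows r (f , f∈F)) k}
              (λ k → cong₂ _-_ (combine-rows c (f , f∈F) k) (seq-rows r (f , f∈F) k)) (cM≃Mr (f , f∈F)))
            }
          recombine : ∀ k → sum (λ i → seq (c i) k * Mx i) + sum
              (λ f → (sum (λ i → seq (c i) k * M i f) - M r f) * - x f) ≡ Mx r
          recombine k = begin
            sum (λ i → s i * Mx i) + sum (λ f → (sM f - M r f) * - x f)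
              ≡⟨ cong (_+ sum (λ f → (sM f - M r f) * - x f)) (sum-assoc s M x) ⟨
            sum (λ f → sM f * x f) + sum (λ f → (sM f - M r f) * - x f)
              ≡⟨ ∑-distrib-+ (λ f → sM f * x f) (λ f → (sM f - M r f) * - x f) ⟨
            sum (λ f → sM f * x f + (sM f - M r f) * - x f)
              ≡⟨ sum-cong-≗ (λ f → solve 3 (λ a b x → a :* x :+ (a :- b) :* :- x := b :* x) refl (sM f)
                   (M r f) (x f)) ⟩
            Mx r ∎
            where
            s = λ i → seq (c i) k
            sM = λ f → sum λ i → s i * M i f

      private
        xℝ : Vector ℝ q
        xℝ f = fromℚ (x f)

        xℝ-supported : LinearAlgebra.SupportedOn ℝ-rawRing F xℝ
        xℝ-supported f f∉F = null⇒≃0 (xℝ f) (null-zero λ _ → x∈F f f∉F)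

        xℝ-null : BasisRows → ∀ r → LinearAlgebra.combination ℝ-rawRing xℝ cols r ≃ fromℚ 0ℚ
        xℝ-null basis r = null⇒≃0 (LinearAlgebra.combination ℝ-rawRing xℝ cols r)
            (null-resp {λ _ → Mx r}
          (λ k → trans (sum-cong-≗ λ f → ℚ.*-comm (M r f) (x f)) (sym (combine-cols xℝ r k)))
          (spanned basis r))

      -- The relation x is given only in the rows outside R. `spanned` extends it to all rows, where
      -- independence of the columns applies.
      null-columns : IndependentColumns → BasisRows → ∀ f → x f ≡ 0ℚ
      null-columns forest basis f = null-const
          (≃0⇒null (xℝ f) (forest xℝ xℝ-supported (xℝ-null basis) f))

    module _ (y : Vector ℚ p) (y∈∁R : ∀ r → r ∈ R → y r ≡ 0ℚ)
             (yM≡0 : ∀ f → f ∈ F → sum (λ r → y r * M r f) ≡ 0ℚ) where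
      private
        yℝ : Vector ℝ p
        yℝ r = fromℚ (y r)

        yℝ-supported : LinearAlgebra.SupportedOn ℝ-rawRing (∁ R) yℝ
        yℝ-supported r r∉∁R = null⇒≃0 (yℝ r) (null-zero λ _ → y∈∁R r (x∉∁p⇒x∈p r∉∁R))

        yℝ-null : ∀ j → LinearAlgebra.combination ℝ-rawRing yℝ rows j ≃ fromℚ 0ℚ
        yℝ-null j = null⇒≃0 (LinearAlgebra.combination ℝ-rawRing yℝ rows j) (null-zero λ k →
          trans (combine-rows yℝ j k) (yM≡0 (proj₁ j) (proj₂ j)))

      null-rows : BasisRows → ∀ r → y r ≡ 0ℚ
      null-rows (independent , _) r = null-const
          (≃0⇒null (yℝ r) (independent yℝ yℝ-supported yℝ-null r))

  module _ {p q} (M : Matrix ℤ p q) (F : Subset q) (R : Subset p) where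
    private
      Mℚ : Matrix ℚ p q
      Mℚ r f = M r f /1

    module _ (cols : Fin q → Fin p → RawRing.Carrier ℝ-rawRing)
        (seq-cols : ∀ f r k → seq (cols f r) k ≡ Mℚ r f)
             (rows : Fin p → (∃ λ f → f ∈ F) → RawRing.Carrier ℝ-rawRing)
             (seq-rows : ∀ r j k → seq (rows r j) k ≡ Mℚ r (proj₁ j)) where
      private
        module MQ = RationalMatrix Mℚ F R cols seq-cols rows seq-rows
      open MQ using (IndependentColumns; BasisRows) public

      module _ (inverse : MinorInverse M F R) where
        open MinorInverse inverse
        open ≡-Reasoning

        private
          instance
            scale-nonZero : ℚ.NonZero (scale /1)
            scale-nonZero = ℚ.≢-nonZero (scale≢0 ∘ /1-injective scale)

          1/s = ℚ.1/ (scale /1)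

          Qℚ : Matrix ℚ q p
          Qℚ f r = Q f r /1 * 1/s

          Qℚ-zero : ∀ {f r} → Q f r ≡ 0ℤ → Qℚ f r ≡ 0ℚ
          Qℚ-zero eq = trans (cong (λ z → z /1 * 1/s) eq) (ℚ.*-zeroˡ 1/s)

          unscale : ∀ {x i j} {n} {k l : Fin n} → x ≡
              (scale ℤ.* ℤLin.Id k l) /1 → i ≡ x * 1/s → j ≡ Id k l → i ≡ j
          unscale {k = k} {l} refl refl refl = begin
            (scale ℤ.* ℤLin.Id k l) /1 * 1/s
                ≡⟨ cong (_* 1/s) (trans (/1-* scale (ℤLin.Id k l)) (cong (scale /1 *_) (/1-Id k l))) ⟩
            scale /1 * Id k l * 1/s
                ≡⟨ solve 3 (λ a b c → a :* b :* c := b :* (a :* c)) refl (scale /1) (Id k l) 1/s ⟩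
            Id k l * (scale /1 * 1/s)
                ≡⟨ trans (cong (Id k l *_) (ℚ.*-inverseʳ (scale /1))) (ℚ.*-identityʳ (Id k l)) ⟩
            Id k l                               ∎

          Mℚ⊗Qℚ : ∀ {r} → r ∉ R → ∀ i → sum (λ f → Mℚ r f * Qℚ f i) ≡ Id r i
          Mℚ⊗Qℚ {r} r∉R i = unscale {k = r} {i}
              (trans (sym (/1-sum (M r) (λ f → Q f i))) (cong _/1 (M⊗Q r∉R i)))
            (trans (sum-cong-≗ λ f → sym (ℚ.*-assoc (Mℚ r f) (Q f i /1) 1/s))
                (sym (*-distribʳ-sum 1/s (λ f → Mℚ r f * Q f i /1)))) refl

          Qℚ⊗Mℚ : ∀ {f f′} → f ∈ F → f′ ∈ F → sum (λ r → Qℚ f r * Mℚ r f′) ≡ Id f f′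
          Qℚ⊗Mℚ {f} {f′} f∈F f′∈F = unscale {k = f} {f′}
              (trans (sym (/1-sum (Q f) (λ r → M r f′))) (cong _/1 (Q⊗M f∈F f′∈F)))
            (trans (sum-cong-≗ λ r → solve 3 (λ a b c → a :* b :* c := a :* c :* b) refl (Q f r /1) 1/s
                (Mℚ r f′))
              (sym (*-distribʳ-sum 1/s (λ r → Q f r /1 * Mℚ r f′)))) refl

        independent×basis : IndependentColumns × BasisRows
        independent×basis = MQ.independentColumns Qℚ Qℚ-∉F Qℚ-∈R Mℚ⊗Qℚ Qℚ⊗Mℚ
                          , MQ.basisRows Qℚ Qℚ-∉F Qℚ-∈R Mℚ⊗Qℚ Qℚ⊗Mℚ
          where
          Qℚ-∉F : ∀ {f} → f ∉ F → ∀ r → Qℚ f r ≡ 0ℚ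
          Qℚ-∉F f∉F r = Qℚ-zero (Q-∉F f∉F r)
          Qℚ-∈R : ∀ {r} → r ∈ R → ∀ f → Qℚ f r ≡ 0ℚ
          Qℚ-∈R r∈R f = Qℚ-zero (Q-∈R r∈R f)

      ¬dependentRows : DependentRows M F R → ¬ BasisRows
      ¬dependentRows (y , y∈∁R , yM≡0 , y≢0) basis = y≢0 λ r → /1-injective (y r)
        (MQ.null-rows (_/1 ∘ y) (λ r r∈R → cong _/1 (y∈∁R r r∈R))
          (λ f f∈F → trans (sym (/1-sum y (λ r → M r f))) (cong _/1 (yM≡0 f f∈F))) basis r)

      ¬dependentColumns : DependentColumns M F R → IndependentColumns → ¬ BasisRows
      ¬dependentColumns (x , x∈F , Mx≡0 , x≢0) forest basis = x≢0 λ f → /1-injective (x f)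
        (MQ.null-columns (_/1 ∘ x) (λ f f∉F → cong _/1 (x∈F f f∉F))
          (λ r r∉R → trans (sym (/1-sum (M r) x)) (cong _/1 (Mx≡0 r r∉R))) forest basis f)

-- Rooted forests as the pairs with nonzero minor.

module _ {n} (G : SimplicialComplex n) (d : ℕ) where
  open ≡ using (refl; trans)
  open import Data.Vec.Base using (_++_)
  open Reals

  minorOf : FaceSets G d → ℤ
  minorOf (F , R) = minorAt (∂ G d) F R

  nonzero⇒rooted : ∀ F R → minorOf (F , R) ≢ 0ℤ → RootedForest G d (F , R)
  nonzero⇒rooted F R c≢0 =
    independent×basis (∂ G d) F R (∂ℝ G d ᵀ) (λ _ _ _ → refl) (columns G d F) (λ _ _ _ → refl)
      (minorInverse (∂ G d) F R c≢0)

  rooted⇒nonzero : ∀ F R → RootedForest G d (F , R) → minorOf (F , R) ≢ 0ℤ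
  rooted⇒nonzero F R (forest , root) c≡0 = case minorAt≡0⇒dependent (∂ G d) F R c≡0 of λ
    { (inj₁ dependent) → ¬dependentColumns (∂ G d) F R
        (∂ℝ G d ᵀ) (λ _ _ _ → refl) (columns G d F) (λ _ _ _ → refl) dependent forest root
    ; (inj₂ dependent) → ¬dependentRows (∂ G d) F R
        (∂ℝ G d ᵀ) (λ _ _ _ → refl) (columns G d F) (λ _ _ _ → refl) dependent root
    }

  -- Independence and bases over the Cauchy reals bring no decision procedure of their own;
  -- comparing one integer with zero supplies it.
  rooted? : Decidable (RootedForest G d)
  rooted? (F , R) = case minorOf (F , R) ℤ.≟ 0ℤ of λ
    { (yes c≡0) → no λ rooted → rooted⇒nonzero F R rooted c≡0
    ; (no c≢0)  → yes (nonzero⇒rooted F R c≢0)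
    }

  ¬rooted⇒zero : ∀ FR → ¬ RootedForest G d FR → minorOf FR ≡ 0ℤ
  ¬rooted⇒zero (F , R) ¬rooted =
    decidable-stable (minorOf (F , R) ℤ.≟ 0ℤ) λ c≢0 → ¬rooted (nonzero⇒rooted F R c≢0)

  -- Two chains are identified exactly when their difference lies in the span of the unit vectors at
  -- R and the columns of the boundary matrix at F. This is the span of the selected columns of
  -- `Id∣_`, whose cokernel has been measured.
  homology-size : ∀ FR → RootedForest G d FR → RelativeHomology G d FR HasCardinality ℤ.∣ minorOf FR ∣
  homology-size (F , R) rooted = record
    { to        = to
    ; from      = from
    ; to-cong   = λ {u} {v} u∼v → to-cong u v (relation⇒∼ (∂ G d) F R u v u∼v)
    ; from-cong = λ {i} {j} i≡j → ∼⇒relation (∂ G d) F R (from i) (from j)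
        (to-injective (from i) (from j) (cong (λ k → to (from k)) i≡j))
    ; inverse   = (λ {i} {u} u∼from → trans
        (to-cong u (from i) (relation⇒∼ (∂ G d) F R u (from i) u∼from)) (to∘from i))
                , (λ {u} {i} i≡to → ∼⇒relation (∂ G d) F R (from i) u
                    (to-injective (from i) u (trans (to∘from i) i≡to)))
    }
    where
    open IntegerMatrix.CokernelHasSize
        (SelectedColumns.cokernel-select (Exterior.Id∣_ ℤ.+-*-commutativeRing (∂ G d)) (R ++ F)
        (rooted⇒nonzero F R rooted))

open import Data.Fin.Subset using (∣_∣)

-- The order of the homology is a function on all pairs, required to be correct on rooted forests.
-- The indeterminates of the second ring list the x before the y, in the order of the columns of
-- `Id∣_`.
theorem19 :
    ∀ {n} (G : SimplicialComplex n) (d : ℕ) → HasDimension G d →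
    Σ[ rootedForest? ∈ Decidable (RootedForest G d) ]
    Σ[ ∣H∣ ∈ (FaceSets G d → ℕ) ]
    (∀ FR → RootedForest G d FR → RelativeHomology G d FR HasCardinality ∣H∣ FR) ×
    (let rootedForests = filter rootedForest? (faceSets G d)
         p = #faces G d
         q = #faces G (suc d)
     in
      (let open RawRing ℤ[ 1 ]
           open LinearAlgebra ℤ[ 1 ]
           x = var zero
           L = mapMatrix const (laplacian G d)
       in
         ∑-list rootedForests (λ (F , R) → const (+ ∣H∣ (F , R)) ^ 2 * x ^ ∣ R ∣)
           ≈ det (L ⊕ x · Id))
      ×
      (let open RawRing ℤ[ p +ℕ q ]
           open LinearAlgebra ℤ[ p +ℕ q ]
           x = λ r → var (r ↑ˡ q)
           y = λ f → var (p ↑ʳ f)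
           D = mapMatrix const (∂ G d)
           L = D ⊗ diagonal y ⊗ D ᵀ
       in
         ∑-list rootedForests (λ (F , R) →
             const (+ ∣H∣ (F , R)) ^ 2 * (∏[∈ R ] x) * (∏[∈ F ] y))
           ≈ det (L ⊕ diagonal x)))
theorem19 G d _ = rooted? G d , (λ FR → ℤ.∣ minorOf G d FR ∣) , homology-size G d
  , FromIntegers.det-uniform (Polynomial.commutativeRing 1) const
      (Polynomial.const-isRingHomomorphism 1)
      (∂ G d) (var zero) (rooted? G d) (¬rooted⇒zero G d)
  , FromIntegers.det-weighted (Polynomial.commutativeRing (p +ℕ q)) const
      (Polynomial.const-isRingHomomorphism (p +ℕ q))
      (∂ G d) (λ r → var (r ↑ˡ q)) (λ f → var (p ↑ʳ f)) (rooted? G d) (¬rooted⇒zero G d)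
  where
  p = #faces G d
  q = #faces G (suc d)
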